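{- Let $R$ be a simply-connected region in the plane and let $v,w$ be vertices in the interior of $R$, such that there is a path of $m$ vertices from $v$ to $w$, staying entirely within $R$. Then, for all $c>0$, the probability that $H(v)-H(w)$ (under the uniform distribution on domino tilings of $R$) differs from its expected value by more than $c\sqrt m$ is less than $2e^{ -c^2/32}$.
   Context: A region is a finite union of unit squares of the square lattice that can be tiled by dominos, with a fixed checkerboard coloring of the lattice squares. A path is a lattice path: a sequence of vertices with consecutive ones joined by an edge of a lattice square of $R$. A height function on $R$ is an integer-valued function $h$ on the vertices of the lattice squares of $R$ such that, for adjacent vertices $u,u'$: if the edge $uu'$ is part of the boundary of $R$ then $|h(u)-h(u')|=1$, and if the directed edge from $u$ to $u'$ has a black square on its left then $h(u')$ is either $h(u)+1$ or $h(u)-3$. Each domino tiling of $R$ arises from a height function (the dominos being those bisected by the edges $uu'$ with $|h(u)-h(u')|=3$), unique up to an additive constant; fixing the height of one boundary vertex makes this a bijection. $H$ denotes the height function of a uniformly random domino tiling of $R$ (the difference $H(v)-H(w)$ does not depend on the additive constant). -}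

module Defs where

open import Data.Bool using (Bool; true; not)
open import Data.Empty using (⊥-elim)
open import Data.Integer as ℤ using (ℤ; +_)
import Data.Integer.Properties as ℤ
open import Data.List using (List; []; _∷_; _++_; map; filter; foldr; length; cartesianProduct)
open import Data.List.Membership.Propositional using (_∈_; _∉_)
open import Data.List.Relation.Unary.All using (All; all?)
open import Data.List.Relation.Unary.Any using (Any; here; there)
open import Data.List.Relation.Unary.Unique.Propositional using (Unique)
open import Data.Nat as ℕ using (ℕ; zero; suc; s≤s; z≤n)
import Data.Nat.Properties as ℕ
open import Data.Nat.Coprimality as Coprime using (1-coprimeTo)
open import Data.Product using (∃; _×_; _,_; proj₁; proj₂)
open import Data.Product.Properties using (≡-dec)
open import Data.Rational as ℚ using (ℚ; mkℚ; 0ℚ; 1ℚ; _+_; _*_; _-_; -_; _÷_; ∣_∣; _≤_; _<_; *≤*)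
open import Data.Rational.Properties
open import Data.Rational.Solver renaming (module +-*-Solver to ℚ-Solver)
import Data.Rational.Unnormalised as ℚᵘ
open import Data.Sum using (_⊎_; inj₁; inj₂)
open import Function using (_⇔_)
open import Level using (0ℓ)
open import Relation.Binary using (Rel)
open import Relation.Binary.Construct.Closure.Equivalence using (EqClosure)
open import Relation.Binary.PropositionalEquality
  using (_≡_; refl; sym; trans; cong; cong₂; subst; subst₂)
open import Relation.Nullary using (Dec; yes; no)
open import Relation.Unary using (Pred; Decidable)

fromℕ : ℕ → ℚ
fromℕ n = mkℚ (+ n) 0 (Coprime.sym (1-coprimeTo n))

module Rational-Lemmas where

  fromℕ-* : ∀ m n → fromℕ (m ℕ.* n) ≡ fromℕ m * fromℕ n
  fromℕ-* m n = toℚᵘ-injective (ℚᵘ.≃-trans lemma (ℚᵘ.≃-sym (toℚᵘ-homo-* (fromℕ m) (fromℕ n))))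
    where
    import Data.Rational.Unnormalised.Properties as ℚᵘ
    lemma : ℚ.toℚᵘ (fromℕ (m ℕ.* n)) ℚᵘ.≃ ℚ.toℚᵘ (fromℕ m) ℚᵘ.* ℚ.toℚᵘ (fromℕ n)
    lemma = ℚᵘ.*≡* (cong (ℤ._* + 1) (ℤ.pos-* m n))

  fromℕ-mono : ∀ {m n} → m ℕ.≤ n → fromℕ m ≤ fromℕ n
  fromℕ-mono m≤n = *≤* (ℤ.*-monoʳ-≤-nonNeg (+ 1) (ℤ.+≤+ m≤n))

  archimedean : ∀ q → ∃ λ n → q ≤ fromℕ n
  archimedean q@(mkℚ (+ n) d _) = n , *≤* (ℤ.≤-trans (ℤ.≤-reflexive (ℤ.*-identityʳ (+ n)))
    (ℤ.≤-trans (ℤ.+≤+ (ℕ.m≤m*n n (suc d))) (ℤ.≤-reflexive (ℤ.pos-* n (suc d)))))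
  archimedean (mkℚ ℤ.-[1+ n ] d _) = 0 , *≤* ℤ.-≤+

  inv : ℕ → ℚ
  inv k = ℚ.1/ fromℕ (suc k)

  *-monoˡ : ∀ {r p q} → 0ℚ ≤ r → p ≤ q → r * p ≤ r * q
  *-monoˡ {r} 0≤r = *-monoˡ-≤-nonNeg r {{ℚ.nonNegative 0≤r}}

  *-monoʳ : ∀ {r p q} → 0ℚ ≤ r → p ≤ q → p * r ≤ q * r
  *-monoʳ {r} 0≤r = *-monoʳ-≤-nonNeg r {{ℚ.nonNegative 0≤r}}

  *-mono : ∀ {p q r s} → 0ℚ ≤ r → 0ℚ ≤ q → p ≤ q → r ≤ s → p * r ≤ q * s
  *-mono 0≤r 0≤q p≤q r≤s = ≤-trans (*-monoʳ 0≤r p≤q) (*-monoˡ 0≤q r≤s)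

  0≤* : ∀ {p q} → 0ℚ ≤ p → 0ℚ ≤ q → 0ℚ ≤ p * q
  0≤* {p} {q} 0≤p 0≤q = ≤-trans (≤-reflexive (sym (*-zeroʳ p))) (*-monoˡ 0≤p 0≤q)

  0<* : ∀ {p q} → 0ℚ < p → 0ℚ < q → 0ℚ < p * q
  0<* {p} {q} 0<p 0<q =
    positive⁻¹ (p * q) {{pos*pos⇒pos p {{ℚ.positive 0<p}} q {{ℚ.positive 0<q}}}}

  0≤+ : ∀ {p q} → 0ℚ ≤ p → 0ℚ ≤ q → 0ℚ ≤ p + q
  0≤+ 0≤p 0≤q = +-mono-≤ 0≤p 0≤q

  shrink : ∀ q ε → 0ℚ ≤ q → 0ℚ < ε → ∃ λ δ → 0ℚ < δ × δ * q ≤ ε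
  shrink q ε 0≤q 0<ε with archimedean q
  ... | n , q≤n = ε * inv n , 0<* 0<ε (positive⁻¹ (inv n)) ,
    ≤-trans (*-monoˡ (<⇒≤ (0<* 0<ε (positive⁻¹ (inv n)))) (≤-trans q≤n (fromℕ-mono (ℕ.n≤1+n n))))
      (≤-reflexive (trans (*-assoc ε (inv n) _)
        (trans (cong (ε *_) (*-inverseˡ (fromℕ (suc n)))) (*-identityʳ ε))))

  vanish : ∀ q ε → 0ℚ ≤ q → 0ℚ < ε → ∃ λ N → ∀ n → N ℕ.≤ n → q * inv n ≤ ε
  vanish q ε 0≤q 0<ε = N , λ n N≤n →
      ≤-trans (*-monoʳ (<⇒≤ (positive⁻¹ (inv n)))
                 (≤-trans bound (*-monoˡ (<⇒≤ 0<ε) (fromℕ-mono (ℕ.≤-trans N≤n (ℕ.n≤1+n n))))))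
        (≤-reflexive (trans (*-assoc ε _ _)
          (trans (cong (ε *_) (*-inverseʳ (fromℕ (suc n)))) (*-identityʳ ε))))
    where
    instance
      ε≢0 : ℚ.NonZero ε
      ε≢0 = ℚ.>-nonZero 0<ε
    N = proj₁ (archimedean (q * ℚ.1/ ε))
    bound : q ≤ ε * fromℕ N
    bound = ≤-trans
      (≤-reflexive (sym (trans (*-comm ε _) (trans (*-assoc q (ℚ.1/ ε) ε)
        (trans (cong (q *_) (*-inverseˡ ε)) (*-identityʳ q))))))
      (*-monoˡ (<⇒≤ 0<ε) (proj₂ (archimedean (q * ℚ.1/ ε))))

  ∣∣-bound : ∀ {p q} → p ≤ q → - p ≤ q → ∣ p ∣ ≤ q
  ∣∣-bound {p} p≤q -p≤q with ∣p∣≡p∨∣p∣≡-p p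
  ... | inj₁ eq = ≤-trans (≤-reflexive eq) p≤q
  ... | inj₂ eq = ≤-trans (≤-reflexive eq) -p≤q

  ∣∣-mul-bound : ∀ {p q r s} → ∣ p ∣ ≤ r → ∣ q ∣ ≤ s → ∣ p * q ∣ ≤ r * s
  ∣∣-mul-bound {p} {q} p≤r q≤s = ≤-trans (≤-reflexive (∣p*q∣≡∣p∣*∣q∣ p q))
    (*-mono (0≤∣p∣ q) (≤-trans (0≤∣p∣ p) p≤r) p≤r q≤s)

  ∣∣-add-bound : ∀ {p q r s} → ∣ p ∣ ≤ r → ∣ q ∣ ≤ s → ∣ p + q ∣ ≤ r + s
  ∣∣-add-bound {p} {q} p≤r q≤s = ≤-trans (∣p+q∣≤∣p∣+∣q∣ p q) (+-mono-≤ p≤r q≤s)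

  neg-minus : ∀ a b → - (a - b) ≡ b - a
  neg-minus = solve 2 (λ a b → :- (a :- b) := b :- a) refl
    where open ℚ-Solver

  +-shift : ∀ {p q r} → p ≤ q + r → p - q ≤ r
  +-shift {p} {q} {r} p≤q+r = ≤-trans (+-monoˡ-≤ (- q) p≤q+r)
    (≤-reflexive (solve 2 (λ q r → (q :+ r) :- q := r) refl q r))
    where open ℚ-Solver

open Rational-Lemmas

IsCauchy : (ℕ → ℚ) → Set
IsCauchy x = ∀ ε → 0ℚ < ε → ∃ λ N → ∀ m n → N ℕ.≤ m → N ℕ.≤ n → ∣ x m - x n ∣ ≤ ε

-- Different Cauchy sequences may represent the same number; the operations and
-- the order below do not depend on the choice.
record ℝ : Set where
  field
    seq    : ℕ → ℚ
    cauchy : IsCauchy seq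

open ℝ public

infix 4 _<ℝ_
infixl 7 _*ℝ_
infix 8 -ℝ_

_<ℝ_ : Rel ℝ 0ℓ
x <ℝ y = ∃ λ ε → 0ℚ < ε × ∃ λ N → ∀ n → N ℕ.≤ n → seq x n + ε ≤ seq y n

fromℚ : ℚ → ℝ
fromℚ q .seq _ = q
fromℚ q .cauchy ε 0<ε =
  0 , λ _ _ _ _ → ≤-trans (≤-reflexive (cong ∣_∣ (+-inverseʳ q))) (<⇒≤ 0<ε)

-ℝ_ : ℝ → ℝ
(-ℝ x) .seq n = - seq x n
(-ℝ x) .cauchy ε 0<ε = proj₁ (cauchy x ε 0<ε) , λ m n N≤m N≤n →
  ≤-trans
    (≤-reflexive (trans
      (cong ∣_∣ (solve 2 (λ a b → (:- a) :- (:- b) := :- (a :- b)) refl (seq x m) (seq x n)))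
      (∣-p∣≡∣p∣ (seq x m - seq x n))))
    (proj₂ (cauchy x ε 0<ε) m n N≤m N≤n)
  where open ℚ-Solver

module Bounded where

  eventuallyBounded : ∀ x → ∃ λ B → 0ℚ ≤ B × ∃ λ N → ∀ n → N ℕ.≤ n → ∣ seq x n ∣ ≤ B
  eventuallyBounded x =
    1ℚ + ∣ seq x N ∣ , 0≤+ (<⇒≤ (positive⁻¹ 1ℚ)) (0≤∣p∣ (seq x N)) , N , λ n N≤n →
      ≤-trans
        (≤-reflexive (cong ∣_∣ (solve 2 (λ a b → a := (a :- b) :+ b) refl (seq x n) (seq x N))))
        (∣∣-add-bound (proj₂ c n N N≤n ℕ.≤-refl) ≤-refl)
    where
    open ℚ-Solver
    c = cauchy x 1ℚ (positive⁻¹ 1ℚ)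
    N = proj₁ c

  *-close : ∀ a b c d A B δ ε → ∣ a ∣ ≤ A → ∣ d ∣ ≤ B →
    ∣ a - b ∣ ≤ δ → ∣ c - d ∣ ≤ δ → δ * (A + B) ≤ ε → ∣ a * c - b * d ∣ ≤ ε
  *-close a b c d A B δ ε a≤A d≤B ab≤δ cd≤δ δ≤ε = begin
    ∣ a * c - b * d ∣               ≡⟨ cong ∣_∣ (split a b c d) ⟩
    ∣ a * (c - d) + (a - b) * d ∣   ≤⟨ ∣∣-add-bound {a * (c - d)} {(a - b) * d}
                                         (∣∣-mul-bound {a} {c - d} a≤A cd≤δ)
                                         (∣∣-mul-bound {a - b} {d} ab≤δ d≤B) ⟩
    A * δ + δ * B                   ≡⟨ collect A B δ ⟩
    δ * (A + B)                     ≤⟨ δ≤ε ⟩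
    ε                               ∎
    where
    open ≤-Reasoning
    open ℚ-Solver
    split : ∀ a b c d → a * c - b * d ≡ a * (c - d) + (a - b) * d
    split = solve 4 (λ a b c d → a :* c :- b :* d := a :* (c :- d) :+ (a :- b) :* d) refl
    collect : ∀ A B δ → A * δ + δ * B ≡ δ * (A + B)
    collect = solve 3 (λ A B δ → A :* δ :+ δ :* B := δ :* (A :+ B)) refl

open Bounded

_*ℝ_ : ℝ → ℝ → ℝ
(x *ℝ y) .seq n = seq x n * seq y n
(x *ℝ y) .cauchy ε 0<ε = N , λ m n N≤m N≤n →
  let A≤m = ℕ.≤-trans A≤N N≤m
      B≤n = ℕ.≤-trans B≤N N≤n
  in *-close (seq x m) (seq x n) (seq y m) (seq y n) A B δ ε
       (x≤A m A≤m) (y≤B n B≤n)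
       (cx m n (ℕ.≤-trans X≤N N≤m) (ℕ.≤-trans X≤N N≤n))
       (cy m n (ℕ.≤-trans Y≤N N≤m) (ℕ.≤-trans Y≤N N≤n)) δ≤ε
  where
  bx = eventuallyBounded x
  by = eventuallyBounded y
  A = proj₁ bx
  B = proj₁ by
  x≤A = proj₂ (proj₂ (proj₂ bx))
  y≤B = proj₂ (proj₂ (proj₂ by))
  sh = shrink (A + B) ε (0≤+ {A} {B} (proj₁ (proj₂ bx)) (proj₁ (proj₂ by))) 0<ε
  δ = proj₁ sh
  δ≤ε = proj₂ (proj₂ sh)
  cx = proj₂ (cauchy x δ (proj₁ (proj₂ sh)))
  cy = proj₂ (cauchy y δ (proj₁ (proj₂ sh)))
  NA = proj₁ (proj₂ (proj₂ bx))
  NB = proj₁ (proj₂ (proj₂ by))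
  NX = proj₁ (cauchy x δ (proj₁ (proj₂ sh)))
  NY = proj₁ (cauchy y δ (proj₁ (proj₂ sh)))
  N = (NA ℕ.+ NB) ℕ.+ (NX ℕ.+ NY)
  A≤N : NA ℕ.≤ N
  A≤N = ℕ.≤-trans (ℕ.m≤m+n NA NB) (ℕ.m≤m+n (NA ℕ.+ NB) (NX ℕ.+ NY))
  B≤N : NB ℕ.≤ N
  B≤N = ℕ.≤-trans (ℕ.m≤n+m NB NA) (ℕ.m≤m+n (NA ℕ.+ NB) (NX ℕ.+ NY))
  X≤N : NX ℕ.≤ N
  X≤N = ℕ.≤-trans (ℕ.m≤m+n NX NY) (ℕ.m≤n+m (NX ℕ.+ NY) (NA ℕ.+ NB))
  Y≤N : NY ℕ.≤ N
  Y≤N = ℕ.≤-trans (ℕ.m≤n+m NY NX) (ℕ.m≤n+m (NX ℕ.+ NY) (NA ℕ.+ NB))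

-- isqrt n = ⌊√n⌋
isqrt : ℕ → ℕ
isqrt zero    = 0
isqrt (suc n) with suc (isqrt n) ℕ.* suc (isqrt n) ℕ.≤? suc n
... | yes _ = suc (isqrt n)
... | no  _ = isqrt n

isqrt-lower : ∀ n → isqrt n ℕ.* isqrt n ℕ.≤ n
isqrt-lower zero    = z≤n
isqrt-lower (suc n) with suc (isqrt n) ℕ.* suc (isqrt n) ℕ.≤? suc n
... | yes p = p
... | no  _ = ℕ.≤-trans (isqrt-lower n) (ℕ.n≤1+n n)

isqrt-upper : ∀ n → n ℕ.< suc (isqrt n) ℕ.* suc (isqrt n)
isqrt-upper zero    = s≤s z≤n
isqrt-upper (suc n) with suc (isqrt n) ℕ.* suc (isqrt n) ℕ.≤? suc n
... | no  p = ℕ.≰⇒> p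
... | yes _ = ℕ.≤-<-trans (isqrt-upper n)
  (ℕ.*-mono-< (ℕ.n<1+n (suc (isqrt n))) (ℕ.n<1+n (suc (isqrt n))))

module Square-Root-Lemmas where

  square-cancel-< : ∀ {a b} → a ℕ.* a ℕ.< b ℕ.* b → a ℕ.< b
  square-cancel-< {a} {b} p with a ℕ.<? b
  ... | yes a<b = a<b
  ... | no  a≮b = ⊥-elim (ℕ.<⇒≱ p (ℕ.*-mono-≤ (ℕ.≮⇒≥ a≮b) (ℕ.≮⇒≥ a≮b)))

  fromℕ-suc : ∀ n → fromℕ (suc n) ≡ fromℕ n + 1ℚ
  fromℕ-suc n = trans (toℚᵘ-injective
      (ℚᵘ.≃-trans lemma (ℚᵘ.≃-sym (toℚᵘ-homo-+ (fromℕ n) (fromℕ 1)))))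
      (cong (λ z → fromℕ n + z) one)
    where
    import Data.Rational.Unnormalised.Properties as ℚᵘ
    one : fromℕ 1 ≡ 1ℚ
    one = refl
    lemma : ℚ.toℚᵘ (fromℕ (suc n)) ℚᵘ.≃ ℚ.toℚᵘ (fromℕ n) ℚᵘ.+ ℚ.toℚᵘ (fromℕ 1)
    lemma = ℚᵘ.*≡* (cong (ℤ._* + 1) (trans (cong +_ (ℕ.+-comm 1 n))
      (cong (ℤ._+ + 1) (sym (ℤ.*-identityʳ (+ n))))))

  ratio-close : ∀ r s j k → r ℕ.* suc k ℕ.≤ suc s ℕ.* suc j →
    (fromℕ r ÷ fromℕ (suc j)) - (fromℕ s ÷ fromℕ (suc k)) ≤ inv k
  ratio-close r s j k rk≤sj = +-shift {R * i} {S * l} {l} (begin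
    R * i                  ≡⟨ *-identityʳ (R * i) ⟨
    R * i * 1ℚ             ≡⟨ cong (R * i *_) (*-inverseʳ K) ⟨
    R * i * (K * l)        ≡⟨ regroup R i K l ⟩
    R * K * (i * l)        ≤⟨ *-monoʳ {i * l} {R * K} {(S + 1ℚ) * J} 0≤il cross ⟩
    (S + 1ℚ) * J * (i * l) ≡⟨ regroup′ (S + 1ℚ) J i l ⟩
    (S + 1ℚ) * l * (J * i) ≡⟨ cong ((S + 1ℚ) * l *_) (*-inverseʳ J) ⟩
    (S + 1ℚ) * l * 1ℚ      ≡⟨ expand S l ⟩
    S * l + l              ∎)
    where
    open ≤-Reasoning
    open ℚ-Solver
    R = fromℕ r
    S = fromℕ s
    J = fromℕ (suc j)
    K = fromℕ (suc k)
    i = inv j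
    l = inv k
    regroup : ∀ a b c d → a * b * (c * d) ≡ a * c * (b * d)
    regroup = solve 4 (λ a b c d → a :* b :* (c :* d) := a :* c :* (b :* d)) refl
    regroup′ : ∀ a b c d → a * b * (c * d) ≡ a * d * (b * c)
    regroup′ = solve 4 (λ a b c d → a :* b :* (c :* d) := a :* d :* (b :* c)) refl
    expand : ∀ a b → (a + 1ℚ) * b * 1ℚ ≡ a * b + b
    expand = solve 2 (λ a b → (a :+ con 1ℚ) :* b :* con 1ℚ := a :* b :+ b) refl
    0≤il : 0ℚ ≤ i * l
    0≤il = 0≤* {i} {l} (<⇒≤ (positive⁻¹ i)) (<⇒≤ (positive⁻¹ l))
    cross : R * K ≤ (S + 1ℚ) * J
    cross = subst₂ _≤_ (fromℕ-* r (suc k))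
      (trans (fromℕ-* (suc s) (suc j)) (cong (_* J) (fromℕ-suc s)))
      (fromℕ-mono rk≤sj)

  isqrt-cross : ∀ m j k → isqrt (m ℕ.* (suc j ℕ.* suc j)) ℕ.* suc k
                      ℕ.≤ suc (isqrt (m ℕ.* (suc k ℕ.* suc k))) ℕ.* suc j
  isqrt-cross m j k = ℕ.<⇒≤ (square-cancel-< {r ℕ.* suc k} {suc s ℕ.* suc j} (begin-strict
    (r ℕ.* suc k) ℕ.* (r ℕ.* suc k)         ≡⟨ ℕ.[m*n]*[o*p]≡[m*o]*[n*p] r (suc k) r (suc k) ⟩
    (r ℕ.* r) ℕ.* (suc k ℕ.* suc k)         ≤⟨ ℕ.*-monoˡ-≤ (suc k ℕ.* suc k) (isqrt-lower (m ℕ.* (suc j ℕ.* suc j))) ⟩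
    (m ℕ.* (suc j ℕ.* suc j)) ℕ.* (suc k ℕ.* suc k) ≡⟨ swap m (suc j ℕ.* suc j) (suc k ℕ.* suc k) ⟩
    (m ℕ.* (suc k ℕ.* suc k)) ℕ.* (suc j ℕ.* suc j)
      <⟨ ℕ.*-monoˡ-< (suc j ℕ.* suc j) (isqrt-upper (m ℕ.* (suc k ℕ.* suc k))) ⟩
    (suc s ℕ.* suc s) ℕ.* (suc j ℕ.* suc j) ≡⟨ ℕ.[m*n]*[o*p]≡[m*o]*[n*p] (suc s) (suc s) (suc j) (suc j) ⟩
    (suc s ℕ.* suc j) ℕ.* (suc s ℕ.* suc j) ∎))
    where
    open ℕ.≤-Reasoning
    r = isqrt (m ℕ.* (suc j ℕ.* suc j))
    s = isqrt (m ℕ.* (suc k ℕ.* suc k))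
    swap : ∀ a b c → (a ℕ.* b) ℕ.* c ≡ (a ℕ.* c) ℕ.* b
    swap a b c = trans (ℕ.*-assoc a b c) (trans (cong (a ℕ.*_) (ℕ.*-comm b c)) (sym (ℕ.*-assoc a c b)))

open Square-Root-Lemmas

-- The n-th approximation is ⌊ (n + 1) √m ⌋ / (n + 1).
√_ : ℕ → ℝ
(√ m) .seq n = fromℕ (isqrt (m ℕ.* (suc n ℕ.* suc n))) ÷ fromℕ (suc n)
(√ m) .cauchy ε 0<ε = N , λ i j N≤i N≤j →
    let r = isqrt (m ℕ.* (suc i ℕ.* suc i))
        s = isqrt (m ℕ.* (suc j ℕ.* suc j))
        a = fromℕ r ÷ fromℕ (suc i)
        b = fromℕ s ÷ fromℕ (suc j)
    in ∣∣-bound {a - b} {ε}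
      (≤-trans (ratio-close r s i j (isqrt-cross m i j)) (close j N≤j))
      (≤-trans (≤-reflexive (neg-minus a b))
        (≤-trans (ratio-close s r j i (isqrt-cross m j i)) (close i N≤i)))
  where
  v = vanish 1ℚ ε (<⇒≤ (positive⁻¹ 1ℚ)) 0<ε
  N = proj₁ v
  close : ∀ n → N ℕ.≤ n → inv n ≤ ε
  close n N≤n = ≤-trans (≤-reflexive (sym (*-identityˡ (inv n)))) (proj₂ v n N≤n)

-- expTerm q k = q ^ k / k !
expTerm : ℚ → ℕ → ℚ
expTerm q zero    = 1ℚ
expTerm q (suc k) = (q * expTerm q k) ÷ fromℕ (suc k)

-- expSum q n = Σ_{k ≤ n} q ^ k / k !
expSum : ℚ → ℕ → ℚ
expSum q zero    = expTerm q zero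
expSum q (suc n) = expSum q n + expTerm q (suc n)

module Exponential-Lemmas where

  ≤-grow : ∀ {p q} → 0ℚ ≤ q → p ≤ p + q
  ≤-grow {p} {q} 0≤q = ≤-trans (≤-reflexive (sym (+-identityʳ p))) (+-monoʳ-≤ p 0≤q)

  ∣-∣-comm : ∀ a b → ∣ a - b ∣ ≡ ∣ b - a ∣
  ∣-∣-comm a b = trans (cong ∣_∣ (sym (neg-minus b a))) (∣-p∣≡∣p∣ (b - a))

  minus-add : ∀ a b c d → (a + b) - (c + d) ≡ (a - c) + (b - d)
  minus-add = solve 4 (λ a b c d → (a :+ b) :- (c :+ d) := (a :- c) :+ (b :- d)) refl
    where open ℚ-Solver

  add-minus : ∀ a b c → (a + b) - c ≡ (a - c) + b
  add-minus = solve 3 (λ a b c → (a :+ b) :- c := (a :- c) :+ b) refl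
    where open ℚ-Solver

  three : ∀ a b c d η ε → ∣ a - b ∣ ≤ η → ∣ b - c ∣ ≤ η → ∣ c - d ∣ ≤ η →
    η * (1ℚ + 1ℚ + 1ℚ) ≤ ε → ∣ a - d ∣ ≤ ε
  three a b c d η ε ab bc cd η≤ε = begin
    ∣ a - d ∣                         ≡⟨ cong ∣_∣ (telescope a b c d) ⟩
    ∣ ((a - b) + (b - c)) + (c - d) ∣ ≤⟨ ∣∣-add-bound {(a - b) + (b - c)} {c - d}
                                          (∣∣-add-bound {a - b} {b - c} ab bc) cd ⟩
    (η + η) + η                       ≡⟨ triple η ⟩
    η * (1ℚ + 1ℚ + 1ℚ)                ≤⟨ η≤ε ⟩
    ε                                 ∎
    where
    open ≤-Reasoning
    open ℚ-Solver
    telescope : ∀ a b c d → a - d ≡ ((a - b) + (b - c)) + (c - d)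
    telescope = solve 4 (λ a b c d → a :- d := ((a :- b) :+ (b :- c)) :+ (c :- d)) refl
    triple : ∀ η → (η + η) + η ≡ η * (1ℚ + 1ℚ + 1ℚ)
    triple = solve 1 (λ η → (η :+ η) :+ η := η :* (con 1ℚ :+ con 1ℚ :+ con 1ℚ)) refl

  module ExpBounds (B : ℚ) (0≤B : 0ℚ ≤ B) where

    t : ℕ → ℚ
    t = expTerm B

    S : ℕ → ℚ
    S = expSum B

    0≤inv : ∀ k → 0ℚ ≤ inv k
    0≤inv k = <⇒≤ (positive⁻¹ (inv k))

    0≤t : ∀ k → 0ℚ ≤ t k
    0≤t zero    = <⇒≤ (positive⁻¹ 1ℚ)
    0≤t (suc k) = 0≤* {B * t k} {inv k} (0≤* {B} {t k} 0≤B (0≤t k)) (0≤inv k)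

    0≤S : ∀ k → 0ℚ ≤ S k
    0≤S zero    = 0≤t 0
    0≤S (suc k) = 0≤+ {S k} {t (suc k)} (0≤S k) (0≤t (suc k))

    ∣inv∣ : ∀ k → ∣ inv k ∣ ≤ inv k
    ∣inv∣ k = ≤-reflexive (0≤p⇒∣p∣≡p (0≤inv k))

    term-bound : ∀ x → ∣ x ∣ ≤ B → ∀ k → ∣ expTerm x k ∣ ≤ t k
    term-bound x hx zero    = ≤-refl
    term-bound x hx (suc k) = ∣∣-mul-bound {x * expTerm x k} {inv k} {B * t k} {inv k}
      (∣∣-mul-bound {x} {expTerm x k} {B} {t k} hx (term-bound x hx k)) (∣inv∣ k)

    t-suc : ∀ k → B * t k ≡ fromℕ (suc k) * t (suc k)
    t-suc k = sym (trans (rearrange (fromℕ (suc k)) (B * t k) (inv k))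
      (trans (cong (B * t k *_) (*-inverseʳ (fromℕ (suc k)))) (*-identityʳ (B * t k))))
      where
      open ℚ-Solver
      rearrange : ∀ n p i → n * (p * i) ≡ p * (n * i)
      rearrange = solve 3 (λ n p i → n :* (p :* i) := p :* (n :* i)) refl

    lipschitz-step : ∀ x y a b d k → ∣ x ∣ ≤ B → ∣ x - y ∣ ≤ d → ∣ b ∣ ≤ t (suc k) →
      ∣ a - b ∣ ≤ d * t k → ∣ x * a * inv (suc k) - y * b * inv (suc k) ∣ ≤ d * t (suc k)
    lipschitz-step x y a b d k hx xy hb ab = begin
      ∣ x * a * i - y * b * i ∣             ≡⟨ cong ∣_∣ (split x y a b i) ⟩
      ∣ (x * (a - b) + (x - y) * b) * i ∣   ≤⟨ ∣∣-mul-bound {x * (a - b) + (x - y) * b} {i}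
                                                {B * (d * t k) + d * t (suc k)} {i}
                                                (∣∣-add-bound {x * (a - b)} {(x - y) * b}
                                                  {B * (d * t k)} {d * t (suc k)}
                                                  (∣∣-mul-bound {x} {a - b} {B} {d * t k} hx ab)
                                                  (∣∣-mul-bound {x - y} {b} {d} {t (suc k)} xy hb))
                                                (∣inv∣ (suc k)) ⟩
      (B * (d * t k) + d * t (suc k)) * i   ≡⟨ collect B d (t k) (t (suc k)) i ⟩
      d * (B * t k + t (suc k)) * i         ≡⟨ cong (λ z → d * (z + t (suc k)) * i) (t-suc k) ⟩
      d * (n * t (suc k) + t (suc k)) * i   ≡⟨ collect′ d n (t (suc k)) i ⟩
      d * t (suc k) * ((n + 1ℚ) * i)        ≡⟨ cong (λ z → d * t (suc k) * (z * i)) (sym (fromℕ-suc (suc k))) ⟩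
      d * t (suc k) * (fromℕ (suc (suc k)) * i) ≡⟨ cong (d * t (suc k) *_) (*-inverseʳ (fromℕ (suc (suc k)))) ⟩
      d * t (suc k) * 1ℚ                    ≡⟨ *-identityʳ (d * t (suc k)) ⟩
      d * t (suc k)                         ∎
      where
      open ≤-Reasoning
      open ℚ-Solver
      i = inv (suc k)
      n = fromℕ (suc k)
      split : ∀ x y a b i → x * a * i - y * b * i ≡ (x * (a - b) + (x - y) * b) * i
      split = solve 5 (λ x y a b i →
        x :* a :* i :- y :* b :* i := (x :* (a :- b) :+ (x :- y) :* b) :* i) refl
      collect : ∀ B d a b i → (B * (d * a) + d * b) * i ≡ d * (B * a + b) * i
      collect = solve 5 (λ B d a b i → (B :* (d :* a) :+ d :* b) :* i := d :* (B :* a :+ b) :* i) refl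
      collect′ : ∀ d n b i → d * (n * b + b) * i ≡ d * b * ((n + 1ℚ) * i)
      collect′ = solve 4 (λ d n b i → d :* (n :* b :+ b) :* i := d :* b :* ((n :+ con 1ℚ) :* i)) refl

    term-lipschitz : ∀ x y → ∣ x ∣ ≤ B → ∣ y ∣ ≤ B → ∀ k →
      ∣ expTerm x (suc k) - expTerm y (suc k) ∣ ≤ ∣ x - y ∣ * t k
    term-lipschitz x y _ _ zero =
      ≤-reflexive (trans (cong ∣_∣ (cong₂ _-_ (unit x) (unit y))) (sym (*-identityʳ ∣ x - y ∣)))
      where
      unit : ∀ x → x * 1ℚ * inv 0 ≡ x
      unit x = trans (*-identityʳ (x * 1ℚ)) (*-identityʳ x)
    term-lipschitz x y hx hy (suc k) =
      lipschitz-step x y (expTerm x (suc k)) (expTerm y (suc k)) ∣ x - y ∣ k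
        hx ≤-refl (term-bound y hy (suc k)) (term-lipschitz x y hx hy k)

    sum-lipschitz : ∀ x y → ∣ x ∣ ≤ B → ∣ y ∣ ≤ B → ∀ n →
      ∣ expSum x (suc n) - expSum y (suc n) ∣ ≤ ∣ x - y ∣ * S n
    sum-lipschitz x y hx hy n = begin
      ∣ (expSum x n + a) - (expSum y n + b) ∣ ≡⟨ cong ∣_∣ (minus-add (expSum x n) a (expSum y n) b) ⟩
      ∣ (expSum x n - expSum y n) + (a - b) ∣ ≤⟨ ∣p+q∣≤∣p∣+∣q∣ (expSum x n - expSum y n) (a - b) ⟩
      ∣ expSum x n - expSum y n ∣ + ∣ a - b ∣ ≤⟨ +-monoʳ-≤ ∣ expSum x n - expSum y n ∣ (term-lipschitz x y hx hy n) ⟩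
      ∣ expSum x n - expSum y n ∣ + d * t n   ≤⟨ previous n ⟩
      d * S n                                 ∎
      where
      open ≤-Reasoning
      a = expTerm x (suc n)
      b = expTerm y (suc n)
      d = ∣ x - y ∣
      previous : ∀ n → ∣ expSum x n - expSum y n ∣ + d * t n ≤ d * S n
      previous zero    = ≤-reflexive (+-identityˡ (d * 1ℚ))
      previous (suc n) = ≤-trans
        (+-monoˡ-≤ (d * t (suc n)) (sum-lipschitz x y hx hy n))
        (≤-reflexive (sym (*-distribˡ-+ d (S n) (t (suc n)))))

    -- From index K on, the terms at least halve at every step.
    K : ℕ
    K = proj₁ (archimedean (B + B))

    halve : ∀ k → K ℕ.≤ k → t (suc k) + t (suc k) ≤ t k
    halve k K≤k = begin
      B * t k * i + B * t k * i ≡⟨ collect B (t k) i ⟩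
      (B + B) * i * t k         ≤⟨ *-monoʳ {t k} {(B + B) * i} {fromℕ (suc k) * i} (0≤t k)
                                     (*-monoʳ {i} {B + B} {fromℕ (suc k)} (0≤inv k)
                                       (≤-trans (proj₂ (archimedean (B + B)))
                                         (fromℕ-mono (ℕ.≤-trans K≤k (ℕ.n≤1+n k))))) ⟩
      fromℕ (suc k) * i * t k   ≡⟨ cong (_* t k) (*-inverseʳ (fromℕ (suc k))) ⟩
      1ℚ * t k                  ≡⟨ *-identityˡ (t k) ⟩
      t k                       ∎
      where
      open ≤-Reasoning
      open ℚ-Solver
      i = inv k
      collect : ∀ B a i → B * a * i + B * a * i ≡ (B + B) * i * a
      collect = solve 3 (λ B a i → B :* a :* i :+ B :* a :* i := (B :+ B) :* i :* a) refl

    decreasing : ∀ j → t (K ℕ.+ j) ≤ t K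
    decreasing zero    = ≤-reflexive (cong t (ℕ.+-identityʳ K))
    decreasing (suc j) = ≤-trans (≤-reflexive (cong t (ℕ.+-suc K j)))
      (≤-trans (≤-grow {t (suc (K ℕ.+ j))} {t (suc (K ℕ.+ j))} (0≤t (suc (K ℕ.+ j))))
        (≤-trans (halve (K ℕ.+ j) (ℕ.m≤m+n K j)) (decreasing j)))

    tail : ∀ N → K ℕ.≤ N → ∀ j → S (N ℕ.+ j) + t (N ℕ.+ j) ≤ S N + t N
    tail N K≤N zero    = ≤-reflexive (cong (λ n → S n + t n) (ℕ.+-identityʳ N))
    tail N K≤N (suc j) = ≤-trans (≤-reflexive (cong (λ n → S n + t n) (ℕ.+-suc N j)))
      (≤-trans (≤-reflexive (+-assoc (S n) (t (suc n)) (t (suc n))))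
        (≤-trans (+-monoʳ-≤ (S n) (halve n (ℕ.≤-trans K≤N (ℕ.m≤m+n N j)))) (tail N K≤N j)))
      where n = N ℕ.+ j

    S-bound : ∀ N → K ℕ.≤ N → ∀ j → S (N ℕ.+ j) ≤ S N + t N
    S-bound N K≤N j = ≤-trans (≤-grow {S (N ℕ.+ j)} {t (N ℕ.+ j)} (0≤t (N ℕ.+ j))) (tail N K≤N j)

    sum-tail : ∀ x → ∣ x ∣ ≤ B → ∀ N j → ∣ expSum x (N ℕ.+ j) - expSum x N ∣ ≤ S (N ℕ.+ j) - S N
    sum-tail x hx N zero = ≤-reflexive (trans
      (cong (λ n → ∣ expSum x n - expSum x N ∣) (ℕ.+-identityʳ N))
      (trans (cong ∣_∣ (+-inverseʳ (expSum x N)))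
        (sym (trans (cong (λ n → S n - S N) (ℕ.+-identityʳ N)) (+-inverseʳ (S N))))))
    sum-tail x hx N (suc j) = subst (λ n → ∣ expSum x n - expSum x N ∣ ≤ S n - S N) (sym (ℕ.+-suc N j))
      (begin
        ∣ (expSum x n + a) - expSum x N ∣   ≡⟨ cong ∣_∣ (add-minus (expSum x n) a (expSum x N)) ⟩
        ∣ (expSum x n - expSum x N) + a ∣   ≤⟨ ∣∣-add-bound {expSum x n - expSum x N} {a}
                                                (sum-tail x hx N j) (term-bound x hx (suc n)) ⟩
        (S n - S N) + t (suc n)             ≡⟨ add-minus (S n) (t (suc n)) (S N) ⟨
        (S n + t (suc n)) - S N             ∎)
      where
      open ≤-Reasoning
      n = N ℕ.+ j
      a = expTerm x (suc n)

    sum-close : ∀ x → ∣ x ∣ ≤ B → ∀ N → K ℕ.≤ N → ∀ n → N ℕ.≤ n → ∣ expSum x n - expSum x N ∣ ≤ t N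
    sum-close x hx N K≤N n N≤n = subst (λ n → ∣ expSum x n - expSum x N ∣ ≤ t N)
      (ℕ.m+[n∸m]≡n N≤n)
      (≤-trans (sum-tail x hx N j) (+-shift {S (N ℕ.+ j)} {S N} {t N} (S-bound N K≤N j)))
      where j = n ℕ.∸ N

    C : ℚ
    C = S K + t K

    0≤C : 0ℚ ≤ C
    0≤C = 0≤+ {S K} {t K} (0≤S K) (0≤t K)

    S≤C : ∀ N → K ℕ.≤ N → S N ≤ C
    S≤C N K≤N = subst (λ n → S n ≤ C) (ℕ.m+[n∸m]≡n K≤N) (S-bound K ℕ.≤-refl (N ℕ.∸ K))

    t-vanishes : ∀ ε → 0ℚ < ε → ∃ λ N → K ℕ.≤ N × ∀ n → N ℕ.≤ n → t (suc n) ≤ ε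
    t-vanishes ε 0<ε = K ℕ.+ proj₁ v , ℕ.m≤m+n K (proj₁ v) , λ n N≤n → ≤-trans
      (*-monoʳ {inv n} {B * t n} {B * t K} (0≤inv n) (*-monoˡ {B} {t n} {t K} 0≤B
        (subst (λ n → t n ≤ t K) (ℕ.m+[n∸m]≡n (ℕ.≤-trans (ℕ.m≤m+n K (proj₁ v)) N≤n)) (decreasing (n ℕ.∸ K)))))
      (proj₂ v n (ℕ.≤-trans (ℕ.m≤n+m (proj₁ v) K) N≤n))
      where v = vanish (B * t K) ε (0≤* {B} {t K} 0≤B (0≤t K)) 0<ε

open Exponential-Lemmas

exp : ℝ → ℝ
exp x .seq n = expSum (seq x n) n
exp x .cauchy ε 0<ε = suc N , λ m n N≤m N≤n →
  let xm = seq x m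
      xn = seq x n
      hm = x≤B m (ℕ.≤-trans N₁≤N N≤m)
      hn = x≤B n (ℕ.≤-trans N₁≤N N≤n)
  in three (expSum xm m) (expSum xm (suc N)) (expSum xn (suc N)) (expSum xn n) η ε
       (≤-trans (sum-close xm hm (suc N) K≤N m N≤m) (t≤η N N₂≤N))
       (≤-trans (sum-lipschitz xm xn hm hn N)
         (≤-trans (*-mono {∣ xm - xn ∣} {δ} {S N} {C} (0≤S N) (<⇒≤ 0<δ)
                    (cx m n (ℕ.≤-trans N₃≤N N≤m) (ℕ.≤-trans N₃≤N N≤n)) (S≤C N (ℕ.≤-trans K≤N₂ N₂≤N)))
           δC≤η))
       (≤-trans (≤-reflexive (∣-∣-comm (expSum xn (suc N)) (expSum xn n)))
         (≤-trans (sum-close xn hn (suc N) K≤N n N≤n) (t≤η N N₂≤N)))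
       3η≤ε
  where
  bx = eventuallyBounded x
  x≤B = proj₂ (proj₂ (proj₂ bx))
  open ExpBounds (proj₁ bx) (proj₁ (proj₂ bx))
  sh = shrink (1ℚ + 1ℚ + 1ℚ) ε (<⇒≤ (positive⁻¹ (1ℚ + 1ℚ + 1ℚ))) 0<ε
  η = proj₁ sh
  3η≤ε = proj₂ (proj₂ sh)
  sh′ = shrink C η 0≤C (proj₁ (proj₂ sh))
  δ = proj₁ sh′
  0<δ = proj₁ (proj₂ sh′)
  δC≤η = proj₂ (proj₂ sh′)
  tv = t-vanishes η (proj₁ (proj₂ sh))
  K≤N₂ = proj₁ (proj₂ tv)
  t≤η = proj₂ (proj₂ tv)
  cx = proj₂ (cauchy x δ 0<δ)
  N₁ = proj₁ (proj₂ (proj₂ bx))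
  N₂ = proj₁ tv
  N₃ = proj₁ (cauchy x δ 0<δ)
  N = N₁ ℕ.+ (N₂ ℕ.+ N₃)
  N₁≤N : N₁ ℕ.≤ suc N
  N₁≤N = ℕ.≤-trans (ℕ.m≤m+n N₁ (N₂ ℕ.+ N₃)) (ℕ.n≤1+n N)
  N₂≤N : N₂ ℕ.≤ N
  N₂≤N = ℕ.≤-trans (ℕ.m≤m+n N₂ N₃) (ℕ.m≤n+m (N₂ ℕ.+ N₃) N₁)
  N₃≤N : N₃ ℕ.≤ suc N
  N₃≤N = ℕ.≤-trans (ℕ.≤-trans (ℕ.m≤n+m N₃ N₂) (ℕ.m≤n+m (N₂ ℕ.+ N₃) N₁)) (ℕ.n≤1+n N)
  K≤N : K ℕ.≤ suc N
  K≤N = ℕ.≤-trans K≤N₂ (ℕ.≤-trans N₂≤N (ℕ.n≤1+n N))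

Point : Set
Point = ℤ × ℤ

Vertex : Set
Vertex = Point

-- A unit square is named by its lower left corner.
Square : Set
Square = Point

_≟ₛ_ : (s s′ : Square) → Dec (s ≡ s′)
_≟ₛ_ = ≡-dec ℤ._≟_ ℤ._≟_

open import Data.List.Membership.DecPropositional _≟ₛ_ using (_∈?_)

data Dir : Set where
  E N W S : Dir

step : Dir → Point → Point
step E (x , y) = ℤ.suc x , y
step N (x , y) = x , ℤ.suc y
step W (x , y) = ℤ.pred x , y
step S (x , y) = x , ℤ.pred y

turnLeft : Dir → Dir
turnLeft E = N
turnLeft N = W
turnLeft W = S
turnLeft S = E

-- A directed edge is given by its source and its direction; these are
-- the squares to its left and to its right.
leftOf rightOf : Dir → Vertex → Square
leftOf E (x , y) = x , y
leftOf N (x , y) = ℤ.pred x , y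
leftOf W (x , y) = ℤ.pred x , ℤ.pred y
leftOf S (x , y) = x , ℤ.pred y
rightOf E (x , y) = x , ℤ.pred y
rightOf N (x , y) = x , y
rightOf W (x , y) = ℤ.pred x , y
rightOf S (x , y) = ℤ.pred x , ℤ.pred y

squaresAround : Vertex → List Square
squaresAround u = leftOf E u ∷ leftOf N u ∷ leftOf W u ∷ leftOf S u ∷ []

-- black s ≡ true when the square s is black.
IsCheckerboard : (Square → Bool) → Set
IsCheckerboard black = ∀ d s → black (step d s) ≡ not (black s)

data Orientation : Set where
  horizontal vertical : Orientation

-- A domino is named by its left or lower square and its orientation.
Domino : Set
Domino = Square × Orientation

cells : Domino → List Square
cells (s , horizontal) = s ∷ step E s ∷ []
cells (s , vertical)   = s ∷ step N s ∷ []

-- The directed edge separating the two cells of a domino.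
bisector : Domino → Vertex × Dir
bisector (s , horizontal) = step E s , N
bisector (s , vertical)   = step N s , E

dominos : List Square → List Domino
dominos R = filter (λ D → all? (_∈? R) (cells D)) (cartesianProduct R (horizontal ∷ vertical ∷ []))

Tiling : Set
Tiling = List Domino

IsTiling : List Square → Pred Tiling 0ℓ
IsTiling R T = All (λ s → length (filter (λ D → s ∈? cells D) T) ≡ 1) R

isTiling? : ∀ R → Decidable (IsTiling R)
isTiling? R T = all? (λ s → length (filter (λ D → s ∈? cells D) T) ℕ.≟ 1) R

subsequences : {A : Set} → List A → List (List A)
subsequences []       = [] ∷ []
subsequences (x ∷ xs) = map (x ∷_) (subsequences xs) ++ subsequences xs

-- When R has no repetitions, neither has dominos R, so that its subsequences
-- are its subsets, each listed once.
tilings : List Square → List Tiling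
tilings R = filter (isTiling? R) (subsequences (dominos R))

record Region : Set where
  field
    squares  : List Square
    unique   : Unique squares
    tileable : ∃ λ T → T ∈ tilings squares

open Region public

IsVertex : Region → Pred Vertex 0ℓ
IsVertex R u = Any (_∈ squares R) (squaresAround u)

Interior : Region → Pred Vertex 0ℓ
Interior R u = All (_∈ squares R) (squaresAround u)

IsEdge : Region → Dir → Vertex → Set
IsEdge R d u = leftOf d u ∈ squares R ⊎ rightOf d u ∈ squares R

IsBoundaryEdge : Region → Dir → Vertex → Set
IsBoundaryEdge R d u = (leftOf d u ∈ squares R × rightOf d u ∉ squares R)
                     ⊎ (leftOf d u ∉ squares R × rightOf d u ∈ squares R)

data Path (R : Region) : Vertex → Vertex → Set where
  stop : ∀ {u} → IsVertex R u → Path R u u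
  go   : ∀ {u w} d → IsEdge R d u → Path R (step d u) w → Path R u w

vertices : ∀ {R u w} → Path R u w → List Vertex
vertices (stop {u} _)   = u ∷ []
vertices (go {u} _ _ p) = u ∷ vertices p

-- Elementary homotopies of edge paths in the union of the closed squares of R:
-- removing a backtrack, and pushing a corner across a square of R.
data Move (R : Region) : Rel (List Vertex) 0ℓ where
  backtrack : ∀ xs ys d u → IsEdge R d u →
    Move R (xs ++ u ∷ step d u ∷ u ∷ ys) (xs ++ u ∷ ys)
  push : ∀ xs ys d u → leftOf d u ∈ squares R →
    Move R (xs ++ u ∷ step d u            ∷ step (turnLeft d) (step d u) ∷ ys)
           (xs ++ u ∷ step (turnLeft d) u ∷ step (turnLeft d) (step d u) ∷ ys)

Homotopic : (R : Region) → Rel (List Vertex) 0ℓ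
Homotopic R = EqClosure (Move R)

-- The union of the closed squares of R is a square complex, whose fundamental
-- group is its edge-path group.
record SimplyConnected (R : Region) : Set where
  field
    connected    : ∀ u w → IsVertex R u → IsVertex R w → Path R u w
    contractible : ∀ u (p : Path R u u) → Homotopic R (vertices p) (u ∷ [])

-- Only the values of h at the vertices of R are constrained.
record IsHeightFunction (R : Region) (black : Square → Bool) (h : Vertex → ℤ) : Set where
  field
    boundary  : ∀ d u → IsBoundaryEdge R d u → ℤ.∣ h u ℤ.- h (step d u) ∣ ≡ 1
    blackLeft : ∀ d u → IsEdge R d u → black (leftOf d u) ≡ true →
      h (step d u) ≡ h u ℤ.+ + 1 ⊎ h (step d u) ≡ h u ℤ.- + 3

record IsHeightOf (R : Region) (black : Square → Bool) (T : Tiling) (h : Vertex → ℤ) : Set where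
  field
    isHeightFunction : IsHeightFunction R black h
    bisected : ∀ D → D ∈ dominos (squares R) →
      D ∈ T ⇔ (let u , d = bisector D in ℤ.∣ h u ℤ.- h (step d u) ∣ ≡ 3)

#tilings : Region → ℕ
#tilings R = length (tilings (squares R))

#tilings-nonZero : ∀ R → ℕ.NonZero (#tilings R)
#tilings-nonZero R = nonEmpty (proj₂ (tileable R))
  where
  nonEmpty : ∀ {T Ts} → T ∈ Ts → ℕ.NonZero (length {A = Tiling} Ts)
  nonEmpty (here _)  = _
  nonEmpty (there _) = _

𝔼 : (R : Region) → (Tiling → ℤ) → ℚ
𝔼 R X = (foldr ℤ._+_ (+ 0) (map X (tilings (squares R))) ℚ./ #tilings R) {{#tilings-nonZero R}}

ℙ : (R : Region) {A : Pred Tiling 0ℓ} → Decidable A → ℚ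
ℙ R A? = (+ length (filter A? (tilings (squares R))) ℚ./ #tilings R) {{#tilings-nonZero R}}

-- An inequality between real numbers is not constructively decidable, so the
-- tilings satisfying it cannot be counted directly. The event Q has probability
-- less than b when every decidable event contained in Q has; for a decidable Q
-- this is equivalent to ℙ R Q? being less than b.
ProbabilityLessThan : (R : Region) → Pred Tiling 0ℓ → ℝ → Set₁
ProbabilityLessThan R Q b = {A : Pred Tiling 0ℓ} (A? : Decidable A) →
  (∀ T → T ∈ tilings (squares R) → A T → Q T) → fromℚ (ℙ R A?) <ℝ b

DiffersFromMeanByMoreThan : (R : Region) → (Tiling → ℤ) → ℝ → Pred Tiling 0ℓ
DiffersFromMeanByMoreThan R X r T = r <ℝ fromℚ ∣ X T ℚ./ 1 - 𝔼 R X ∣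

{-# OPTIONS --safe #-}

-- Fix the heights to be 0 at v and reveal the heights of a random tiling one vertex after
-- another along the path.  The heights revealed so far determine the next one up to the
-- choice between two values that differ by 4.  The height functions with prescribed values
-- at some vertices are closed under pointwise minimum and maximum, so by the four functions
-- theorem the mean height at w is monotone in the prescribed values; hence each choice moves
-- it by at most 4.  Azuma's inequality for the resulting martingale of m - 1 steps is proved
-- with truncations of cosh instead of the exponential: they are convex polynomials with
-- rational coefficients in the square of the argument, so no square root of m is needed.
-- What makes the final inequality strict is cosh z > e^z / 2, together with m - 1 < m, which
-- leaves room for replacing c by a rational approximation.

module Submission where

open import Defs
open Rational-Lemmas
open Square-Root-Lemmas using (fromℕ-suc)
open Exponential-Lemmas using (module ExpBounds; ≤-grow; ∣-∣-comm)

open import Data.Bool using (Bool; true; false; not; _∧_; _∨_)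
import Data.Bool.Properties as 𝔹
open import Data.Integer as ℤ using (ℤ; +_)
import Data.Integer.Properties as ℤ
open import Data.Integer.Solver using () renaming (module +-*-Solver to ℤ-Solver)
open import Algebra.Properties.AbelianGroup ℤ.+-0-abelianGroup using (∙-cancelˡ; ∙-cancelʳ)
open import Data.List using (List; []; _∷_; _++_; map; filter; foldr; length; cartesianProduct;
  concatMap)
open import Data.List.Properties using (length-map)
open import Data.List.Membership.DecPropositional _≟ₛ_ using (_∈?_)
open import Data.List.Membership.Propositional using (_∈_)
open import Data.List.Membership.Propositional.Properties
  using (∈-filter⁺; ∈-filter⁻; ∈-cartesianProduct⁺; ∈-cartesianProduct⁻; ∈-map⁺; ∈-map⁻; ∈-++⁺ˡ;
    ∈-++⁺ʳ; ∈-++⁻)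
open import Data.List.Relation.Unary.All as All using (All; []; _∷_; all?)
open import Data.List.Relation.Unary.AllPairs using (AllPairs; []; _∷_)
import Data.List.Relation.Unary.AllPairs.Properties as AllPairs
open import Data.List.Relation.Unary.Any using (here; there)
open import Data.List.Relation.Unary.Unique.Propositional using (Unique)
import Data.List.Relation.Unary.Unique.Propositional.Properties as Unique
open import Data.Nat as ℕ using (ℕ; zero; suc; z≤n; s≤s)
import Data.Nat.Properties as ℕ
open import Data.Product using (∃; _×_; _,_; proj₁; proj₂)
open import Data.Rational as ℚ using (ℚ; 0ℚ; 1ℚ; ½; _⊓_; _+_; _*_; _-_; -_; _/_; ∣_∣; _≤_; _<_; *<*)
open import Data.Rational.Properties
open import Data.Rational.Solver using () renaming (module +-*-Solver to ℚ-Solver)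
import Data.Rational.Unnormalised as ℚᵘ
import Data.Rational.Unnormalised.Properties as ℚᵘ
open import Data.Sum using (_⊎_; inj₁; inj₂)
open import Function using (_∘_; _⇔_; mk⇔; Equivalence)
open import Level using (0ℓ)
open import Relation.Binary.Definitions using (tri<; tri≈; tri>)
open import Relation.Binary.PropositionalEquality
  using (_≡_; refl; sym; trans; cong; cong₂; subst; subst₂; module ≡-Reasoning)
open import Relation.Nullary using (yes; no; does; ¬_; contradiction)
open import Relation.Nullary.Decidable using (dec-true; dec-false)
open import Relation.Unary using (Pred; Decidable)
open import Relation.Unary.Properties using (∁?)

-- Finite sums and the exponential series

-- A strict inequality of Cauchy reals asks for one rational gap that is valid at all late indices,
-- and the right-hand side at index `n` is a truncated series at an argument that itself changes
-- with `n`. Therefore the estimates on the exponential series are uniform in the argument, and the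
-- moments of the martingale are bounded degree by degree, so that the bound holds for every
-- truncation at once.
--
-- An even test function controls both tails together; this is the origin of the factor 2. The
-- exponent is Hoeffding's: for `m` steps of size 4, the parameter λ = c / (16 √m) turns λ c √m - m
-- 4² λ² / 2 into c² / 32.
--
-- That a choice moves the mean by at most 4 takes monotonicity twice: once for the two families of
-- tilings as they are, which gives the sign of the change, and once with 4 added to all heights of
-- the lower family. Adding 4 keeps the residues modulo 4, without which minima and maxima would not
-- be height functions.

≤-by : ∀ {p q} e → 0ℚ ≤ e → p + e ≡ q → p ≤ q
≤-by {p} e 0≤e eq = ≤-trans (≤-grow {p} {e} 0≤e) (≤-reflexive eq)

p≤∣p∣ : ∀ p → p ≤ ∣ p ∣
p≤∣p∣ p with ≤-total 0ℚ p
... | inj₁ 0≤p = ≤-reflexive (sym (0≤p⇒∣p∣≡p 0≤p))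
... | inj₂ p≤0 = ≤-trans p≤0 (0≤∣p∣ p)

p≤q⇒0≤q-p : ∀ {p q} → p ≤ q → 0ℚ ≤ q - p
p≤q⇒0≤q-p {p} {q} p≤q = ≤-trans (≤-reflexive (sym (+-inverseʳ p))) (+-monoˡ-≤ (- p) p≤q)

0≤1 : 0ℚ ≤ 1ℚ
0≤1 = <⇒≤ (positive⁻¹ 1ℚ)

0≤fromℕ : ∀ n → 0ℚ ≤ fromℕ n
0≤fromℕ n = fromℕ-mono {0} {n} z≤n

0<fromℕ-suc : ∀ n → 0ℚ < fromℕ (suc n)
0<fromℕ-suc n = positive⁻¹ (fromℕ (suc n))

0≤inv : ∀ k → 0ℚ ≤ inv k
0≤inv k = <⇒≤ (positive⁻¹ (inv k))

fromℕ-+ : ∀ m n → fromℕ (m ℕ.+ n) ≡ fromℕ m + fromℕ n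
fromℕ-+ zero    n = sym (+-identityˡ (fromℕ n))
fromℕ-+ (suc m) n = trans (fromℕ-suc (m ℕ.+ n)) (trans (cong (_+ 1ℚ) (fromℕ-+ m n))
  (trans (solve 3 (λ a b c → (a :+ b) :+ c := (a :+ c) :+ b) refl (fromℕ m) (fromℕ n) 1ℚ)
    (cong (_+ fromℕ n) (sym (fromℕ-suc m)))))
  where open ℚ-Solver

*-inv : ∀ q k → fromℕ (suc k) * q * inv k ≡ q
*-inv q k = trans (solve 3 (λ a q i → a :* q :* i := a :* i :* q) refl (fromℕ (suc k)) q (inv k))
  (trans (cong (_* q) (*-inverseʳ (fromℕ (suc k)))) (*-identityˡ q))
  where open ℚ-Solver

inv-unique : ∀ q k → q * fromℕ (suc k) ≡ 1ℚ → inv k ≡ q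
inv-unique q k eq = trans (sym (*-identityˡ (inv k))) (trans (cong (_* inv k) (sym eq))
  (trans (cong (_* inv k) (*-comm q (fromℕ (suc k)))) (*-inv q k)))

Σ≤ : ℕ → (ℕ → ℚ) → ℚ
Σ≤ zero    f = f 0
Σ≤ (suc n) f = Σ≤ n f + f (suc n)

Σ≤-cong : ∀ n {f g} → (∀ i → i ℕ.≤ n → f i ≡ g i) → Σ≤ n f ≡ Σ≤ n g
Σ≤-cong zero    f≡g = f≡g 0 z≤n
Σ≤-cong (suc n) f≡g = cong₂ _+_ (Σ≤-cong n (λ i i≤n → f≡g i (ℕ.m≤n⇒m≤1+n i≤n)))
  (f≡g (suc n) ℕ.≤-refl)

Σ≤-mono : ∀ n {f g} → (∀ i → i ℕ.≤ n → f i ≤ g i) → Σ≤ n f ≤ Σ≤ n g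
Σ≤-mono zero    f≤g = f≤g 0 z≤n
Σ≤-mono (suc n) f≤g = +-mono-≤ (Σ≤-mono n (λ i i≤n → f≤g i (ℕ.m≤n⇒m≤1+n i≤n)))
  (f≤g (suc n) ℕ.≤-refl)

Σ≤-+ : ∀ n f g → Σ≤ n (λ i → f i + g i) ≡ Σ≤ n f + Σ≤ n g
Σ≤-+ zero    f g = refl
Σ≤-+ (suc n) f g = trans (cong (_+ (f (suc n) + g (suc n))) (Σ≤-+ n f g))
  (solve 4 (λ a b c d → (a :+ b) :+ (c :+ d) := (a :+ c) :+ (b :+ d)) refl
    (Σ≤ n f) (Σ≤ n g) (f (suc n)) (g (suc n)))
  where open ℚ-Solver

Σ≤-*ˡ : ∀ n q f → Σ≤ n (λ i → q * f i) ≡ q * Σ≤ n f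
Σ≤-*ˡ zero    q f = refl
Σ≤-*ˡ (suc n) q f = trans (cong (_+ q * f (suc n)) (Σ≤-*ˡ n q f))
  (sym (*-distribˡ-+ q (Σ≤ n f) (f (suc n))))

Σ≤-*ʳ : ∀ n q f → Σ≤ n (λ i → f i * q) ≡ Σ≤ n f * q
Σ≤-*ʳ n q f = trans (Σ≤-cong n (λ i _ → *-comm (f i) q)) (trans (Σ≤-*ˡ n q f) (*-comm q (Σ≤ n f)))

Σ≤-head : ∀ n f → Σ≤ (suc n) f ≡ f 0 + Σ≤ n (f ∘ suc)
Σ≤-head zero    f = refl
Σ≤-head (suc n) f = trans (cong (_+ f (suc (suc n))) (Σ≤-head n f)) (+-assoc (f 0) _ _)

Σ≤-nonNeg : ∀ n {f} → (∀ i → 0ℚ ≤ f i) → 0ℚ ≤ Σ≤ n f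
Σ≤-nonNeg zero    0≤f = 0≤f 0
Σ≤-nonNeg (suc n) {f} 0≤f = 0≤+ {Σ≤ n f} {f (suc n)} (Σ≤-nonNeg n 0≤f) (0≤f (suc n))

Σ≤-extend : ∀ {f} n j → (∀ i → 0ℚ ≤ f i) → Σ≤ n f ≤ Σ≤ (n ℕ.+ j) f
Σ≤-extend {f} n zero    0≤f = ≤-reflexive (cong (λ k → Σ≤ k f) (sym (ℕ.+-identityʳ n)))
Σ≤-extend {f} n (suc j) 0≤f = ≤-trans (Σ≤-extend n j 0≤f)
  (≤-trans (≤-grow {Σ≤ (n ℕ.+ j) f} {f (suc (n ℕ.+ j))} (0≤f _)) (≤-reflexive (cong (λ k → Σ≤ k f)
    (sym (ℕ.+-suc n j)))))

∣Σ≤∣ : ∀ n f → ∣ Σ≤ n f ∣ ≤ Σ≤ n (∣_∣ ∘ f)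
∣Σ≤∣ zero    f = ≤-refl
∣Σ≤∣ (suc n) f = ∣∣-add-bound {Σ≤ n f} {f (suc n)} (∣Σ≤∣ n f) ≤-refl

expSum≡Σ≤ : ∀ x n → expSum x n ≡ Σ≤ n (expTerm x)
expSum≡Σ≤ x zero    = refl
expSum≡Σ≤ x (suc n) = cong (_+ expTerm x (suc n)) (expSum≡Σ≤ x n)

*-expTerm : ∀ x k → x * expTerm x k ≡ fromℕ (suc k) * expTerm x (suc k)
*-expTerm x k = sym (trans (sym (*-assoc (fromℕ (suc k)) (x * expTerm x k) (inv k)))
  (*-inv (x * expTerm x k) k))

-- The binomial theorem divided by `k !`. In the induction step the factor `k + 1` is split as
-- `i + (k + 1 - i)`: multiplication by `x` produces the terms weighted by `i`, multiplication by
-- `y` those weighted by `k + 1 - i`.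
expTerm-+ : ∀ x y k → expTerm (x + y) k ≡ Σ≤ k (λ i → expTerm x i * expTerm y (k ℕ.∸ i))
expTerm-+ x y zero    = refl
expTerm-+ x y (suc k) = trans (cong (_* inv k) step-k) (*-inv (Σ≤ (suc k) F) k)
  where
  open ℚ-Solver
  F G H A B : ℕ → ℚ
  F i = expTerm x i * expTerm y (suc k ℕ.∸ i)
  G i = fromℕ i * F i
  H i = fromℕ (suc k ℕ.∸ i) * F i
  A i = x * (expTerm x i * expTerm y (k ℕ.∸ i))
  B i = y * (expTerm x i * expTerm y (k ℕ.∸ i))
  G-sum : Σ≤ k A ≡ Σ≤ (suc k) G
  G-sum = trans (Σ≤-cong k (λ i _ → trans (sym (*-assoc x (expTerm x i) (expTerm y (k ℕ.∸ i))))
            (trans (cong (_* expTerm y (k ℕ.∸ i)) (*-expTerm x i)) (*-assoc (fromℕ (suc i))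
              (expTerm x (suc i)) (expTerm y (k ℕ.∸ i))))))
    (trans (sym (+-identityˡ (Σ≤ k (G ∘ suc))))
      (trans (cong (_+ Σ≤ k (G ∘ suc)) (sym (*-zeroˡ (F 0)))) (sym (Σ≤-head k G))))
  H-last : H (suc k) ≡ 0ℚ
  H-last = trans (cong (λ j → fromℕ j * F (suc k)) (ℕ.n∸n≡0 k)) (*-zeroˡ (F (suc k)))
  H-sum : Σ≤ k B ≡ Σ≤ (suc k) H
  H-sum = trans (Σ≤-cong k (λ i i≤k → trans
      (solve 3 (λ y a b → y :* (a :* b) := a :* (y :* b)) refl y (expTerm x i)
        (expTerm y (k ℕ.∸ i)))
      (trans (cong (expTerm x i *_) (trans (*-expTerm y (k ℕ.∸ i))
               (cong (λ j → fromℕ j * expTerm y j) (sym (ℕ.+-∸-assoc 1 i≤k)))))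
        (solve 3 (λ a n b → a :* (n :* b) := n :* (a :* b)) refl (expTerm x i) (fromℕ (suc k ℕ.∸ i))
          (expTerm y (suc k ℕ.∸ i))))))
    (trans (sym (+-identityʳ (Σ≤ k H))) (cong (_+_ (Σ≤ k H)) (sym H-last)))
  step-k : (x + y) * expTerm (x + y) k ≡ fromℕ (suc k) * Σ≤ (suc k) F
  step-k = trans (cong ((x + y) *_) (expTerm-+ x y k))
    (trans (sym (Σ≤-*ˡ k (x + y) (λ i → expTerm x i * expTerm y (k ℕ.∸ i))))
    (trans (Σ≤-cong k (λ i _ → *-distribʳ-+ (expTerm x i * expTerm y (k ℕ.∸ i)) x y))
    (trans (Σ≤-+ k A B)
    (trans (cong₂ _+_ G-sum H-sum)
    (trans (sym (Σ≤-+ (suc k) G H))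
    (trans (Σ≤-cong (suc k) (λ i i≤k → trans (sym (*-distribʳ-+ (F i) (fromℕ i)
      (fromℕ (suc k ℕ.∸ i))))
             (cong (_* F i) (trans (sym (fromℕ-+ i (suc k ℕ.∸ i)))
               (cong fromℕ (ℕ.m+[n∸m]≡n i≤k))))))
      (Σ≤-*ˡ (suc k) (fromℕ (suc k)) F)))))))

-- Both sides sum over the triangle `i + j ≤ n`, the left one by columns and the right one by
-- diagonals.
expSum-+ : ∀ x y n → Σ≤ n (λ i → expTerm x i * expSum y (n ℕ.∸ i)) ≡ expSum (x + y) n
expSum-+ x y zero    = refl
expSum-+ x y (suc n) = trans
  (cong₂ _+_
    (trans (Σ≤-cong n (λ i i≤n → trans (cong (λ j → expTerm x i * expSum y j) (ℕ.+-∸-assoc 1 i≤n))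
                               (trans (*-distribˡ-+ (expTerm x i) (expSum y (n ℕ.∸ i))
                                 (expTerm y (suc (n ℕ.∸ i))))
                                 (cong (λ j → expTerm x i * expSum y (n ℕ.∸ i) + expTerm x i
                                   * expTerm y j) (sym (ℕ.+-∸-assoc 1 i≤n))))))
           (trans (Σ≤-+ n (λ i → expTerm x i * expSum y (n ℕ.∸ i)) (λ i → expTerm x i * expTerm y
             (suc n ℕ.∸ i)))
             (cong (_+ Σ≤ n (λ i → expTerm x i * expTerm y (suc n ℕ.∸ i))) (expSum-+ x y n))))
    (cong (expTerm x (suc n) *_) (trans (cong (expSum y) (ℕ.n∸n≡0 n)) (cong (expTerm y)
      (sym (ℕ.n∸n≡0 n))))))
  (trans (+-assoc (expSum (x + y) n) _ _) (cong (_+_ (expSum (x + y) n))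
    (sym (expTerm-+ x y (suc n)))))

expTerm-nonNeg : ∀ x → 0ℚ ≤ x → ∀ k → 0ℚ ≤ expTerm x k
expTerm-nonNeg x 0≤x = ExpBounds.0≤t x 0≤x

expSum-mono : ∀ x → 0ℚ ≤ x → ∀ {m n} → m ℕ.≤ n → expSum x m ≤ expSum x n
expSum-mono x 0≤x {m} {n} m≤n = subst₂ _≤_ (sym (expSum≡Σ≤ x m))
  (trans (cong (λ k → Σ≤ k (expTerm x)) (ℕ.m+[n∸m]≡n m≤n)) (sym (expSum≡Σ≤ x n)))
  (Σ≤-extend m (n ℕ.∸ m) (expTerm-nonNeg x 0≤x))

expTerm-monoˡ : ∀ x y → 0ℚ ≤ x → x ≤ y → ∀ k → expTerm x k ≤ expTerm y k
expTerm-monoˡ x y 0≤x x≤y k = subst (_≤ expTerm y k) (0≤p⇒∣p∣≡p (expTerm-nonNeg x 0≤x k))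
  (ExpBounds.term-bound y (≤-trans 0≤x x≤y) x (≤-trans (≤-reflexive (0≤p⇒∣p∣≡p 0≤x)) x≤y) k)

expSum-monoˡ : ∀ x y → 0ℚ ≤ x → x ≤ y → ∀ n → expSum x n ≤ expSum y n
expSum-monoˡ x y 0≤x x≤y zero    = ≤-refl
expSum-monoˡ x y 0≤x x≤y (suc n) = +-mono-≤ (expSum-monoˡ x y 0≤x x≤y n) (expTerm-monoˡ x y 0≤x x≤y
  (suc n))

expSum-zero : ∀ n → expSum 0ℚ n ≡ 1ℚ
expSum-zero zero    = refl
expSum-zero (suc n) = trans (cong₂ _+_ (expSum-zero n)
  (trans (cong (_* inv n) (*-zeroˡ (expTerm 0ℚ n))) (*-zeroˡ (inv n)))) refl

-- The square `i, j ≤ n` lies in the triangle `i + j ≤ n + n`, and all terms are nonnegative.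
expSum-*-≤ : ∀ x y → 0ℚ ≤ x → 0ℚ ≤ y → ∀ n → expSum x n * expSum y n ≤ expSum (x + y) (n ℕ.+ n)
expSum-*-≤ x y 0≤x 0≤y n = begin
  expSum x n * expSum y n                               ≡⟨ cong (_* expSum y n) (expSum≡Σ≤ x n) ⟩
  Σ≤ n (expTerm x) * expSum y n                         ≡⟨ Σ≤-*ʳ n (expSum y n) (expTerm x) ⟨
  Σ≤ n (λ i → expTerm x i * expSum y n)                 ≤⟨ Σ≤-mono n (λ i i≤n
    → *-monoˡ {expTerm x i} {expSum y n} {expSum y (n ℕ.+ n ℕ.∸ i)} (expTerm-nonNeg x 0≤x i)
                                                             (expSum-mono y 0≤y (ℕ.≤-trans
                                                               (ℕ.m≤m+n n (n ℕ.∸ i))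
                                                               (ℕ.≤-reflexive (sym (ℕ.+-∸-assoc n
                                                               i≤n)))))) ⟩
  Σ≤ n (λ i → expTerm x i * expSum y (n ℕ.+ n ℕ.∸ i))   ≤⟨ Σ≤-extend n n (λ i
    → 0≤* {expTerm x i} {expSum y (n ℕ.+ n ℕ.∸ i)} (expTerm-nonNeg x 0≤x i) (ExpBounds.0≤S y 0≤y
    (n ℕ.+ n ℕ.∸ i))) ⟩
  Σ≤ (n ℕ.+ n) (λ i → expTerm x i * expSum y (n ℕ.+ n ℕ.∸ i)) ≡⟨ expSum-+ x y (n ℕ.+ n) ⟩
  expSum (x + y) (n ℕ.+ n)                              ∎
  where open ≤-Reasoning

-- The product sums over the square `i, j ≤ n`, of which the triangle `i + j ≤ n` alone contributes
-- `expSum (y - y) n = 1`. The rest is dominated termwise by the same terms with `y` in place of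
-- `- y`.
expSum-*-neg : ∀ y → 0ℚ ≤ y → ∀ n →
  ∣ expSum y n * expSum (- y) n - 1ℚ ∣ ≤ expSum (y + y) (n ℕ.+ n) - expSum (y + y) n
expSum-*-neg y 0≤y n = begin
  ∣ expSum y n * expSum (- y) n - 1ℚ ∣
    ≡⟨ cong (λ z → ∣ expSum y n * expSum (- y) n - z ∣) (trans (sym (expSum-zero n))
      (cong (λ z → expSum z n) (sym (+-inverseʳ y)))) ⟩
  ∣ expSum y n * expSum (- y) n - expSum (y + - y) n ∣
    ≡⟨ cong ∣_∣ (difference (- y)) ⟩
  ∣ Σ≤ n (λ i → expTerm y i * (expSum (- y) n - expSum (- y) (n ℕ.∸ i))) ∣
    ≤⟨ ∣Σ≤∣ n (λ i → expTerm y i * (expSum (- y) n - expSum (- y) (n ℕ.∸ i))) ⟩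
  Σ≤ n (λ i → ∣ expTerm y i * (expSum (- y) n - expSum (- y) (n ℕ.∸ i)) ∣)
    ≤⟨ Σ≤-mono n (λ i i≤n → ∣∣-mul-bound {expTerm y i} {expSum (- y) n - expSum (- y) (n ℕ.∸ i)}
      {expTerm y i} {expSum y n - expSum y (n ℕ.∸ i)}
         (≤-reflexive (0≤p⇒∣p∣≡p (expTerm-nonNeg y 0≤y i))) (tail-bound i i≤n)) ⟩
  Σ≤ n (λ i → expTerm y i * (expSum y n - expSum y (n ℕ.∸ i)))
    ≡⟨ difference y ⟨
  expSum y n * expSum y n - expSum (y + y) n
    ≤⟨ +-monoˡ-≤ (- expSum (y + y) n) (expSum-*-≤ y y 0≤y 0≤y n) ⟩
  expSum (y + y) (n ℕ.+ n) - expSum (y + y) n ∎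
  where
  open ≤-Reasoning
  open ℚ-Solver using (solve; _:+_; _:-_; _:*_; :-_; con; _:=_)
  difference : ∀ x → expSum y n * expSum x n - expSum (y + x) n
    ≡ Σ≤ n (λ i → expTerm y i * (expSum x n - expSum x (n ℕ.∸ i)))
  difference x = sym (trans (Σ≤-cong n (λ i _ →
      solve 3 (λ a b c → a :* (b :- c) := a :* b :+ (:- con 1ℚ) :* (a :* c)) refl (expTerm y i)
        (expSum x n) (expSum x (n ℕ.∸ i))))
    (trans (Σ≤-+ n (λ i → expTerm y i * expSum x n) (λ i →
      (- 1ℚ) * (expTerm y i * expSum x (n ℕ.∸ i))))
    (trans (cong₂ _+_ (trans (Σ≤-*ʳ n (expSum x n) (expTerm y)) (cong (_* expSum x n)
      (sym (expSum≡Σ≤ y n))))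
                      (trans (Σ≤-*ˡ n (- 1ℚ) (λ i → expTerm y i * expSum x (n ℕ.∸ i)))
                        (cong ((- 1ℚ) *_) (expSum-+ y x n))))
      (solve 2 (λ a b → a :+ (:- con 1ℚ) :* b := a :- b) refl (expSum y n * expSum x n)
        (expSum (y + x) n)))))
  tail-bound : ∀ i → i ℕ.≤ n → ∣ expSum (- y) n - expSum (- y) (n ℕ.∸ i) ∣ ≤ expSum y n - expSum y
    (n ℕ.∸ i)
  tail-bound i i≤n = subst (λ k → ∣ expSum (- y) k - expSum (- y) (n ℕ.∸ i) ∣
    ≤ expSum y k - expSum y (n ℕ.∸ i))
    (ℕ.m∸n+n≡m i≤n)
    (ExpBounds.sum-tail y 0≤y (- y) (≤-reflexive (trans (∣-p∣≡∣p∣ y) (0≤p⇒∣p∣≡p 0≤y))) (n ℕ.∸ i) i)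

-- The index depends on `B` and `η` only, because `y` will be a rational approximation that varies
-- with `n`.
expSum-inverse : ∀ B η → 0ℚ ≤ B → 0ℚ < η →
  ∃ λ k → ∀ n → k ℕ.≤ n → ∀ y → 0ℚ ≤ y → y ≤ B → 1ℚ - η ≤ expSum y n * expSum (- y) n
-- The tail after index `n` is at most the term at `n`, and `t-vanishes` bounds terms of successor
-- index; hence `suc k`.
expSum-inverse B η 0≤B 0<η = suc k , λ n k<n y 0≤y y≤B →
  let 0≤y+y = 0≤+ {y} {y} 0≤y 0≤y
      p = expSum y n * expSum (- y) n
      p-close : ∣ p - 1ℚ ∣ ≤ η
      p-close = ≤-trans (expSum-*-neg y 0≤y n) (≤-trans (p≤∣p∣ (expSum (y + y) (n ℕ.+ n) - expSum
        (y + y) n))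
        (≤-trans (ExpBounds.sum-tail (B + B) 0≤B+B (y + y)
                   (≤-trans (≤-reflexive (0≤p⇒∣p∣≡p 0≤y+y)) (+-mono-≤ y≤B y≤B)) n n)
          (≤-trans (+-shift {expSum (B + B) (n ℕ.+ n)} {expSum (B + B) n} {expTerm (B + B) n}
                     (ExpBounds.S-bound (B + B) 0≤B+B n (ℕ.≤-trans K≤k (ℕ.<⇒≤ k<n)) n))
            (small n k<n))))
  in ≤-by {1ℚ - η} {p} (η - (1ℚ - p)) (p≤q⇒0≤q-p 
       (≤-trans (p≤∣p∣ (1ℚ - p)) (≤-trans (≤-reflexive (∣-∣-comm 1ℚ p)) p-close)))
       (solve 2 (λ η p → (con 1ℚ :- η) :+ (η :- (con 1ℚ :- p)) := p) refl η p)
  where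
  open ℚ-Solver using (solve; _:+_; _:-_; _:*_; :-_; con; _:=_)
  0≤B+B = 0≤+ {B} {B} 0≤B 0≤B
  vanishes = ExpBounds.t-vanishes (B + B) 0≤B+B η 0<η
  k = proj₁ vanishes
  K≤k = proj₁ (proj₂ vanishes)
  small : ∀ n → k ℕ.< n → expTerm (B + B) n ≤ η
  small (suc n) (s≤s k≤n) = proj₂ (proj₂ vanishes) n k≤n

-- The truncated hyperbolic cosine

¼ : ℚ
¼ = ½ * ½

-- `q ^ j / (2 j) !`: for `q = x * x` these are the terms of cosh x.
evenTerm : ℚ → ℕ → ℚ
evenTerm q zero    = 1ℚ
evenTerm q (suc j) = q * evenTerm q j * (inv (j ℕ.+ j) * inv (suc (j ℕ.+ j)))

evenSum : ℚ → ℕ → ℚ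
evenSum q n = Σ≤ n (evenTerm q)

expTerm-double-suc : ∀ x j → expTerm x (suc j ℕ.+ suc j) ≡ expTerm x (suc (suc (j ℕ.+ j)))
expTerm-double-suc x j = cong (expTerm x ∘ suc) (ℕ.+-suc j j)

evenTerm≡expTerm : ∀ x j → evenTerm (x * x) j ≡ expTerm x (j ℕ.+ j)
evenTerm≡expTerm x zero    = refl
evenTerm≡expTerm x (suc j) = trans
  (trans (cong (λ t → x * x * t * (inv (j ℕ.+ j) * inv (suc (j ℕ.+ j)))) (evenTerm≡expTerm x j))
    (solve 4 (λ x t a b → x :* x :* t :* (a :* b) := x :* (x :* t :* a) :* b) refl
      x (expTerm x (j ℕ.+ j)) (inv (j ℕ.+ j)) (inv (suc (j ℕ.+ j)))))
  (sym (expTerm-double-suc x j))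
  where open ℚ-Solver

expTerm-neg-suc : ∀ x k s → expTerm (- x) k ≡ s * expTerm x k → expTerm (- x) (suc k)
  ≡ (- s) * expTerm x (suc k)
expTerm-neg-suc x k s eq = trans (cong (λ t → (- x) * t * inv k) eq)
  (solve 4 (λ x s t i → (:- x) :* (s :* t) :* i := (:- s) :* (x :* t :* i)) refl x s (expTerm x k)
    (inv k))
  where open ℚ-Solver

expTerm-neg-even : ∀ x j → expTerm (- x) (j ℕ.+ j) ≡ 1ℚ * expTerm x (j ℕ.+ j)
expTerm-neg-odd : ∀ x j → expTerm (- x) (suc (j ℕ.+ j)) ≡ (- 1ℚ) * expTerm x (suc (j ℕ.+ j))
expTerm-neg-even x zero    = refl
expTerm-neg-even x (suc j) = trans (expTerm-double-suc (- x) j)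
  (trans (expTerm-neg-suc x (suc (j ℕ.+ j)) (- 1ℚ) (expTerm-neg-odd x j))
    (cong (1ℚ *_) (sym (expTerm-double-suc x j))))
expTerm-neg-odd x j = expTerm-neg-suc x (j ℕ.+ j) 1ℚ (expTerm-neg-even x j)

expTerm-even-part : ∀ x j → expTerm x (j ℕ.+ j) + expTerm (- x) (j ℕ.+ j) ≡ (1ℚ + 1ℚ) * evenTerm
  (x * x) j
expTerm-even-part x j = trans (cong (_+_ (expTerm x (j ℕ.+ j))) (expTerm-neg-even x j))
  (trans (solve 1 (λ t → t :+ con 1ℚ :* t := (con 1ℚ :+ con 1ℚ) :* t) refl (expTerm x (j ℕ.+ j)))
    (cong ((1ℚ + 1ℚ) *_) (sym (evenTerm≡expTerm x j))))
  where open ℚ-Solver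

expTerm-odd-part : ∀ x j → expTerm x (suc (j ℕ.+ j)) + expTerm (- x) (suc (j ℕ.+ j)) ≡ 0ℚ
expTerm-odd-part x j = trans (cong (_+_ (expTerm x (suc (j ℕ.+ j)))) (expTerm-neg-odd x j))
  (solve 1 (λ t → t :+ (:- con 1ℚ) :* t := con 0ℚ) refl (expTerm x (suc (j ℕ.+ j))))
  where open ℚ-Solver

Σ≤-double-suc : ∀ j f → Σ≤ (suc j ℕ.+ suc j) f ≡ Σ≤ (j ℕ.+ j) f + f (suc (j ℕ.+ j)) + f
  (suc (suc (j ℕ.+ j)))
Σ≤-double-suc j f = cong (λ k → Σ≤ (suc k) f) (ℕ.+-suc j j)

Σ≤-even : ∀ j {f} → (∀ i → f (suc (i ℕ.+ i)) ≡ 0ℚ) → Σ≤ (j ℕ.+ j) f ≡ Σ≤ j (λ i → f (i ℕ.+ i))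
Σ≤-even zero    odd≡0 = refl
Σ≤-even (suc j) {f} odd≡0 = trans (Σ≤-double-suc j f) (cong₂ _+_
  (trans (cong (_+_ (Σ≤ (j ℕ.+ j) f)) (odd≡0 j)) (trans (+-identityʳ (Σ≤ (j ℕ.+ j) f))
    (Σ≤-even j odd≡0)))
  (cong (f ∘ suc) (sym (ℕ.+-suc j j))))

expSum-even-part : ∀ z n → expSum z (n ℕ.+ n) + expSum (- z) (n ℕ.+ n) ≡ (1ℚ + 1ℚ) * evenSum
  (z * z) n
expSum-even-part z n = trans (cong₂ _+_ (expSum≡Σ≤ z (n ℕ.+ n)) (expSum≡Σ≤ (- z) (n ℕ.+ n)))
  (trans (sym (Σ≤-+ (n ℕ.+ n) (expTerm z) (expTerm (- z))))
  (trans (Σ≤-even n (expTerm-odd-part z))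
  (trans (Σ≤-cong n (λ j _ → expTerm-even-part z j)) (Σ≤-*ˡ n (1ℚ + 1ℚ) (evenTerm (z * z))))))

evenTerm-nonNeg : ∀ q → 0ℚ ≤ q → ∀ j → 0ℚ ≤ evenTerm q j
evenTerm-nonNeg q 0≤q zero    = 0≤1
evenTerm-nonNeg q 0≤q (suc j) = 0≤* {q * evenTerm q j} {inv (j ℕ.+ j) * inv (suc (j ℕ.+ j))}
  (0≤* {q} {evenTerm q j} 0≤q (evenTerm-nonNeg q 0≤q j))
  (0≤* {inv (j ℕ.+ j)} {inv (suc (j ℕ.+ j))} (0≤inv (j ℕ.+ j)) (0≤inv (suc (j ℕ.+ j))))

evenTerm-mono : ∀ p q → 0ℚ ≤ p → p ≤ q → ∀ j → evenTerm p j ≤ evenTerm q j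
evenTerm-mono p q 0≤p p≤q zero    = ≤-refl
evenTerm-mono p q 0≤p p≤q (suc j) = *-monoʳ {i} {p * evenTerm p j} {q * evenTerm q j}
  (0≤* {inv (j ℕ.+ j)} {inv (suc (j ℕ.+ j))} (0≤inv (j ℕ.+ j)) (0≤inv (suc (j ℕ.+ j))))
  (*-mono {p} {q} {evenTerm p j} {evenTerm q j} (evenTerm-nonNeg p 0≤p j) (≤-trans 0≤p p≤q) p≤q
    (evenTerm-mono p q 0≤p p≤q j))
  where i = inv (j ℕ.+ j) * inv (suc (j ℕ.+ j))

evenSum-mono : ∀ p q → 0ℚ ≤ p → p ≤ q → ∀ n → evenSum p n ≤ evenSum q n
evenSum-mono p q 0≤p p≤q n = Σ≤-mono n (λ j _ → evenTerm-mono p q 0≤p p≤q j)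

evenSum-nonNeg : ∀ q → 0ℚ ≤ q → ∀ n → 0ℚ ≤ evenSum q n
evenSum-nonNeg q 0≤q n = Σ≤-nonNeg n (evenTerm-nonNeg q 0≤q)

1≤evenSum : ∀ q → 0ℚ ≤ q → ∀ n → 1ℚ ≤ evenSum q n
1≤evenSum q 0≤q n = Σ≤-extend 0 n (evenTerm-nonNeg q 0≤q)

evenSum≤expSum : ∀ z → 0ℚ ≤ z → ∀ n → evenSum (z * z) n ≤ expSum z (n ℕ.+ n)
evenSum≤expSum z 0≤z zero    = ≤-refl
evenSum≤expSum z 0≤z (suc n) = begin
  evenSum (z * z) n + evenTerm (z * z) (suc n) ≡⟨ cong (_+_ (evenSum (z * z) n))
    (trans (evenTerm≡expTerm z (suc n)) (expTerm-double-suc z n)) ⟩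
  evenSum (z * z) n + e₂  ≤⟨ +-monoˡ-≤ e₂ (≤-trans (evenSum≤expSum z 0≤z n)
    (≤-grow {expSum z (n ℕ.+ n)} {e₁} (expTerm-nonNeg z 0≤z (suc (n ℕ.+ n))))) ⟩
  expSum z (n ℕ.+ n) + e₁ + e₂  ≡⟨ cong (expSum z ∘ suc) (ℕ.+-suc n n) ⟨
  expSum z (suc n ℕ.+ suc n) ∎
  where
  open ≤-Reasoning
  e₁ = expTerm z (suc (n ℕ.+ n))
  e₂ = expTerm z (suc (suc (n ℕ.+ n)))

module _ (z : ℚ) (0≤z : 0ℚ ≤ z) where

  open ExpBounds z 0≤z using (C; K; S≤C)

  private
    small : ∃ λ σ → 0ℚ < σ × σ * C ≤ ¼
    small = shrink C ¼ (ExpBounds.0≤C z 0≤z) (positive⁻¹ ¼)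
    σ = proj₁ small
    inverse = expSum-inverse z ½ 0≤z (positive⁻¹ ½)
    k = proj₁ inverse

  -- A truncation of the exponential series at a negative argument can itself be negative, so
  -- positivity only holds from some index on. There the product with `expSum y n ≤ C` is at least
  -- `½`, whereas a value below `σ` would make it at most `¼`.
  expSum-neg-positive : ∃ λ σ → 0ℚ < σ × ∃ λ k → ∀ n → k ℕ.≤ n → ∀ y → 0ℚ ≤ y → y ≤ z → σ
    ≤ expSum (- y) n
  expSum-neg-positive = σ , proj₁ (proj₂ small) , k ℕ.+ K , λ n k+K≤n y 0≤y y≤z → ≮⇒≥ λ S<σ →
    <-irrefl refl (<-≤-trans (*<* (ℤ.+<+ (s≤s (s≤s (s≤s z≤n))))) (≤-trans
      (proj₂ inverse n (ℕ.≤-trans (ℕ.m≤m+n k K) k+K≤n) y 0≤y y≤z)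
      (≤-trans (*-monoˡ {expSum y n} {expSum (- y) n} {σ} (ExpBounds.0≤S y 0≤y n) (<⇒≤ S<σ))
        (≤-trans (*-monoʳ {σ} {expSum y n} {C} (<⇒≤ (proj₁ (proj₂ small)))
                   (≤-trans (expSum-monoˡ y z 0≤y y≤z n) (S≤C n (ℕ.≤-trans (ℕ.m≤n+m K k) k+K≤n))))
          (≤-trans (≤-reflexive (*-comm C σ)) (proj₂ (proj₂ small)))))))

-- Writing C for evenSum (z * z) n, which approximates cosh z, the hypotheses give
-- C P e^y ≤ e^(q + y) ≤ e^z = 2 C - e^(-z), so that P e^y < 2 with a gap.
exp-bound : ∀ P z q (y : ℕ → ℚ) k → 0ℚ ≤ P → 0ℚ ≤ z → 0ℚ ≤ q →
  (∀ n → k ℕ.≤ n → 0ℚ ≤ y n × q + y n ≤ z) →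
  (∀ n → P * evenSum (z * z) n ≤ expSum q n) →
  ∃ λ ε → 0ℚ < ε × ∃ λ N₀ → ∀ n → N₀ ℕ.≤ n → P + ε ≤ (1ℚ + 1ℚ) * expSum (- y n) n
exp-bound P z q y k 0≤P 0≤z 0≤q hy hP = ε , 0<ε , k ℕ.+ (k₁ ℕ.+ (k₂ ℕ.+ K)) , final
  where
  open ExpBounds z 0≤z using (C; K; S≤C)
  open ℚ-Solver using (solve; _:+_; _:-_; _:*_; :-_; con; _:=_)
  lower = expSum-neg-positive z 0≤z
  σ = proj₁ lower
  0<σ = proj₁ (proj₂ lower)
  k₁ = proj₁ (proj₂ (proj₂ lower))
  -- `C` also bounds the truncated cosh z, so `δ` times the latter is at most `σ` and hence at most
  -- the truncation of e^(-z): relative to cosh z, the term e^(-z) is worth at least `δ`.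
  gap = shrink C σ (ExpBounds.0≤C z 0≤z) 0<σ
  δ = proj₁ gap
  0<δ = proj₁ (proj₂ gap)
  -- The total gain is `δ * σ`. One half pays for `s⁺ * s⁻` being only `1 - η` instead of 1, the
  -- other half remains as the gap.
  ε = ½ * (δ * σ)
  0<ε = 0<* {½} {δ * σ} (positive⁻¹ ½) (0<* {δ} {σ} 0<δ 0<σ)
  small = shrink P ε 0≤P 0<ε
  η = proj₁ small
  inverse = expSum-inverse z η 0≤z (proj₁ (proj₂ small))
  k₂ = proj₁ inverse
  final : ∀ n → k ℕ.+ (k₁ ℕ.+ (k₂ ℕ.+ K)) ℕ.≤ n → P + ε ≤ (1ℚ + 1ℚ) * expSum (- y n) n
  final n h = ≤-by {P + ε} {(1ℚ + 1ℚ) * s⁻} (e₁ + (e₂ + δ * (s⁻ - σ)))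
      (0≤+ {e₁} {e₂ + δ * (s⁻ - σ)} (p≤q⇒0≤q-p (proj₂ (proj₂ small)))
        (0≤+ {e₂} {δ * (s⁻ - σ)} 0≤e₂ (0≤* {δ} {s⁻ - σ} (<⇒≤ 0<δ) (p≤q⇒0≤q-p σ≤s⁻))))
      (solve 5 (λ P δ σ η s → (P :+ con ½ :* (δ :* σ)) :+ ((con ½ :* (δ :* σ) :- η :* P) :+
        (((con 1ℚ :+ con 1ℚ :- δ) :* s :- P :* (con 1ℚ :- η)) :+ δ :* (s :- σ)))
          := (con 1ℚ :+ con 1ℚ) :* s) refl P δ σ η s⁻)
    where
    k≤n = ℕ.≤-trans (ℕ.m≤m+n k _) h
    k₁≤n = ℕ.≤-trans (ℕ.≤-trans (ℕ.m≤m+n k₁ (k₂ ℕ.+ K)) (ℕ.m≤n+m _ k)) h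
    k₂≤n = ℕ.≤-trans (ℕ.≤-trans (ℕ.m≤m+n k₂ K) (ℕ.≤-trans (ℕ.m≤n+m _ k₁) (ℕ.m≤n+m _ k))) h
    K≤n = ℕ.≤-trans (ℕ.≤-trans (ℕ.m≤n+m K k₂) (ℕ.≤-trans (ℕ.m≤n+m _ k₁) (ℕ.m≤n+m _ k))) h
    n≤n+n = ℕ.m≤m+n n n
    y₀ = y n
    0≤y = proj₁ (hy n k≤n)
    y≤z : y₀ ≤ z
    y≤z = ≤-trans (≤-by {y₀} {q + y₀} q 0≤q (+-comm y₀ q)) (proj₂ (hy n k≤n))
    s⁺ = expSum y₀ n
    s⁻ = expSum (- y₀) n
    σ≤s⁻ : σ ≤ s⁻
    σ≤s⁻ = proj₂ (proj₂ (proj₂ lower)) n k₁≤n y₀ 0≤y y≤z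
    0≤s⁻ = ≤-trans (<⇒≤ 0<σ) σ≤s⁻
    c = evenSum (z * z) n
    0<c : 0ℚ < c
    0<c = <-≤-trans (positive⁻¹ 1ℚ) (1≤evenSum (z * z) (0≤* {z} {z} 0≤z 0≤z) n)
    c≤C = ≤-trans (evenSum≤expSum z 0≤z n) (S≤C (n ℕ.+ n) (ℕ.≤-trans K≤n n≤n+n))
    two-minus : (P * c) * s⁺ ≤ (1ℚ + 1ℚ - δ) * c
    two-minus = begin
      (P * c) * s⁺                        ≤⟨ *-monoʳ {s⁺} {P * c} {expSum q n}
        (ExpBounds.0≤S y₀ 0≤y n) (hP n) ⟩
      expSum q n * s⁺                     ≤⟨ expSum-*-≤ q y₀ 0≤q 0≤y n ⟩
      expSum (q + y₀) (n ℕ.+ n)           ≤⟨ expSum-monoˡ (q + y₀) z (0≤+ {q} {y₀} 0≤q 0≤y)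
        (proj₂ (hy n k≤n)) (n ℕ.+ n) ⟩
      expSum z (n ℕ.+ n)                  ≡⟨ solve 2 (λ a b → a := (a :+ b) :- b) refl
        (expSum z (n ℕ.+ n)) s₂ ⟩
      (expSum z (n ℕ.+ n) + s₂) - s₂      ≡⟨ cong (_- s₂) (expSum-even-part z n) ⟩
      (1ℚ + 1ℚ) * c - s₂                  ≤⟨ ≤-by {(1ℚ + 1ℚ) * c - s₂} {(1ℚ + 1ℚ - δ) * c}
        (s₂ - δ * c) (p≤q⇒0≤q-p δc≤s₂)
                                               (solve 3 (λ c s δ → ((con 1ℚ :+ con 1ℚ) :* c :- s)
                                                 :+ (s :- δ :* c) := (con 1ℚ :+ con 1ℚ :- δ) :* c)
                                                 refl c s₂ δ) ⟩
      (1ℚ + 1ℚ - δ) * c                   ∎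
      where
      open ≤-Reasoning
      s₂ = expSum (- z) (n ℕ.+ n)
      δc≤s₂ : δ * c ≤ s₂
      δc≤s₂ = ≤-trans (*-monoˡ {δ} {c} {C} (<⇒≤ 0<δ) c≤C) (≤-trans (proj₂ (proj₂ gap))
        (proj₂ (proj₂ (proj₂ lower)) (n ℕ.+ n) (ℕ.≤-trans k₁≤n n≤n+n) z 0≤z ≤-refl))
    Ps⁺ : P * s⁺ ≤ 1ℚ + 1ℚ - δ
    Ps⁺ = *-cancelʳ-≤-pos c {{ℚ.positive 0<c}} (≤-trans (≤-reflexive
      (solve 3 (λ P s c → P :* s :* c := P :* c :* s) refl P s⁺ c)) two-minus)
    e₁ = ε - η * P
    e₂ = (1ℚ + 1ℚ - δ) * s⁻ - P * (1ℚ - η)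
    0≤e₂ : 0ℚ ≤ e₂
    0≤e₂ = p≤q⇒0≤q-p (≤-trans
      (*-monoˡ {P} {1ℚ - η} {s⁺ * s⁻} 0≤P (proj₂ inverse n k₂≤n y₀ 0≤y y≤z))
      (≤-trans (≤-reflexive (sym (*-assoc P s⁺ s⁻))) (*-monoʳ {s⁻} {P * s⁺} {1ℚ + 1ℚ - δ} 0≤s⁻
        Ps⁺)))

-- Random walks, convexity and moments

0≤-cancelˡ : ∀ {p q} → 0ℚ < p → 0ℚ ≤ p * q → 0ℚ ≤ q
0≤-cancelˡ {p} {q} 0<p 0≤pq = *-cancelˡ-≤-pos p {{ℚ.positive 0<p}}
  (≤-trans (≤-reflexive (*-zeroʳ p)) 0≤pq)

0≤x² : ∀ x → 0ℚ ≤ x * x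
0≤x² x with ≤-total 0ℚ x
... | inj₁ 0≤x = 0≤* {x} {x} 0≤x 0≤x
... | inj₂ x≤0 = ≤-trans (0≤* { - x} { - x} (neg-antimono-≤ x≤0) (neg-antimono-≤ x≤0))
  (≤-reflexive (solve 1 (λ x → (:- x) :* (:- x) := x :* x) refl x))
  where open ℚ-Solver

inv≤1 : ∀ k → inv k ≤ 1ℚ
inv≤1 k = ≤-trans (≤-reflexive (sym (*-identityʳ (inv k))))
  (≤-trans (*-monoˡ {inv k} {1ℚ} {fromℕ (suc k)} (0≤inv k) (fromℕ-mono {1} {suc k} (s≤s z≤n)))
    (≤-reflexive (*-inverseˡ (fromℕ (suc k)))))

inv-double : ∀ j → inv (suc (j ℕ.+ j)) ≡ ½ * inv j
inv-double j = inv-unique (½ * inv j) (suc (j ℕ.+ j)) (begin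
  ½ * inv j * fromℕ (suc (suc (j ℕ.+ j)))       ≡⟨ cong (λ k → ½ * inv j * fromℕ (suc k))
    (sym (ℕ.+-suc j j)) ⟩
  ½ * inv j * fromℕ (suc j ℕ.+ suc j)           ≡⟨ cong (½ * inv j *_) (fromℕ-+ (suc j) (suc j)) ⟩
  ½ * inv j * (fromℕ (suc j) + fromℕ (suc j))   ≡⟨ solve 2 (λ i f → con ½ :* i :* (f :+ f)
    := f :* con 1ℚ :* i) refl (inv j) (fromℕ (suc j)) ⟩
  fromℕ (suc j) * 1ℚ * inv j                    ≡⟨ *-inv 1ℚ j ⟩
  1ℚ                                            ∎)
  where
  open ≡-Reasoning
  open ℚ-Solver using (solve; _:+_; _:-_; _:*_; :-_; con; _:=_)

-- This is cosh x ≤ e^(x²/2), term by term: `(2 j) !` is at least `2 ^ j` times `j !`, since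
-- `(2 j + 1) (2 j + 2) ≥ 2 (j + 1)`.
evenTerm≤expTerm : ∀ q → 0ℚ ≤ q → ∀ j → evenTerm q j ≤ expTerm (½ * q) j
evenTerm≤expTerm q 0≤q zero    = ≤-refl
evenTerm≤expTerm q 0≤q (suc j) = begin
  q * t * (i * inv (suc (j ℕ.+ j)))  ≡⟨ cong (λ k → q * t * (i * k)) (inv-double j) ⟩
  q * t * (i * (½ * inv j))          ≡⟨ solve 5 (λ q t i h k → q :* t :* (i :* (h :* k))
    := (h :* q :* k) :* (t :* i)) refl q t i ½ (inv j) ⟩
  (½ * q * inv j) * (t * i)          ≤⟨ *-monoˡ {½ * q * inv j} {t * i} {e} 0≤c
    (≤-trans (*-monoˡ {t} {i} {1ℚ} (evenTerm-nonNeg q 0≤q j) (inv≤1 (j ℕ.+ j)))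
                                          (≤-trans (≤-reflexive (*-identityʳ t))
                                            (evenTerm≤expTerm q 0≤q j))) ⟩
  (½ * q * inv j) * e                ≡⟨ solve 4 (λ h q k e → (h :* q :* k) :* e
    := (h :* q :* e) :* k) refl ½ q (inv j) e ⟩
  ½ * q * e * inv j                  ∎
  where
  open ≤-Reasoning
  open ℚ-Solver using (solve; _:+_; _:-_; _:*_; :-_; con; _:=_)
  t = evenTerm q j
  i = inv (j ℕ.+ j)
  e = expTerm (½ * q) j
  0≤c : 0ℚ ≤ ½ * q * inv j
  0≤c = 0≤* {½ * q} {inv j} (0≤* {½} {q} (<⇒≤ (positive⁻¹ ½)) 0≤q) (0≤inv j)

power : ℚ → ℕ → ℚ
power q zero    = 1ℚ
power q (suc n) = q * power q n

power-nonNeg : ∀ q → 0ℚ ≤ q → ∀ n → 0ℚ ≤ power q n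
power-nonNeg q 0≤q zero    = 0≤1
power-nonNeg q 0≤q (suc n) = 0≤* {q} {power q n} 0≤q (power-nonNeg q 0≤q n)

evenTerm-* : ∀ p q j → evenTerm (p * q) j ≡ power p j * evenTerm q j
evenTerm-* p q zero    = refl
evenTerm-* p q (suc j) = trans (cong (λ t → p * q * t * i) (evenTerm-* p q j))
  (solve 5 (λ p q a b i → p :* q :* (a :* b) :* i := p :* a :* (q :* b :* i)) refl p q (power p j)
    (evenTerm q j) i)
  where
  open ℚ-Solver
  i = inv (j ℕ.+ j) * inv (suc (j ℕ.+ j))

expTerm-* : ∀ p q j → expTerm (p * q) j ≡ power p j * expTerm q j
expTerm-* p q zero    = refl
expTerm-* p q (suc j) = trans (cong (λ t → p * q * t * inv j) (expTerm-* p q j))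
  (solve 5 (λ p q a b i → p :* q :* (a :* b) :* i := p :* a :* (q :* b :* i)) refl p q (power p j)
    (expTerm q j) (inv j))
  where open ℚ-Solver

module Average (a : ℚ) where

  -- The expectation of g one step of size a of the simple random walk later.
  average : (ℚ → ℚ) → ℚ → ℚ
  average g x = ½ * (g (x - a) + g (x + a))

  averages : ℕ → (ℚ → ℚ) → ℚ → ℚ
  averages zero    g = g
  averages (suc n) g = average (averages n g)

  averages-cong : ∀ n {f g} → (∀ x → f x ≡ g x) → ∀ x → averages n f x ≡ averages n g x
  averages-cong zero    f≡g x = f≡g x
  averages-cong (suc n) f≡g x = cong (½ *_) (cong₂ _+_ (averages-cong n f≡g (x - a))
    (averages-cong n f≡g (x + a)))

  averages-average : ∀ n g x → averages n (average g) x ≡ average (averages n g) x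
  averages-average zero    g x = refl
  averages-average (suc n) g x = cong (½ *_) (cong₂ _+_ (averages-average n g (x - a))
    (averages-average n g (x + a)))

  averages-Σ≤ : ∀ n j (c : ℕ → ℚ) (g : ℕ → ℚ → ℚ) x →
    averages n (λ x → Σ≤ j (λ i → c i * g i x)) x ≡ Σ≤ j (λ i → c i * averages n (g i) x)
  averages-Σ≤ zero    j c g x = refl
  averages-Σ≤ (suc n) j c g x = trans
    (cong (½ *_) (trans (cong₂ _+_ (averages-Σ≤ n j c g (x - a)) (averages-Σ≤ n j c g (x + a)))
      (sym (Σ≤-+ j _ _))))
    (trans (sym (Σ≤-*ˡ j ½ _)) (Σ≤-cong j (λ i _ →
      solve 4 (λ h c u v → h :* (c :* u :+ c :* v) := c :* (h :* (u :+ v))) refl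
        ½ (c i) (averages n (g i) (x - a)) (averages n (g i) (x + a)))))
    where open ℚ-Solver

  double-∸ : ∀ {i j} → i ℕ.≤ j → (j ℕ.+ j) ℕ.∸ (i ℕ.+ i) ≡ (j ℕ.∸ i) ℕ.+ (j ℕ.∸ i)
  double-∸ {i} {j} i≤j = trans (cong (λ k → (k ℕ.+ k) ℕ.∸ (i ℕ.+ i)) (sym (ℕ.m+[n∸m]≡n i≤j)))
    (trans (cong (ℕ._∸ (i ℕ.+ i)) (interchange i (j ℕ.∸ i) i (j ℕ.∸ i))) (ℕ.m+n∸m≡n (i ℕ.+ i) _))
    where open import Algebra.Properties.CommutativeSemigroup ℕ.+-commutativeSemigroup
            using (interchange)

  -- The part of degree `2 j` of ½ (cosh (x - a) + cosh (x + a)) = cosh a cosh x; the odd powers of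
  -- `a` cancel.
  average-evenTerm : ∀ j x → average (λ x → evenTerm (x * x) j) x ≡
    Σ≤ j (λ i → evenTerm (a * a) i * evenTerm (x * x) (j ℕ.∸ i))
  average-evenTerm j x = begin
    ½ * (evenTerm ((x - a) * (x - a)) j + evenTerm ((x + a) * (x + a)) j)
      ≡⟨ cong (½ *_) (trans (+-comm (evenTerm ((x - a) * (x - a)) j)
        (evenTerm ((x + a) * (x + a)) j)) (cong₂ _+_ (expand a) (expand (- a)))) ⟩
    ½ * (Σ≤ d (λ k → expTerm a k * e k) + Σ≤ d (λ k → expTerm (- a) k * e k))
      ≡⟨ cong (½ *_) (trans (sym (Σ≤-+ d _ _)) (Σ≤-cong d (λ k _
        → sym (*-distribʳ-+ (e k) (expTerm a k) (expTerm (- a) k))))) ⟩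
    ½ * Σ≤ d (λ k → (expTerm a k + expTerm (- a) k) * e k)
      ≡⟨ cong (½ *_) (Σ≤-even j (λ i → trans (cong (_* e (suc (i ℕ.+ i))) (expTerm-odd-part a i))
        (*-zeroˡ (e (suc (i ℕ.+ i)))))) ⟩
    ½ * Σ≤ j (λ i → (expTerm a (i ℕ.+ i) + expTerm (- a) (i ℕ.+ i)) * e (i ℕ.+ i))
      ≡⟨ Σ≤-*ˡ j ½ _ ⟨
    Σ≤ j (λ i → ½ * ((expTerm a (i ℕ.+ i) + expTerm (- a) (i ℕ.+ i)) * e (i ℕ.+ i)))
      ≡⟨ Σ≤-cong j (λ i i≤j → trans
           (cong₂ (λ u v → ½ * (u * v)) (expTerm-even-part a i)
              (trans (cong (expTerm x) (double-∸ i≤j)) (sym (evenTerm≡expTerm x (j ℕ.∸ i)))))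
           (solve 2 (λ u v → con ½ :* ((con 1ℚ :+ con 1ℚ) :* u :* v) := u :* v) refl
             (evenTerm (a * a) i) (evenTerm (x * x) (j ℕ.∸ i)))) ⟩
    Σ≤ j (λ i → evenTerm (a * a) i * evenTerm (x * x) (j ℕ.∸ i)) ∎
    where
    open ≡-Reasoning
    open ℚ-Solver using (solve; _:+_; _:-_; _:*_; :-_; con; _:=_)
    d = j ℕ.+ j
    e : ℕ → ℚ
    e k = expTerm x (d ℕ.∸ k)
    expand : ∀ b → evenTerm ((x + b) * (x + b)) j ≡ Σ≤ d (λ k → expTerm b k * e k)
    expand b = trans (evenTerm≡expTerm (x + b) j) (trans (cong (λ y → expTerm y d) (+-comm x b))
      (expTerm-+ b x d))

  -- The moment bound E Sₙ²ʲ / (2j)! ≤ (n a² / 2)ʲ / j! for the random walk.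
  averages-evenTerm : ∀ n j → averages n (λ x → evenTerm (x * x) j) 0ℚ
    ≤ expTerm (fromℕ n * (½ * (a * a))) j
  averages-evenTerm zero    j = ≤-trans (evenTerm≤expTerm (0ℚ * 0ℚ) ≤-refl j)
    (≤-reflexive (cong (λ y → expTerm y j) (sym (*-zeroˡ (½ * (a * a))))))
  averages-evenTerm (suc n) j = begin
    averages (suc n) (λ x → evenTerm (x * x) j) 0ℚ
      -- The outermost average is moved inside, to the explicit polynomial, where the addition
      -- formula applies. The other `n` averages are still evaluated at 0, as the induction
      -- hypothesis requires.
      ≡⟨ averages-average n (λ x → evenTerm (x * x) j) 0ℚ ⟨
    averages n (average (λ x → evenTerm (x * x) j)) 0ℚ
      ≡⟨ averages-cong n (average-evenTerm j) 0ℚ ⟩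
    averages n (λ x → Σ≤ j (λ i → evenTerm (a * a) i * evenTerm (x * x) (j ℕ.∸ i))) 0ℚ
      ≡⟨ averages-Σ≤ n j (evenTerm (a * a)) (λ i x → evenTerm (x * x) (j ℕ.∸ i)) 0ℚ ⟩
    Σ≤ j (λ i → evenTerm (a * a) i * averages n (λ x → evenTerm (x * x) (j ℕ.∸ i)) 0ℚ)
      ≤⟨ Σ≤-mono j (λ i _ → ≤-trans
           (*-monoˡ {evenTerm (a * a) i} {averages n (λ x → evenTerm (x * x) (j ℕ.∸ i)) 0ℚ} {expTerm
             (fromℕ n * η) (j ℕ.∸ i)}
              (evenTerm-nonNeg (a * a) 0≤aa i) (averages-evenTerm n (j ℕ.∸ i)))
           (*-monoʳ {expTerm (fromℕ n * η) (j ℕ.∸ i)} {evenTerm (a * a) i} {expTerm η i}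
              (expTerm-nonNeg (fromℕ n * η) (0≤* {fromℕ n} {η} (0≤fromℕ n) 0≤η) (j ℕ.∸ i))
                (evenTerm≤expTerm (a * a) 0≤aa i))) ⟩
    Σ≤ j (λ i → expTerm η i * expTerm (fromℕ n * η) (j ℕ.∸ i))
      ≡⟨ expTerm-+ η (fromℕ n * η) j ⟨
    expTerm (η + fromℕ n * η) j
      ≡⟨ cong (λ y → expTerm y j) (trans (solve 2 (λ η f → η :+ f :* η := (f :+ con 1ℚ) :* η) refl η
        (fromℕ n)) (cong (_* η) (sym (fromℕ-suc n)))) ⟩
    expTerm (fromℕ (suc n) * η) j ∎
    where
    open ≤-Reasoning
    open ℚ-Solver using (solve; _:+_; _:-_; _:*_; :-_; con; _:=_)
    η = ½ * (a * a)
    0≤aa : 0ℚ ≤ a * a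
    0≤aa = 0≤x² a
    0≤η : 0ℚ ≤ η
    0≤η = 0≤* {½} {a * a} (<⇒≤ (positive⁻¹ ½)) 0≤aa

  averages-evenSum : ∀ τ → 0ℚ ≤ τ → ∀ n N₀ → averages n (λ x → evenSum (τ * (x * x)) N₀) 0ℚ
    ≤ expSum (τ * (fromℕ n * (½ * (a * a)))) N₀
  averages-evenSum τ 0≤τ n N₀ = begin
    averages n (λ x → evenSum (τ * (x * x)) N₀) 0ℚ
      ≡⟨ averages-cong n (λ x → Σ≤-cong N₀ (λ j _ → evenTerm-* τ (x * x) j)) 0ℚ ⟩
    averages n (λ x → Σ≤ N₀ (λ j → power τ j * evenTerm (x * x) j)) 0ℚ
      ≡⟨ averages-Σ≤ n N₀ (power τ) (λ j x → evenTerm (x * x) j) 0ℚ ⟩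
    Σ≤ N₀ (λ j → power τ j * averages n (λ x → evenTerm (x * x) j) 0ℚ)
      ≤⟨ Σ≤-mono N₀ (λ j _ → *-monoˡ {power τ j} {averages n (λ x → evenTerm (x * x) j) 0ℚ} {expTerm
        (fromℕ n * (½ * (a * a))) j} (power-nonNeg τ 0≤τ j) (averages-evenTerm n j)) ⟩
    Σ≤ N₀ (λ j → power τ j * expTerm (fromℕ n * (½ * (a * a))) j)
      ≡⟨ Σ≤-cong N₀ (λ j _ → sym (expTerm-* τ (fromℕ n * (½ * (a * a))) j)) ⟩
    Σ≤ N₀ (expTerm (τ * (fromℕ n * (½ * (a * a)))))
      ≡⟨ expSum≡Σ≤ (τ * (fromℕ n * (½ * (a * a)))) N₀ ⟨
    expSum (τ * (fromℕ n * (½ * (a * a)))) N₀ ∎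
    where open ≤-Reasoning

  -- Convexity of g along intervals of length 2a.
  Chord : (ℚ → ℚ) → Set
  Chord g = ∀ x d → 0ℚ ≤ a - d → 0ℚ ≤ a + d →
    (a + a) * g (x + d) ≤ (a - d) * g (x - a) + (a + d) * g (x + a)

  chord-average : ∀ {g} → Chord g → Chord (average g)
  chord-average {g} chord x d 0≤a-d 0≤a+d = begin
    (a + a) * (½ * (g (x + d - a) + g (x + d + a)))
      ≡⟨ cong₂ (λ y z → (a + a) * (½ * (g y + g z))) (shift x d (- a)) (shift x d a) ⟩
    (a + a) * (½ * (g (x - a + d) + g (x + a + d)))
      ≡⟨ solve 4 (λ a h u v → (a :+ a) :* (h :* (u :+ v)) := h :* ((a :+ a) :* u :+ (a :+ a) :* v))
        refl a ½ (g (x - a + d)) (g (x + a + d)) ⟩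
    ½ * ((a + a) * g (x - a + d) + (a + a) * g (x + a + d))
      ≤⟨ *-monoˡ {½} {(a + a) * g (x - a + d) + (a + a) * g (x + a + d)} {c * p + c' * q
        + (c * q' + c' * r)} (<⇒≤ (positive⁻¹ ½))
           (+-mono-≤ (chord (x - a) d 0≤a-d 0≤a+d) (chord (x + a) d 0≤a-d 0≤a+d)) ⟩
    ½ * (c * p + c' * q + (c * q' + c' * r))
      ≡⟨ cong (λ y → ½ * (c * p + c' * y + (c * q' + c' * r))) (cong g (shift x (- a) a)) ⟩
    ½ * (c * p + c' * q' + (c * q' + c' * r))
      ≡⟨ cong (λ y → ½ * (c * p + c' * q' + (c * y + c' * r))) (cong g (shift x a (- a))) ⟩
    ½ * (c * p + c' * q' + (c * q + c' * r))
      ≡⟨ solve 7 (λ h c c' p q q' r → h :* (c :* p :+ c' :* q' :+ (c :* q :+ c' :* r))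
        := c :* (h :* (p :+ q)) :+ c' :* (h :* (q' :+ r))) refl ½ c c' p q q' r ⟩
    c * (½ * (p + q)) + c' * (½ * (q' + r)) ∎
    where
    open ≤-Reasoning
    open ℚ-Solver using (solve; _:+_; _:-_; _:*_; :-_; con; _:=_)
    c = a - d
    c' = a + d
    p = g (x - a - a)
    q = g (x - a + a)
    q' = g (x + a - a)
    r = g (x + a + a)
    shift : ∀ x y z → x + y + z ≡ x + z + y
    shift = solve 3 (λ x y z → x :+ y :+ z := x :+ z :+ y) refl

  chord-averages : ∀ n {g} → Chord g → Chord (averages n g)
  chord-averages zero    {g} chord = chord
  chord-averages (suc n) {g} chord = chord-average {averages n g} (chord-averages n {g} chord)

  chord-const : ∀ c → Chord (λ _ → c)
  chord-const c x d _ _ = ≤-reflexive (solve 3 (λ a d c → (a :+ a) :* c := (a :- d) :* c :+ (a :+ d)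
    :* c) refl a d c)
    where open ℚ-Solver

  chord-+ : ∀ {f g} → Chord f → Chord g → Chord (λ x → f x + g x)
  chord-+ {f} {g} cf cg x d h h' = ≤-trans (≤-reflexive (*-distribˡ-+ (a + a) (f (x + d))
    (g (x + d))))
    (≤-trans (+-mono-≤ (cf x d h h') (cg x d h h'))
      (≤-reflexive (solve 6 (λ c c' p q r s → c :* p :+ c' :* q :+ (c :* r :+ c' :* s)
        := c :* (p :+ r) :+ c' :* (q :+ s)) refl
        (a - d) (a + d) (f (x - a)) (f (x + a)) (g (x - a)) (g (x + a)))))
    where open ℚ-Solver

  chord-Σ≤ : ∀ n {g : ℕ → ℚ → ℚ} → (∀ j → Chord (g j)) → Chord (λ x → Σ≤ n (λ j → g j x))
  chord-Σ≤ zero    {g} chord = chord 0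
  chord-Σ≤ (suc n) {g} chord = chord-+ {λ x → Σ≤ n (λ j → g j x)} {g (suc n)} (chord-Σ≤ n {g} chord)
    (chord (suc n))

  chord-translate : ∀ {g} y → Chord g → Chord (λ x → g (x - y))
  chord-translate {g} y chord x d h h' = subst₂ _≤_ (cong (λ z → (a + a) * g z) (shift x y d))
    (cong₂ (λ u v → (a - d) * g u + (a + d) * g v) (shift x y (- a)) (shift x y a))
      (chord (x - y) d h h')
    where
    open ℚ-Solver
    shift : ∀ x y z → x - y + z ≡ x + z - y
    shift = solve 3 (λ x y z → x :- y :+ z := x :+ z :- y) refl

  -- The two chord bounds are multiplied. By Chebyshev's sum inequality, the product of the weighted
  -- means of two comonotone functions is at most the weighted mean of their product.
  chord-* : 0ℚ < a → ∀ {f g} → (∀ x → 0ℚ ≤ f x) → (∀ x → 0ℚ ≤ g x) →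
    (∀ x y → 0ℚ ≤ (f x - f y) * (g x - g y)) → Chord f → Chord g → Chord (λ x → f x * g x)
  chord-* 0<a {f} {g} 0≤f 0≤g comonotone cf cg x d 0≤a-d 0≤a+d =
    *-cancelˡ-≤-pos (a + a) {{ℚ.positive 0<a+a}} (begin
    (a + a) * ((a + a) * (f₀ * g₀))
      ≡⟨ solve 3 (λ s f g → s :* (s :* (f :* g)) := (s :* f) :* (s :* g)) refl (a + a) f₀ g₀ ⟩
    ((a + a) * f₀) * ((a + a) * g₀)
      ≤⟨ *-mono {(a + a) * f₀} {(a - d) * f₁ + (a + d) * f₂} {(a + a) * g₀} {(a - d) * g₁ + (a + d)
        * g₂}
           (0≤* {a + a} {g₀} (<⇒≤ 0<a+a) (0≤g (x + d)))
           (≤-trans (0≤* {a + a} {f₀} (<⇒≤ 0<a+a) (0≤f (x + d))) (cf x d 0≤a-d 0≤a+d))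
           (cf x d 0≤a-d 0≤a+d) (cg x d 0≤a-d 0≤a+d) ⟩
    ((a - d) * f₁ + (a + d) * f₂) * ((a - d) * g₁ + (a + d) * g₂)
      ≤⟨ ≤-by {((a - d) * f₁ + (a + d) * f₂) * ((a - d) * g₁ + (a + d) * g₂)}
        ((a - d) * (a + d) * ((f₁ - f₂) * (g₁ - g₂)))
           (0≤* {(a - d) * (a + d)} {(f₁ - f₂) * (g₁ - g₂)} (0≤* {a - d} {a + d} 0≤a-d 0≤a+d)
             (comonotone (x - a) (x + a)))
           (solve 6 (λ a d f₁ f₂ g₁ g₂ → ((a :- d) :* f₁ :+ (a :+ d) :* f₂) :* ((a :- d) :* g₁
             :+ (a :+ d) :* g₂)
               :+ (a :- d) :* (a :+ d) :* ((f₁ :- f₂) :* (g₁ :- g₂))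
               := (a :+ a) :* ((a :- d) :* (f₁ :* g₁) :+ (a :+ d) :* (f₂ :* g₂))) refl a d f₁ f₂ g₁
                 g₂) ⟩
    (a + a) * ((a - d) * (f₁ * g₁) + (a + d) * (f₂ * g₂)) ∎)
    where
    open ≤-Reasoning
    open ℚ-Solver using (solve; _:+_; _:-_; _:*_; :-_; con; _:=_)
    0<a+a : 0ℚ < a + a
    0<a+a = +-mono-< 0<a 0<a
    f₀ = f (x + d)
    f₁ = f (x - a)
    f₂ = f (x + a)
    g₀ = g (x + d)
    g₁ = g (x - a)
    g₂ = g (x + a)

  chord-square : 0ℚ ≤ a → ∀ τ → 0ℚ ≤ τ → Chord (λ x → τ * (x * x))
  chord-square 0≤a τ 0≤τ x d 0≤a-d 0≤a+d = ≤-by {(a + a) * (τ * ((x + d) * (x + d)))}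
    (τ * ((a + a) * ((a - d) * (a + d))))
    (0≤* {τ} {(a + a) * ((a - d) * (a + d))} 0≤τ (0≤* {a + a} {(a - d) * (a + d)}
      (0≤+ {a} {a} 0≤a 0≤a) (0≤* {a - d} {a + d} 0≤a-d 0≤a+d)))
    (solve 4 (λ a d τ x → (a :+ a) :* (τ :* ((x :+ d) :* (x :+ d))) :+ τ
      :* ((a :+ a) :* ((a :- d) :* (a :+ d)))
       := (a :- d) :* (τ :* ((x :- a) :* (x :- a))) :+ (a :+ d) :* (τ :* ((x :+ a) :* (x :+ a))))
         refl a d τ x)
    where open ℚ-Solver

  -- Each term is, up to a constant, the product of `τ * (x * x)` and the term before it. Both are
  -- nonnegative and increasing in `x * x`, hence comonotone.
  chord-evenTerm : 0ℚ < a → ∀ τ → 0ℚ ≤ τ → ∀ j → Chord (λ x → evenTerm (τ * (x * x)) j)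
  chord-evenTerm 0<a τ 0≤τ zero    = chord-const 1ℚ
  chord-evenTerm 0<a τ 0≤τ (suc j) = chord-* 0<a {λ x → s x * t x} {λ _ → i}
      (λ x → 0≤* {s x} {t x} (0≤s x) (0≤t x)) (λ _ → 0≤i)
      (λ x y → ≤-reflexive (solve 3 (λ u v i → con 0ℚ := (u :- v) :* (i :- i)) refl (s x * t x)
        (s y * t y) i))
      (chord-* 0<a {s} {t} 0≤s 0≤t comonotone (chord-square (<⇒≤ 0<a) τ 0≤τ)
        (chord-evenTerm 0<a τ 0≤τ j))
      (chord-const i)
    where
    open ℚ-Solver using (solve; _:+_; _:-_; _:*_; :-_; con; _:=_)
    i = inv (j ℕ.+ j) * inv (suc (j ℕ.+ j))
    0≤i = 0≤* {inv (j ℕ.+ j)} {inv (suc (j ℕ.+ j))} (0≤inv (j ℕ.+ j)) (0≤inv (suc (j ℕ.+ j)))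
    s t : ℚ → ℚ
    s x = τ * (x * x)
    t x = evenTerm (s x) j
    0≤s : ∀ x → 0ℚ ≤ s x
    0≤s x = 0≤* {τ} {x * x} 0≤τ (0≤x² x)
    0≤t : ∀ x → 0ℚ ≤ t x
    0≤t x = evenTerm-nonNeg (s x) (0≤s x) j
    comonotone : ∀ x y → 0ℚ ≤ (s x - s y) * (t x - t y)
    comonotone x y with ≤-total (s x) (s y)
    ... | inj₁ p = ≤-trans (0≤* {s y - s x} {t y - t x} (p≤q⇒0≤q-p p)
      (p≤q⇒0≤q-p (evenTerm-mono (s x) (s y) (0≤s x) p j)))
      (≤-reflexive (solve 4 (λ a b c d → (b :- a) :* (d :- c) := (a :- b) :* (c :- d)) refl (s x)
        (s y) (t x) (t y)))
    ... | inj₂ p = 0≤* {s x - s y} {t x - t y} (p≤q⇒0≤q-p p) (p≤q⇒0≤q-p (evenTerm-mono (s y) (s x)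
      (0≤s y) p j))

  chord-evenSum : 0ℚ < a → ∀ τ → 0ℚ ≤ τ → ∀ n → Chord (λ x → evenSum (τ * (x * x)) n)
  chord-evenSum 0<a τ 0≤τ n = chord-Σ≤ n {λ j x → evenTerm (τ * (x * x)) j}
    (chord-evenTerm 0<a τ 0≤τ)

-- Azuma's inequality

module _ {A : Set} where

  sumOf : (A → ℚ) → List A → ℚ
  sumOf f []       = 0ℚ
  sumOf f (x ∷ xs) = f x + sumOf f xs

  size : List A → ℚ
  size xs = fromℕ (length xs)

  sumOf-cong : ∀ {f g} xs → (∀ {x} → x ∈ xs → f x ≡ g x) → sumOf f xs ≡ sumOf g xs
  sumOf-cong []       f≡g = refl
  sumOf-cong (x ∷ xs) f≡g = cong₂ _+_ (f≡g (here refl)) (sumOf-cong xs (f≡g ∘ there))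

  sumOf-const : ∀ c xs → sumOf (λ _ → c) xs ≡ size xs * c
  sumOf-const c []       = sym (*-zeroˡ c)
  sumOf-const c (x ∷ xs) = trans (cong (_+_ c) (sumOf-const c xs))
    (trans (solve 2 (λ c n → c :+ n :* c := (n :+ con 1ℚ) :* c) refl c (size xs))
      (cong (_* c) (sym (fromℕ-suc (length xs)))))
    where open ℚ-Solver

  size≡sumOf : ∀ xs → size xs ≡ sumOf (λ _ → 1ℚ) xs
  size≡sumOf xs = trans (sym (*-identityʳ (size xs))) (sym (sumOf-const 1ℚ xs))

  sumOf-nonNeg : ∀ {f} xs → (∀ {x} → x ∈ xs → 0ℚ ≤ f x) → 0ℚ ≤ sumOf f xs
  sumOf-nonNeg         []       0≤f = ≤-refl
  sumOf-nonNeg {f = f} (x ∷ xs) 0≤f = 0≤+ {f x} {sumOf f xs} (0≤f (here refl)) (sumOf-nonNeg xs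
    (0≤f ∘ there))

  sumOf-filter : ∀ f {P : Pred A 0ℓ} (P? : Decidable P) xs →
    sumOf f (filter P? xs) + sumOf f (filter (∁? P?) xs) ≡ sumOf f xs
  sumOf-filter f P? []       = refl
  sumOf-filter f P? (x ∷ xs) with P? x
  ... | yes _ = trans (+-assoc (f x) (sumOf f (filter P? xs)) (sumOf f (filter (∁? P?) xs)))
    (cong (_+_ (f x)) (sumOf-filter f P? xs))
  ... | no  _ = trans (solve 3 (λ a b c → a :+ (b :+ c) := b :+ (a :+ c)) refl
    (sumOf f (filter P? xs)) (f x) (sumOf f (filter (∁? P?) xs)))
    (cong (_+_ (f x)) (sumOf-filter f P? xs))
    where open ℚ-Solver

  size-filter : ∀ {P : Pred A 0ℓ} (P? : Decidable P) xs → size (filter P? xs) + size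
    (filter (∁? P?) xs) ≡ size xs
  size-filter P? xs = trans (cong₂ _+_ (size≡sumOf (filter P? xs)) (size≡sumOf (filter (∁? P?) xs)))
    (trans (sumOf-filter (λ _ → 1ℚ) P? xs) (sym (size≡sumOf xs)))

  sumOf-+ : ∀ f g xs → sumOf (λ x → f x + g x) xs ≡ sumOf f xs + sumOf g xs
  sumOf-+ f g []       = refl
  sumOf-+ f g (x ∷ xs) = trans (cong (_+_ (f x + g x)) (sumOf-+ f g xs))
    (solve 4 (λ a b c d → (a :+ b) :+ (c :+ d) := (a :+ c) :+ (b :+ d)) refl (f x) (g x)
      (sumOf f xs) (sumOf g xs))
    where open ℚ-Solver

∣p∣≤q⇒0≤q±p : ∀ p q → ∣ p ∣ ≤ q → 0ℚ ≤ q - p × 0ℚ ≤ q + p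
∣p∣≤q⇒0≤q±p p q h = p≤q⇒0≤q-p (≤-trans (p≤∣p∣ p) h) ,
  ≤-trans (p≤q⇒0≤q-p (≤-trans (p≤∣p∣ (- p)) (≤-trans (≤-reflexive (∣-p∣≡∣p∣ p)) h)))
    (≤-reflexive (solve 2 (λ p q → q :- (:- p) := q :+ p) refl p q))
  where open ℚ-Solver

-- Hoeffding's martingale on a finite uniform probability space: the values of X are
-- found out by n successive yes-no questions, each moving the conditional mean by at
-- most a.
module Martingale {A : Set} (X : A → ℚ) (a : ℚ) (0<a : 0ℚ < a) where

  open Average a

  -- The inequality in `reveal` says that the means of `X` over `ys` and `zs` differ by at most `a`.
  -- It is cleared of denominators, so that it holds trivially when one of the parts is empty.
  data Revealed : ℕ → List A → Set₁ where
    done   : ∀ {xs} → (∀ {x y} → x ∈ xs → y ∈ xs → X x ≡ X y) → Revealed 0 xs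
    reveal : ∀ {n xs} {P : Pred A 0ℓ} (P? : Decidable P) →
      let ys = filter P? xs; zs = filter (∁? P?) xs in
      ∣ size zs * sumOf X ys - size ys * sumOf X zs ∣ ≤ a * (size ys * size zs) →
      Revealed n ys → Revealed n zs → Revealed (suc n) xs

  -- Let `n` and `m` be the sizes of the parts. The cross difference equals `n (n + m) (ν - μ)`, and
  -- its bound `a n m` is at most `a n (n + m)`.
  part-mean : ∀ ys zs μ → (size ys + size zs) * μ ≡ sumOf X ys + sumOf X zs →
    ∣ size zs * sumOf X ys - size ys * sumOf X zs ∣ ≤ a * (size ys * size zs) →
    ∃ λ ν → size ys * ν ≡ sumOf X ys × 0ℚ ≤ a - (ν - μ) × 0ℚ ≤ a + (ν - μ)
  -- An empty part has no mean of its own; any value near `μ` serves, and `μ` is the simplest.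
  part-mean [] zs μ _ _ = μ , *-zeroˡ μ ,
    ≤-trans (<⇒≤ 0<a) (≤-reflexive (solve 2 (λ a μ → a := a :- (μ :- μ)) refl a μ)) ,
    ≤-trans (<⇒≤ 0<a) (≤-reflexive (solve 2 (λ a μ → a := a :+ (μ :- μ)) refl a μ))
    where open ℚ-Solver
  part-mean ys@(_ ∷ ys′) zs μ mean close = ν , eq ,
      0≤-cancelˡ {n * (n + m)} {a - (ν - μ)} 0<nN (≤-trans (0≤+ {a * (n * m) - D} {a * (n * n)}
        (proj₁ bounds) 0≤ann)
        (≤-reflexive (trans (cong (λ w → a * (n * m) - w + a * (n * n)) D≡)
          (solve 5 (λ a n m ν μ → a :* (n :* m) :- (n :+ m) :* (n :* (ν :- μ)) :+ a :* (n :* n)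
            := n :* (n :+ m) :* (a :- (ν :- μ))) refl a n m ν μ)))) ,
      0≤-cancelˡ {n * (n + m)} {a + (ν - μ)} 0<nN (≤-trans (0≤+ {a * (n * m) + D} {a * (n * n)}
        (proj₂ bounds) 0≤ann)
        (≤-reflexive (trans (cong (λ w → a * (n * m) + w + a * (n * n)) D≡)
          (solve 5 (λ a n m ν μ → a :* (n :* m) :+ (n :+ m) :* (n :* (ν :- μ)) :+ a :* (n :* n)
            := n :* (n :+ m) :* (a :+ (ν :- μ))) refl a n m ν μ))))
    where
    open ℚ-Solver using (solve; _:+_; _:-_; _:*_; :-_; con; _:=_)
    n = size ys
    m = size zs
    ν = sumOf X ys * inv (length ys′)
    D = m * sumOf X ys - n * sumOf X zs
    eq : n * ν ≡ sumOf X ys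
    eq = trans (sym (*-assoc n (sumOf X ys) (inv (length ys′)))) (*-inv (sumOf X ys) (length ys′))
    0<n : 0ℚ < n
    0<n = 0<fromℕ-suc (length ys′)
    0≤m : 0ℚ ≤ m
    0≤m = 0≤fromℕ (length zs)
    0<nN : 0ℚ < n * (n + m)
    0<nN = 0<* {n} {n + m} 0<n (+-mono-<-≤ 0<n 0≤m)
    0≤ann : 0ℚ ≤ a * (n * n)
    0≤ann = 0≤* {a} {n * n} (<⇒≤ 0<a) (0≤x² n)
    bounds = ∣p∣≤q⇒0≤q±p D (a * (n * m)) close
    D≡ : D ≡ (n + m) * (n * (ν - μ))
    D≡ = begin
      m * sumOf X ys - n * sumOf X zs
        ≡⟨ solve 4 (λ m n s t → m :* s :- n :* t := (n :+ m) :* s :- n :* (s :+ t)) refl m n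
          (sumOf X ys) (sumOf X zs) ⟩
      (n + m) * sumOf X ys - n * (sumOf X ys + sumOf X zs)
        ≡⟨ cong₂ (λ s t → (n + m) * s - n * t) (sym eq) (sym mean) ⟩
      (n + m) * (n * ν) - n * ((n + m) * μ)
        ≡⟨ solve 4 (λ n m ν μ → (n :+ m) :* (n :* ν) :- n :* ((n :+ m) :* μ)
          := (n :+ m) :* (n :* (ν :- μ))) refl n m ν μ ⟩
      (n + m) * (n * (ν - μ)) ∎
      where open ≡-Reasoning

  -- Jensen's inequality for two values: `g` is replaced by its chord over the interval from `μ - a`
  -- to `μ + a`, and the linear terms cancel because `μ` is the weighted mean.
  chord-bound : ∀ {g} → Chord g → ∀ n m μ ν₁ ν₂ → 0ℚ ≤ n → 0ℚ ≤ m → n * ν₁ + m * ν₂ ≡ (n + m) * μ →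
    0ℚ ≤ a - (ν₁ - μ) × 0ℚ ≤ a + (ν₁ - μ) → 0ℚ ≤ a - (ν₂ - μ) × 0ℚ ≤ a + (ν₂ - μ) →
    n * g ν₁ + m * g ν₂ ≤ (n + m) * average g μ
  chord-bound {g} chord n m μ ν₁ ν₂ 0≤n 0≤m mean (l₁ , u₁) (l₂ , u₂) = *-cancelˡ-≤-pos
    (a + a) {{ℚ.positive (+-mono-< 0<a 0<a)}} (begin
    (a + a) * (n * g ν₁ + m * g ν₂)
      ≡⟨ cong₂ (λ p q → (a + a) * (n * g p + m * g q)) (split μ ν₁) (split μ ν₂) ⟩
    (a + a) * (n * g (μ + d₁) + m * g (μ + d₂))
      ≡⟨ solve 5 (λ s n m p q → s :* (n :* p :+ m :* q) := n :* (s :* p) :+ m :* (s :* q)) refl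
        (a + a) n m (g (μ + d₁)) (g (μ + d₂)) ⟩
    n * ((a + a) * g (μ + d₁)) + m * ((a + a) * g (μ + d₂))
      ≤⟨ +-mono-≤ (*-monoˡ {n} {(a + a) * g (μ + d₁)} {(a - d₁) * p + (a + d₁) * q} 0≤n
        (chord μ d₁ l₁ u₁))
                  (*-monoˡ {m} {(a + a) * g (μ + d₂)} {(a - d₂) * p + (a + d₂) * q} 0≤m
                    (chord μ d₂ l₂ u₂)) ⟩
    n * ((a - d₁) * p + (a + d₁) * q) + m * ((a - d₂) * p + (a + d₂) * q)
      ≡⟨ solve 8 (λ a n m μ ν₁ ν₂ p q → n :* ((a :- (ν₁ :- μ)) :* p :+ (a :+ (ν₁ :- μ)) :* q) :+ m
        :* ((a :- (ν₂ :- μ)) :* p :+ (a :+ (ν₂ :- μ)) :* q)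
           := (a :+ a) :* ((n :+ m) :* (con ½ :* (p :+ q))) :+ ((n :* ν₁ :+ m :* ν₂) :- (n :+ m)
             :* μ) :* (q :- p)) refl a n m μ ν₁ ν₂ p q ⟩
    (a + a) * ((n + m) * average g μ) + ((n * ν₁ + m * ν₂) - (n + m) * μ) * (q - p)
      ≡⟨ cong (λ w → (a + a) * ((n + m) * average g μ) + (w - (n + m) * μ) * (q - p)) mean ⟩
    (a + a) * ((n + m) * average g μ) + ((n + m) * μ - (n + m) * μ) * (q - p)
      ≡⟨ solve 3 (λ t u v → t :+ (u :- u) :* v := t) refl ((a + a) * ((n + m) * average g μ))
        ((n + m) * μ) (q - p) ⟩
    (a + a) * ((n + m) * average g μ) ∎)
    where
    open ≤-Reasoning
    open ℚ-Solver using (solve; _:+_; _:-_; _:*_; :-_; con; _:=_)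
    d₁ = ν₁ - μ
    d₂ = ν₂ - μ
    p = g (μ - a)
    q = g (μ + a)
    split : ∀ μ ν → ν ≡ μ + (ν - μ)
    split = solve 2 (λ μ ν → ν := μ :+ (ν :- μ)) refl

  -- Each question costs one averaging. By induction `g` is replaced on both parts by
  -- `averages n g`, which is again convex, so `chord-bound` applies to that function at the means
  -- of the parts.
  revealed-bound : ∀ {n xs g} → Revealed n xs → Chord g → ∀ μ → size xs * μ ≡ sumOf X xs →
    sumOf (g ∘ X) xs ≤ size xs * averages n g μ
  revealed-bound {xs = []}     {g} (done _) chord μ _ = ≤-reflexive (sym (*-zeroˡ (g μ)))
  revealed-bound {xs = x ∷ xs} {g} (done constant) chord μ mean = ≤-reflexive
    (trans (sumOf-cong {f = g ∘ X} (x ∷ xs) (λ y∈ → cong g (constant y∈ (here refl))))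
      (trans (sumOf-const (g (X x)) (x ∷ xs)) (cong (λ y → size (x ∷ xs) * g y) X≡μ)))
    where
    X≡μ : X x ≡ μ
    X≡μ = trans (sym (*-inv (X x) (length xs)))
      (trans (cong (_* inv (length xs)) (trans (sym (trans (sumOf-cong {f = X} (x ∷ xs) (λ y∈
        → constant y∈ (here refl))) (sumOf-const (X x) (x ∷ xs)))) (sym mean)))
        (*-inv μ (length xs)))
  revealed-bound {suc n} {xs} {g} (reveal P? close ry rz) chord μ mean = begin
    sumOf (g ∘ X) xs                                      ≡⟨ sumOf-filter (g ∘ X) P? xs ⟨
    sumOf (g ∘ X) ys + sumOf (g ∘ X) zs                   ≤⟨ +-mono-≤
      (revealed-bound {g = g} ry chord (proj₁ meanʸ) (proj₁ (proj₂ meanʸ)))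
                                                                      (revealed-bound {g = g} rz
                                                                        chord (proj₁ meanᶻ) (proj₁
                                                                        (proj₂ meanᶻ))) ⟩
    size ys * averages n g (proj₁ meanʸ) + size zs * averages n g (proj₁ meanᶻ)
      ≤⟨ chord-bound {averages n g} (chord-averages n {g} chord) (size ys) (size zs) μ (proj₁ meanʸ)
        (proj₁ meanᶻ)
           (0≤fromℕ (length ys)) (0≤fromℕ (length zs)) (trans (cong₂ _+_ (proj₁ (proj₂ meanʸ))
             (proj₁ (proj₂ meanᶻ))) (sym total))
           (proj₂ (proj₂ meanʸ)) (proj₂ (proj₂ meanᶻ)) ⟩
    (size ys + size zs) * averages (suc n) g μ            ≡⟨ cong (_* averages (suc n) g μ)
      (size-filter P? xs) ⟩
    size xs * averages (suc n) g μ                        ∎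
    where
    open ≤-Reasoning
    ys = filter P? xs
    zs = filter (∁? P?) xs
    total : (size ys + size zs) * μ ≡ sumOf X ys + sumOf X zs
    total = trans (cong (_* μ) (size-filter P? xs)) (trans mean (sym (sumOf-filter X P? xs)))
    meanʸ = part-mean ys zs μ total close
    meanᶻ = part-mean zs ys μ
      (trans (cong (_* μ) (+-comm (size zs) (size ys))) (trans total (+-comm (sumOf X ys)
        (sumOf X zs))))
      (≤-trans (≤-reflexive (∣-∣-comm (size ys * sumOf X zs) (size zs * sumOf X ys)))
        (≤-trans close (≤-reflexive (cong (a *_) (*-comm (size ys) (size zs))))))

-- The four functions theorem

-- The case of a single bit. For the mixed products, `u` and `v` are at most `p` and
-- `u * v ≤ p * q`; then `(p - u) * (p - v) ≥ 0` gives `p * (u + v) ≤ p * p + u * v ≤ p * (p + q)`.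
four-numbers : ∀ {α₀ α₁ β₀ β₁ γ₀ γ₁ δ₀ δ₁} →
  0ℚ ≤ α₀ → 0ℚ ≤ α₁ → 0ℚ ≤ β₀ → 0ℚ ≤ β₁ → 0ℚ ≤ γ₀ → 0ℚ ≤ γ₁ → 0ℚ ≤ δ₀ → 0ℚ ≤ δ₁ →
  α₀ * β₀ ≤ γ₀ * δ₀ → α₀ * β₁ ≤ γ₀ * δ₁ → α₁ * β₀ ≤ γ₀ * δ₁ → α₁ * β₁ ≤ γ₁ * δ₁ →
  (α₀ + α₁) * (β₀ + β₁) ≤ (γ₀ + γ₁) * (δ₀ + δ₁)
four-numbers {α₀} {α₁} {β₀} {β₁} {γ₀} {γ₁} {δ₀} {δ₁} 0≤α₀ 0≤α₁ 0≤β₀ 0≤β₁ 0≤γ₀ 0≤γ₁ 0≤δ₀ 0≤δ₁ h₀₀ h₀₁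
  h₁₀ h₁₁ = begin
  (α₀ + α₁) * (β₀ + β₁)             ≡⟨ solve 4 (λ a b c d → (a :+ b) :* (c :+ d)
    := (a :* c :+ b :* d) :+ (a :* d :+ b :* c)) refl α₀ α₁ β₀ β₁ ⟩
  (α₀ * β₀ + α₁ * β₁) + (u + v)     ≤⟨ +-mono-≤ (+-mono-≤ h₀₀ h₁₁) u+v≤p+q ⟩
  (γ₀ * δ₀ + γ₁ * δ₁) + (p + q)     ≡⟨ solve 4 (λ a b c d → (a :* c :+ b :* d) :+ (a :* d :+ b :* c)
    := (a :+ b) :* (c :+ d)) refl γ₀ γ₁ δ₀ δ₁ ⟩
  (γ₀ + γ₁) * (δ₀ + δ₁)             ∎
  where
  open ≤-Reasoning
  open ℚ-Solver using (solve; _:+_; _:-_; _:*_; :-_; con; _:=_)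
  p = γ₀ * δ₁
  q = γ₁ * δ₀
  u = α₀ * β₁
  v = α₁ * β₀
  0≤p = 0≤* {γ₀} {δ₁} 0≤γ₀ 0≤δ₁
  0≤q = 0≤* {γ₁} {δ₀} 0≤γ₁ 0≤δ₀
  uv≤pq : u * v ≤ p * q
  uv≤pq = ≤-trans (≤-reflexive (solve 4 (λ a b c d → (a :* d) :* (b :* c) := (a :* c) :* (b :* d))
    refl α₀ α₁ β₀ β₁))
    (≤-trans (*-mono {α₀ * β₀} {γ₀ * δ₀} {α₁ * β₁} {γ₁ * δ₁} (0≤* {α₁} {β₁} 0≤α₁ 0≤β₁)
      (0≤* {γ₀} {δ₀} 0≤γ₀ 0≤δ₀) h₀₀ h₁₁)
      (≤-reflexive (solve 4 (λ a b c d → (a :* c) :* (b :* d) := (a :* d) :* (b :* c)) refl γ₀ γ₁ δ₀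
        δ₁)))
  u+v≤p+q : u + v ≤ p + q
  u+v≤p+q with p ≤? 0ℚ
  ... | yes p≤0 = ≤-trans (+-mono-≤ (≤-trans h₀₁ p≤0) (≤-trans h₁₀ p≤0)) (0≤+ {p} {q} 0≤p 0≤q)
  ... | no  p≰0 = *-cancelˡ-≤-pos p {{ℚ.positive (≰⇒> p≰0)}} (≤-by {p * (u + v)}
    ((p - u) * (p - v) + (p * q - u * v))
    (0≤+ {(p - u) * (p - v)} {p * q - u * v} (0≤* {p - u} {p - v} (p≤q⇒0≤q-p h₀₁) (p≤q⇒0≤q-p h₁₀))
      (p≤q⇒0≤q-p uv≤pq))
    (solve 4 (λ p q u v → p :* (u :+ v) :+ ((p :- u) :* (p :- v) :+ (p :* q :- u :* v))
      := p :* (p :+ q)) refl p q u v))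

allPairs-map-∈ : ∀ {A : Set} {R S : A → A → Set} {xs} → (∀ {x y} → x ∈ xs → y ∈ xs → R x y → S x y)
  → AllPairs R xs → AllPairs S xs
allPairs-map-∈ f []       = []
allPairs-map-∈ f (r ∷ rs) = All.tabulate (λ y∈ → f (here refl) (there y∈) (All.lookup r y∈))
  ∷ allPairs-map-∈ (λ x∈ y∈ → f (there x∈) (there y∈)) rs

-- The Ahlswede–Daykin four functions theorem for lists of elements coded by bits, by
-- induction on the number of bits.
module FourFunctions {A C : Set} (bit : A → C → Bool) where

  Agree : List C → A → A → Set
  Agree cs x y = ∀ {c} → c ∈ cs → bit x c ≡ bit y c

  Distinct : List C → List A → Set
  Distinct cs = AllPairs (λ x y → ¬ Agree cs x y)

  Meet Join : List C → A → A → A → Set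
  Meet cs x y z = ∀ {c} → c ∈ cs → bit z c ≡ bit x c ∧ bit y c
  Join cs x y z = ∀ {c} → c ∈ cs → bit z c ≡ bit x c ∨ bit y c

  sumOf-≥ : ∀ {f : A → ℚ} {xs x} → (∀ {x} → x ∈ xs → 0ℚ ≤ f x) → x ∈ xs → f x ≤ sumOf f xs
  sumOf-≥ {f} {y ∷ xs} 0≤f (here refl) = ≤-grow {f y} {sumOf f xs} (sumOf-nonNeg xs (0≤f ∘ there))
  sumOf-≥ {f} {y ∷ xs} {x} 0≤f (there x∈) = ≤-trans (sumOf-≥ (0≤f ∘ there) x∈)
    (≤-trans (≤-grow {sumOf f xs} {f y} (0≤f (here refl))) (≤-reflexive (+-comm (sumOf f xs)
      (f y))))

  _is_ : ∀ c b → Decidable (λ x → bit x c ≡ b)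
  (c is b) x = bit x c 𝔹.≟ b

  sumOf-bit : ∀ f c xs → sumOf f (filter (c is false) xs) + sumOf f (filter (c is true) xs)
    ≡ sumOf f xs
  sumOf-bit f c []       = refl
  sumOf-bit f c (x ∷ xs) with bit x c
  ... | false = trans (+-assoc (f x) (sumOf f (filter (c is false) xs))
    (sumOf f (filter (c is true) xs))) (cong (_+_ (f x)) (sumOf-bit f c xs))
  ... | true  = trans (solve 3 (λ a b c → a :+ (b :+ c) := b :+ (a :+ c)) refl
    (sumOf f (filter (c is false) xs)) (f x) (sumOf f (filter (c is true) xs)))
    (cong (_+_ (f x)) (sumOf-bit f c xs))
    where open ℚ-Solver

  distinct-filter : ∀ {c cs} b {xs} → Distinct (c ∷ cs) xs → Distinct cs (filter (c is b) xs)
  distinct-filter {c} b {xs} d = allPairs-map-∈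
    (λ x∈ y∈ differ agree → differ λ { (here refl) → trans (bit≡b x∈) (sym (bit≡b y∈)) ; (there c∈)
      → agree c∈ })
    (AllPairs.filter⁺ (c is b) d)
    where
    bit≡b : ∀ {x} → x ∈ filter (c is b) xs → bit x c ≡ b
    bit≡b x∈ = proj₂ (∈-filter⁻ (c is b) {xs = xs} x∈)

  -- Meets and joins are only required to exist in `zs` and `ws`, so the lists may be parts of a
  -- sublattice of the cube. Fixing the first bit to `a` in `xs` and to `b` in `ys` leads to `a ∧ b`
  -- in `zs` and `a ∨ b` in `ws`; `four-numbers` combines the four cases.
  four-functions : ∀ cs {xs ys zs ws} {α β γ δ : A → ℚ} →
    (∀ {x} → x ∈ xs → 0ℚ ≤ α x) → (∀ {x} → x ∈ ys → 0ℚ ≤ β x) →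
    (∀ {x} → x ∈ zs → 0ℚ ≤ γ x) → (∀ {x} → x ∈ ws → 0ℚ ≤ δ x) →
    Distinct cs xs → Distinct cs ys →
    (∀ {x y} → x ∈ xs → y ∈ ys → ∃ λ z → ∃ λ w → z ∈ zs × w ∈ ws × Meet cs x y z × Join cs x y w
      × α x * β y ≤ γ z * δ w) →
    sumOf α xs * sumOf β ys ≤ sumOf γ zs * sumOf δ ws
  four-functions [] {[]} {ys} {zs} {ws} {γ = γ} {δ} 0≤α 0≤β 0≤γ 0≤δ dx dy h = ≤-trans
    (≤-reflexive (*-zeroˡ (sumOf _ ys)))
    (0≤* {sumOf γ zs} {sumOf δ ws} (sumOf-nonNeg zs 0≤γ) (sumOf-nonNeg ws 0≤δ))
  four-functions [] {x ∷ xs} {[]} {zs} {ws} {α} {γ = γ} {δ} 0≤α 0≤β 0≤γ 0≤δ dx dy h = ≤-trans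
    (≤-reflexive (*-zeroʳ (sumOf α (x ∷ xs))))
    (0≤* {sumOf γ zs} {sumOf δ ws} (sumOf-nonNeg zs 0≤γ) (sumOf-nonNeg ws 0≤δ))
  four-functions [] {x ∷ []} {y ∷ []} {zs} {ws} {α} {β} {γ} {δ} 0≤α 0≤β 0≤γ 0≤δ dx dy h with h
    (here refl) (here refl)
  ... | z , w , z∈ , w∈ , _ , _ , le = ≤-trans (≤-reflexive (cong₂ _*_ (+-identityʳ (α x))
    (+-identityʳ (β y)))) (≤-trans le
    (*-mono {γ z} {sumOf γ zs} {δ w} {sumOf δ ws} (0≤δ w∈) (sumOf-nonNeg zs 0≤γ) (sumOf-≥ 0≤γ z∈)
      (sumOf-≥ 0≤δ w∈)))
  -- With no bits left any two entries agree vacuously, so `Distinct` excludes lists of two or more.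
  four-functions [] {x ∷ x′ ∷ xs} 0≤α 0≤β 0≤γ 0≤δ ((d All.∷ _) ∷ _) dy h = contradiction (λ ()) d
  four-functions [] {x ∷ []} {y ∷ y′ ∷ ys} 0≤α 0≤β 0≤γ 0≤δ dx ((d All.∷ _) ∷ _) h = contradiction
    (λ ()) d
  four-functions (c ∷ cs) {xs} {ys} {zs} {ws} {α} {β} {γ} {δ} 0≤α 0≤β 0≤γ 0≤δ dx dy h =
    subst₂ _≤_ (cong₂ _*_ (sumOf-bit α c xs) (sumOf-bit β c ys)) (cong₂ _*_ (sumOf-bit γ c zs)
      (sumOf-bit δ c ws))
      (four-numbers {sumOf α (xs ↾ false)} {sumOf α (xs ↾ true)} {sumOf β (ys ↾ false)} {sumOf β
        (ys ↾ true)}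
                    {sumOf γ (zs ↾ false)} {sumOf γ (zs ↾ true)} {sumOf δ (ws ↾ false)} {sumOf δ
                      (ws ↾ true)}
        (nonNeg 0≤α false) (nonNeg 0≤α true) (nonNeg 0≤β false) (nonNeg 0≤β true)
        (nonNeg 0≤γ false) (nonNeg 0≤γ true) (nonNeg 0≤δ false) (nonNeg 0≤δ true)
        (part false false) (part false true) (part true false) (part true true))
    where
    infix 9 _↾_
    _↾_ : List A → Bool → List A
    xs ↾ b = filter (c is b) xs
    restrict : ∀ {f : A → ℚ} {xs} b → (∀ {x} → x ∈ xs → 0ℚ ≤ f x) → ∀ {x} → x ∈ xs ↾ b → 0ℚ ≤ f x
    restrict {xs = xs} b 0≤f x∈ = 0≤f (proj₁ (∈-filter⁻ (c is b) {xs = xs} x∈))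
    nonNeg : ∀ {f : A → ℚ} {xs} → (∀ {x} → x ∈ xs → 0ℚ ≤ f x) → ∀ b → 0ℚ ≤ sumOf f (xs ↾ b)
    nonNeg {f} {xs} 0≤f b = sumOf-nonNeg (xs ↾ b) (restrict {f} {xs} b 0≤f)
    part : ∀ a b → sumOf α (xs ↾ a) * sumOf β (ys ↾ b) ≤ sumOf γ (zs ↾ (a ∧ b)) * sumOf δ
      (ws ↾ (a ∨ b))
    part a b = four-functions cs {xs ↾ a} {ys ↾ b} {zs ↾ (a ∧ b)} {ws ↾ (a ∨ b)} {α} {β} {γ} {δ}
      (restrict a 0≤α) (restrict b 0≤β) (restrict (a ∧ b) 0≤γ) (restrict (a ∨ b) 0≤δ)
      (distinct-filter a dx) (distinct-filter b dy)
      λ {x} {y} x∈ y∈ →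
        let x∈xs , xc = ∈-filter⁻ (c is a) {xs = xs} x∈
            y∈ys , yc = ∈-filter⁻ (c is b) {xs = ys} y∈
            z , w , z∈ , w∈ , meet , join , le = h x∈xs y∈ys
        in z , w , ∈-filter⁺ (c is (a ∧ b)) z∈ (trans (meet (here refl)) (cong₂ _∧_ xc yc))
             , ∈-filter⁺ (c is (a ∨ b)) w∈ (trans (join (here refl)) (cong₂ _∨_ xc yc))
             , meet ∘ there , join ∘ there , le

-- Integers as rationals and as families of threshold bits

fromℤ : ℤ → ℚ
fromℤ z = z ℚ./ 1

toℚᵘ-/ : ∀ i n → ℚ.toℚᵘ (i ℚ./ suc n) ℚᵘ.≃ ℚᵘ.mkℚᵘ i n
toℚᵘ-/ i n = toℚᵘ-fromℚᵘ (ℚᵘ.mkℚᵘ i n)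

fromℤ-+ : ∀ i j → fromℤ (i ℤ.+ j) ≡ fromℤ i + fromℤ j
fromℤ-+ i j = toℚᵘ-injective (ℚᵘ.≃-trans (toℚᵘ-/ (i ℤ.+ j) 0)
  (ℚᵘ.≃-sym (ℚᵘ.≃-trans (toℚᵘ-homo-+ (fromℤ i) (fromℤ j))
  (ℚᵘ.≃-trans (ℚᵘ.+-cong (toℚᵘ-/ i 0) (toℚᵘ-/ j 0))
    (ℚᵘ.*≡* (cong (ℤ._* + 1) (cong₂ ℤ._+_ (ℤ.*-identityʳ i) (ℤ.*-identityʳ j))))))))

fromℤ-mono : ∀ {i j} → i ℤ.≤ j → fromℤ i ≤ fromℤ j
fromℤ-mono {i} {j} i≤j = toℚᵘ-cancel-≤ (ℚᵘ.≤-respˡ-≃ (ℚᵘ.≃-sym (toℚᵘ-/ i 0))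
  (ℚᵘ.≤-respʳ-≃ (ℚᵘ.≃-sym (toℚᵘ-/ j 0))
  (ℚᵘ.*≤* (ℤ.*-monoʳ-≤-nonNeg (+ 1) i≤j))))

fromℕ-*-/ : ∀ i n .{{_ : ℕ.NonZero n}} → fromℕ n * (i ℚ./ n) ≡ fromℤ i
fromℕ-*-/ i (suc n) = toℚᵘ-injective (ℚᵘ.≃-trans (toℚᵘ-homo-* (fromℕ (suc n)) (i ℚ./ suc n))
  (ℚᵘ.≃-trans (ℚᵘ.*-cong (ℚᵘ.≃-refl {ℚ.toℚᵘ (fromℕ (suc n))}) (toℚᵘ-/ i n))
    (ℚᵘ.≃-trans (ℚᵘ.*≡* lemma) (ℚᵘ.≃-sym (toℚᵘ-/ i 0)))))
  where
  lemma : (+ suc n ℤ.* i) ℤ.* + 1 ≡ i ℤ.* + suc (n ℕ.+ 0)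
  lemma = trans (ℤ.*-identityʳ (+ suc n ℤ.* i)) (trans (ℤ.*-comm (+ suc n) i)
    (cong (λ k → i ℤ.* + suc k) (sym (ℕ.+-identityʳ n))))

<?-≤ : ∀ k {i j} → i ℤ.≤ j → does (k ℤ.<? i) ∧ does (k ℤ.<? j) ≡ does (k ℤ.<? i)
  × does (k ℤ.<? i) ∨ does (k ℤ.<? j) ≡ does (k ℤ.<? j)
<?-≤ k {i} {j} i≤j with k ℤ.<? i | k ℤ.<? j
... | no  _   | _       = refl , refl
... | yes _   | yes _   = refl , refl
... | yes k<i | no  k≮j = contradiction (ℤ.<-≤-trans k<i i≤j) k≮j

<?-⊓ : ∀ k i j → does (k ℤ.<? i ℤ.⊓ j) ≡ does (k ℤ.<? i) ∧ does (k ℤ.<? j)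
<?-⊓ k i j with ℤ.≤-total i j
... | inj₁ i≤j = trans (cong (λ m → does (k ℤ.<? m)) (ℤ.i≤j⇒i⊓j≡i i≤j)) (sym (proj₁ (<?-≤ k i≤j)))
... | inj₂ j≤i = trans (cong (λ m → does (k ℤ.<? m)) (ℤ.i≥j⇒i⊓j≡j j≤i))
  (trans (sym (proj₁ (<?-≤ k j≤i))) (𝔹.∧-comm (does (k ℤ.<? j)) _))

<?-⊔ : ∀ k i j → does (k ℤ.<? i ℤ.⊔ j) ≡ does (k ℤ.<? i) ∨ does (k ℤ.<? j)
<?-⊔ k i j with ℤ.≤-total i j
... | inj₁ i≤j = trans (cong (λ m → does (k ℤ.<? m)) (ℤ.i≤j⇒i⊔j≡j i≤j)) (sym (proj₂ (<?-≤ k i≤j)))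
... | inj₂ j≤i = trans (cong (λ m → does (k ℤ.<? m)) (ℤ.i≥j⇒i⊔j≡i j≤i))
  (trans (sym (proj₂ (<?-≤ k j≤i))) (𝔹.∨-comm (does (k ℤ.<? j)) _))

lower-bound : ∀ {A : Set} (f : A → ℚ) xs → ∃ λ l → ∀ {x} → x ∈ xs → l ≤ f x
lower-bound f []       = 0ℚ , λ ()
lower-bound f (x ∷ xs) with lower-bound f xs
... | l , l≤ = f x ⊓ l , λ { (here refl) → p⊓q≤p (f x) l ; (there x∈) → ≤-trans (p⊓q≤q (f x) l)
  (l≤ x∈) }

module _ {V : Set} (vs : List V) where

  private
    Distinguished : List (V → ℤ) → Set
    Distinguished = AllPairs (λ f g → ¬ (∀ {v} → v ∈ vs → f v ≡ g v))

    -- A unary code by thresholds: it turns pointwise minima into conjunctions and pointwise maxima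
    -- into disjunctions.
    bit : (V → ℤ) → V × ℤ → Bool
    bit f (v , k) = does (k ℤ.<? f v)

    open FourFunctions bit

    -- The smaller of two different values is itself a threshold that separates them. So the
    -- finitely many attained values suffice as thresholds.
    agree⇒≡ : ∀ {ks f g v} → f v ∈ ks → g v ∈ ks → v ∈ vs → Agree (cartesianProduct vs ks) f g → f v
      ≡ g v
    agree⇒≡ {ks} {f} {g} {v} f∈ g∈ v∈ agree with ℤ.<-cmp (f v) (g v)
    ... | tri≈ _ f≡g _ = f≡g
    ... | tri< f<g _ _ = contradiction
      (trans (sym (dec-false (f v ℤ.<? f v) (ℤ.<-irrefl refl)))
        (trans (agree (∈-cartesianProduct⁺ v∈ f∈)) (dec-true (f v ℤ.<? g v) f<g))) λ ()
    ... | tri> _ _ g<f = contradiction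
      (trans (sym (dec-true (g v ℤ.<? f v) g<f)) (trans (agree (∈-cartesianProduct⁺ v∈ g∈))
        (dec-false (g v ℤ.<? g v) (ℤ.<-irrefl refl)))) λ ()

    distinct : ∀ {ks} xs → (∀ {f v} → f ∈ xs → v ∈ vs → f v ∈ ks) → Distinguished xs
      → Distinct (cartesianProduct vs ks) xs
    distinct xs ∈ks = allPairs-map-∈ λ f∈ g∈ differ agree → differ λ v∈ → agree⇒≡ (∈ks f∈ v∈)
      (∈ks g∈ v∈) v∈ agree

    values : List (V → ℤ) → List ℤ
    values = concatMap (λ f → map f vs)

    ∈-values : ∀ {xs f v} → f ∈ xs → v ∈ vs → f v ∈ values xs
    ∈-values {_ ∷ xs} {f} (here refl) v∈ = ∈-++⁺ˡ (∈-map⁺ f v∈)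
    ∈-values {x ∷ xs}     (there f∈)  v∈ = ∈-++⁺ʳ (map x vs) (∈-values f∈ v∈)

  -- Holley's inequality for uniform distributions.
  lattice-monotone : ∀ xs ys {w} → w ∈ vs → Distinguished xs → Distinguished ys →
    (∀ {f g} → f ∈ xs → g ∈ ys →
      (∃ λ h → h ∈ xs × ∀ {v} → v ∈ vs → h v ≡ f v ℤ.⊓ g v) × (∃ λ h → h ∈ ys × ∀ {v} → v ∈ vs → h v
        ≡ f v ℤ.⊔ g v)) →
    sumOf (λ f → fromℤ (f w)) xs * size ys ≤ size xs * sumOf (λ f → fromℤ (f w)) ys
  lattice-monotone xs ys {w} w∈ dx dy closed = ≤-by {s * m} (n * (t + m * (- l)) - (s + n * (- l))
    * m) (p≤q⇒0≤q-p shifted)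
      (solve 5 (λ s m n t l → s :* m :+ (n :* (t :+ m :* (:- l)) :- (s :+ n :* (:- l)) :* m)
        := n :* t) refl s m n t l)
    where
    open ℚ-Solver
    X : (V → ℤ) → ℚ
    X f = fromℤ (f w)
    s = sumOf X xs
    t = sumOf X ys
    n = size xs
    m = size ys
    -- The four functions have to be nonnegative. Subtracting a common lower bound changes both
    -- sides of the claim by the same amount.
    l = proj₁ (lower-bound X (xs ++ ys))
    l≤ = proj₂ (lower-bound X (xs ++ ys))
    ks = values (xs ++ ys)
    sum-shift : ∀ zs → sumOf (λ f → X f - l) zs ≡ sumOf X zs + size zs * (- l)
    sum-shift zs = trans (sumOf-+ X (λ _ → - l) zs) (cong (_+_ (sumOf X zs)) (sumOf-const (- l) zs))
    shifted : (s + n * (- l)) * m ≤ n * (t + m * (- l))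
    shifted = subst₂ _≤_ (cong₂ _*_ (sum-shift xs) (sym (size≡sumOf ys)))
      (cong₂ _*_ (sym (size≡sumOf xs)) (sum-shift ys))
      -- With `X - l` as first and last function and 1 as the other two, the hypothesis on the
      -- functions becomes `X f ≤ X h′` for the join `h′`.
      (four-functions (cartesianProduct vs ks) {xs} {ys} {xs} {ys} {λ f → X f - l} {λ _ → 1ℚ} {λ _
        → 1ℚ} {λ f → X f - l}
        (λ f∈ → p≤q⇒0≤q-p (l≤ (∈-++⁺ˡ f∈))) (λ _ → 0≤1) (λ _ → 0≤1) (λ f∈
          → p≤q⇒0≤q-p (l≤ (∈-++⁺ʳ xs f∈)))
        (distinct xs (∈-values ∘ ∈-++⁺ˡ) dx) (distinct ys (∈-values ∘ ∈-++⁺ʳ xs) dy)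
        λ {f} {g} f∈ g∈ →
          let (h , h∈ , h≡) , (h′ , h′∈ , h′≡) = closed f∈ g∈
          in h , h′ , h∈ , h′∈
             , (λ { {v , k} c∈ → trans (cong (λ z → does (k ℤ.<? z))
               (h≡ (proj₁ (∈-cartesianProduct⁻ vs ks c∈)))) (<?-⊓ k (f v) (g v)) })
             , (λ { {v , k} c∈ → trans (cong (λ z → does (k ℤ.<? z))
               (h′≡ (proj₁ (∈-cartesianProduct⁻ vs ks c∈)))) (<?-⊔ k (f v) (g v)) })
             , ≤-trans (≤-reflexive (*-identityʳ (X f - l))) (≤-trans
                 (+-monoˡ-≤ (- l) (fromℤ-mono (ℤ.≤-trans (ℤ.i≤i⊔j (f w) (g w))
                   (ℤ.≤-reflexive (sym (h′≡ w∈))))))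
                 (≤-reflexive (sym (*-identityˡ (X h′ - l))))))

-- Squares, edges and dominos

opposite : Dir → Dir
opposite E = W
opposite N = S
opposite W = E
opposite S = N

step-opposite : ∀ d u → step (opposite d) (step d u) ≡ u
step-opposite E (x , y) = cong (_, y) (ℤ.pred-suc x)
step-opposite N (x , y) = cong (x ,_) (ℤ.pred-suc y)
step-opposite W (x , y) = cong (_, y) (ℤ.suc-pred x)
step-opposite S (x , y) = cong (x ,_) (ℤ.suc-pred y)

leftOf-opposite : ∀ d u → leftOf (opposite d) (step d u) ≡ rightOf d u
leftOf-opposite E (x , y) = cong (_, ℤ.pred y) (ℤ.pred-suc x)
leftOf-opposite N (x , y) = cong (x ,_) (ℤ.pred-suc y)
leftOf-opposite W (x , y) = refl
leftOf-opposite S (x , y) = refl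

rightOf-opposite : ∀ d u → rightOf (opposite d) (step d u) ≡ leftOf d u
rightOf-opposite E (x , y) = cong (_, y) (ℤ.pred-suc x)
rightOf-opposite N (x , y) = cong (ℤ.pred x ,_) (ℤ.pred-suc y)
rightOf-opposite W (x , y) = refl
rightOf-opposite S (x , y) = refl

-- The sides of a square are directed counterclockwise.
corner : Dir → Square → Vertex
corner E s = s
corner N s = step E s
corner W s = step N (step E s)
corner S s = step N s

-- The direction is that of the side in its counterclockwise orientation, not the one in which the
-- neighbour lies: `E` is the bottom side, so the domino extends to the south.
across : Dir → Square → Domino
across E s = step S s , vertical
across N s = s , horizontal
across W s = s , vertical
across S s = step W s , horizontal

leftOf-corner : ∀ d s → leftOf d (corner d s) ≡ s
leftOf-corner E (x , y) = refl
leftOf-corner N (x , y) = cong (_, y) (ℤ.pred-suc x)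
leftOf-corner W (x , y) = cong₂ _,_ (ℤ.pred-suc x) (ℤ.pred-suc y)
leftOf-corner S (x , y) = cong (x ,_) (ℤ.pred-suc y)

corner-leftOf : ∀ d u → corner d (leftOf d u) ≡ u
corner-leftOf E (x , y) = refl
corner-leftOf N (x , y) = cong (_, y) (ℤ.suc-pred x)
corner-leftOf W (x , y) = cong₂ _,_ (ℤ.suc-pred x) (ℤ.suc-pred y)
corner-leftOf S (x , y) = cong (x ,_) (ℤ.suc-pred y)

step-corner : ∀ d s → step d (corner d s) ≡ corner (turnLeft d) s
step-corner E (x , y) = refl
step-corner N (x , y) = refl
step-corner W (x , y) = cong (_, ℤ.suc y) (ℤ.pred-suc x)
step-corner S (x , y) = cong (x ,_) (ℤ.pred-suc y)

cells-across⁺ : ∀ d s → s ∈ cells (across d s)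
cells-across⁺ E (x , y) = there (here (cong (x ,_) (sym (ℤ.suc-pred y))))
cells-across⁺ N s       = here refl
cells-across⁺ W s       = here refl
cells-across⁺ S (x , y) = there (here (cong (_, y) (sym (ℤ.suc-pred x))))

cells-across⁻ : ∀ D s → s ∈ cells D → ∃ λ d → D ≡ across d s
cells-across⁻ (s , horizontal)       _ (here refl)         = N , refl
cells-across⁻ ((x , y) , horizontal) _ (there (here refl)) = S , cong (λ x → (x , y) , horizontal)
  (sym (ℤ.pred-suc x))
cells-across⁻ (s , vertical)         _ (here refl)         = W , refl
cells-across⁻ ((x , y) , vertical)   _ (there (here refl)) = E , cong (λ y → (x , y) , vertical)
  (sym (ℤ.pred-suc y))

module _ {P : Pred Square 0ℓ} where

  all-cells-across : ∀ d s → P s → P (rightOf d (corner d s)) → All P (cells (across d s))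
  all-cells-across E (x , y) p q = q ∷ subst P (cong (x ,_) (sym (ℤ.suc-pred y))) p ∷ []
  all-cells-across N s       p q = p ∷ q ∷ []
  all-cells-across W (x , y) p q = p ∷ subst P (cong (_, ℤ.suc y) (ℤ.pred-suc x)) q ∷ []
  all-cells-across S (x , y) p q = subst P (cong (ℤ.pred x ,_) (ℤ.pred-suc y)) q ∷ subst P
    (cong (_, y) (sym (ℤ.suc-pred x))) p ∷ []

drop-across : (Vertex → ℤ) → Domino → ℕ
drop-across h D = let u , d = bisector D in ℤ.∣ h u ℤ.- h (step d u) ∣

-- On the sides `W` and `S` the bisector runs opposite to the side, which the absolute value hides.
drop-across-side : ∀ h d s → drop-across h (across d s) ≡ ℤ.∣ h (corner d s) ℤ.- h
  (step d (corner d s)) ∣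
drop-across-side h E (x , y) = cong (λ y → ℤ.∣ h (x , y) ℤ.- h (ℤ.suc x , y) ∣) (ℤ.suc-pred y)
drop-across-side h N s       = refl
drop-across-side h W (x , y) = trans (ℤ.∣i-j∣≡∣j-i∣ (h (x , ℤ.suc y)) _)
  (cong (λ x′ → ℤ.∣ h (ℤ.suc x , ℤ.suc y) ℤ.- h (x′ , ℤ.suc y) ∣) (sym (ℤ.pred-suc x)))
drop-across-side h S (x , y) = trans (cong (λ x → ℤ.∣ h (x , y) ℤ.- h (x , ℤ.suc y) ∣)
  (ℤ.suc-pred x))
  (trans (ℤ.∣i-j∣≡∣j-i∣ (h (x , y)) _) (cong (λ y′ → ℤ.∣ h (x , ℤ.suc y) ℤ.- h (x , y′) ∣)
    (sym (ℤ.pred-suc y))))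

∈-dominos⁺ : ∀ {R} D → All (_∈ R) (cells D) → D ∈ dominos R
∈-dominos⁺ {R} (s , horizontal) (s∈ ∷ t) = ∈-filter⁺ (λ D → all? (_∈? R) (cells D))
  (∈-cartesianProduct⁺ s∈ (here refl)) (s∈ ∷ t)
∈-dominos⁺ {R} (s , vertical)   (s∈ ∷ t) = ∈-filter⁺ (λ D → all? (_∈? R) (cells D))
  (∈-cartesianProduct⁺ s∈ (there (here refl))) (s∈ ∷ t)

∈-dominos⁻ : ∀ {R D} → D ∈ dominos R → All (_∈ R) (cells D)
∈-dominos⁻ {R} D∈ = proj₂ (∈-filter⁻ (λ D → all? (_∈? R) (cells D)) {xs = cartesianProduct R _} D∈)

dominos-unique : ∀ {R} → Unique R → Unique (dominos R)
dominos-unique {R} u = Unique.filter⁺ (λ D → all? (_∈? R) (cells D)) (Unique.cartesianProduct⁺ u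
  (((λ ()) ∷ []) ∷ [] ∷ []))

-- Sublists of a list without repetitions

module _ {A : Set} where

  subsequences-⊆ : ∀ {xs ys : List A} {x} → ys ∈ subsequences xs → x ∈ ys → x ∈ xs
  subsequences-⊆ {[]} (here refl) ()
  subsequences-⊆ {y ∷ xs} ys∈ x∈ with ∈-++⁻ (map (y ∷_) (subsequences xs)) ys∈
  ... | inj₂ ys∈′ = there (subsequences-⊆ ys∈′ x∈)
  ... | inj₁ ys∈′ with ∈-map⁻ (y ∷_) ys∈′
  subsequences-⊆ {y ∷ xs} ys∈ (here eq)  | inj₁ _ | _ , _ , refl = here eq
  subsequences-⊆ {y ∷ xs} ys∈ (there x∈) | inj₁ _ | zs , zs∈ , refl = there (subsequences-⊆ zs∈ x∈)

  subsequences-unique : ∀ {xs : List A} → Unique xs → Unique (subsequences xs)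
  subsequences-unique {[]}     []       = [] ∷ []
  subsequences-unique {x ∷ xs} (x∉ ∷ u) = Unique.++⁺ (Unique.map⁺ (λ { refl → refl })
    (subsequences-unique u)) (subsequences-unique u)
    λ { (ys∈₁ , ys∈₂) → let _ , _ , eq = ∈-map⁻ (x ∷_) ys∈₁
                        in All.lookup x∉ (subsequences-⊆ ys∈₂ (subst (x ∈_) (sym eq) (here refl))) refl }

  filter-∈-subsequences : ∀ {P : Pred A 0ℓ} (P? : Decidable P) xs → filter P? xs ∈ subsequences xs
  filter-∈-subsequences P? []       = here refl
  filter-∈-subsequences P? (x ∷ xs) with P? x
  ... | yes _ = ∈-++⁺ˡ (∈-map⁺ (x ∷_) (filter-∈-subsequences P? xs))
  ... | no  _ = ∈-++⁺ʳ (map (x ∷_) (subsequences xs)) (filter-∈-subsequences P? xs)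

  -- Lets tilings with the same dominos be identified as lists.
  subsequences-ext : ∀ {zs xs ys : List A} → Unique zs → xs ∈ subsequences zs → ys ∈ subsequences zs
    →
    (∀ {z} → z ∈ zs → z ∈ xs → z ∈ ys) → (∀ {z} → z ∈ zs → z ∈ ys → z ∈ xs) → xs ≡ ys
  subsequences-ext {[]} _ (here refl) (here refl) _ _ = refl
  subsequences-ext {z ∷ zs} (z∉ ∷ u) xs∈ ys∈ f g
    with ∈-++⁻ (map (z ∷_) (subsequences zs)) xs∈ | ∈-++⁻ (map (z ∷_) (subsequences zs)) ys∈
  ... | inj₂ xs∈′ | inj₂ ys∈′ = subsequences-ext u xs∈′ ys∈′ (f ∘ there) (g ∘ there)
  ... | inj₁ xs∈′ | inj₂ ys∈′ with ∈-map⁻ (z ∷_) xs∈′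
  ...   | _ , _ , refl = contradiction refl (All.lookup z∉ (subsequences-⊆ ys∈′
    (f (here refl) (here refl))))
  subsequences-ext {z ∷ zs} (z∉ ∷ u) xs∈ ys∈ f g
      | inj₂ xs∈′ | inj₁ ys∈′ with ∈-map⁻ (z ∷_) ys∈′
  ...   | _ , _ , refl = contradiction refl (All.lookup z∉ (subsequences-⊆ xs∈′
    (g (here refl) (here refl))))
  subsequences-ext {z ∷ zs} (z∉ ∷ u) xs∈ ys∈ f g
      | inj₁ xs∈′ | inj₁ ys∈′ with ∈-map⁻ (z ∷_) xs∈′ | ∈-map⁻ (z ∷_) ys∈′
  ...   | _ , xs₁∈ , refl | _ , ys₁∈ , refl = cong (z ∷_) (subsequences-ext u xs₁∈ ys₁∈ (λ t∈
    → strip t∈ ∘ f (there t∈) ∘ there) (λ t∈ → strip t∈ ∘ g (there t∈) ∘ there))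
    where
    strip : ∀ {t ts} → t ∈ zs → t ∈ z ∷ ts → t ∈ ts
    strip t∈ (here refl) = contradiction refl (All.lookup z∉ t∈)
    strip t∈ (there t∈′) = t∈′

  unique-length : ∀ {xs : List A} {x} → Unique xs → x ∈ xs → (∀ {y} → y ∈ xs → y ≡ x) → length xs
    ≡ 1
  unique-length {_ ∷ []}     _              _ _     = refl
  unique-length {_ ∷ _ ∷ _} ((x≢y ∷ _) ∷ _) _ all≡x = contradiction (trans (all≡x (here refl))
    (sym (all≡x (there (here refl))))) x≢y

tilings-unique : ∀ {R} → Unique R → Unique (tilings R)
tilings-unique {R} u = Unique.filter⁺ (isTiling? R) (subsequences-unique (dominos-unique u))

-- The change of height along an edge with a square of colour b on its left; it is
-- long when the edge bisects a domino.
rise : (b long : Bool) → ℤ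
rise true  false = + 1
rise true  true  = ℤ.- + 3
rise false false = ℤ.- + 1
rise false true  = + 3

∣rise∣≡3 : ∀ b → ℤ.∣ rise b true ∣ ≡ 3
∣rise∣≡3 true  = refl
∣rise∣≡3 false = refl

∣∣-rise : ∀ i b l → ℤ.∣ i ℤ.- (i ℤ.+ rise b l) ∣ ≡ ℤ.∣ rise b l ∣
∣∣-rise i b l = trans (cong ℤ.∣_∣ (solve 2 (λ i r → i :- (i :+ r) := :- r) refl i (rise b l)))
  (ℤ.∣-i∣≡∣i∣ (rise b l))
  where open ℤ-Solver

rise-long : ∀ b {l} → ℤ.∣ rise b l ∣ ≡ 3 → l ≡ true
rise-long b     {true}  _  = refl
rise-long true  {false} ()
rise-long false {false} ()

toℕ : Bool → ℕ
toℕ true  = 1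
toℕ false = 0

-- Since `rise b l` is `rise b false` times `1 - 4 l`, the four rises sum to `rise b false` times
-- `4 - 4 c`, where `c` counts the long sides; and `rise b false` is not 0.
one-long : ∀ b k l m n → rise b k ℤ.+ rise b l ℤ.+ rise b m ℤ.+ rise b n ≡ + 0
  → toℕ k ℕ.+ (toℕ l ℕ.+ (toℕ m ℕ.+ toℕ n)) ≡ 1
one-long b k l m n sum≡0 with ℤ.i*j≡0⇒i≡0∨j≡0 (rise b false) product≡0
  where
  open ℤ-Solver
  c = toℕ k ℕ.+ (toℕ l ℕ.+ (toℕ m ℕ.+ toℕ n))
  rise≡ : ∀ b l → rise b l ≡ rise b false ℤ.* (+ 1 ℤ.- + 4 ℤ.* + toℕ l)
  rise≡ true  true  = refl
  rise≡ true  false = refl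
  rise≡ false true  = refl
  rise≡ false false = refl
  product≡0 : rise b false ℤ.* (+ 4 ℤ.- + 4 ℤ.* + c) ≡ + 0
  product≡0 = trans
    (solve 5 (λ r k l m n → r :* (con (+ 4) :- con (+ 4) :* (k :+ (l :+ (m :+ n)))) :=
      r :* (con (+ 1) :- con (+ 4) :* k) :+ r :* (con (+ 1) :- con (+ 4) :* l) :+
      r :* (con (+ 1) :- con (+ 4) :* m) :+ r :* (con (+ 1) :- con (+ 4) :* n)) refl
      (rise b false) (+ toℕ k) (+ toℕ l) (+ toℕ m) (+ toℕ n))
    (trans (sym (cong₂ ℤ._+_ (cong₂ ℤ._+_ (cong₂ ℤ._+_ (rise≡ b k) (rise≡ b l)) (rise≡ b m))
      (rise≡ b n))) sum≡0)
one-long true  k l m n _ | inj₁ ()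
one-long false k l m n _ | inj₁ ()
one-long b     k l m n _ | inj₂ 4-4c≡0 = ℤ.+-injective (ℤ.*-cancelˡ-≡ (+ 4) _ (+ 1)
  (sym (ℤ.i-j≡0⇒i≡j (+ 4) _ 4-4c≡0)))

unique-long : (l : Dir → Bool) → toℕ (l E) ℕ.+ (toℕ (l N) ℕ.+ (toℕ (l W) ℕ.+ toℕ (l S))) ≡ 1 →
  ∃ λ i → l i ≡ true × (∀ j → l j ≡ true → j ≡ i)
unique-long l one with l E in e | l N in n | l W in w | l S in s
unique-long l () | true  | true  | _     | _
unique-long l () | true  | false | true  | _
unique-long l () | true  | false | false | true
unique-long l _  | true  | false | false | false = E , e , λ where
  E _ → refl
  N t → contradiction (trans (sym t) n) λ ()
  W t → contradiction (trans (sym t) w) λ ()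
  S t → contradiction (trans (sym t) s) λ ()
unique-long l () | false | true  | true  | _
unique-long l () | false | true  | false | true
unique-long l _  | false | true  | false | false = N , n , λ where
  E t → contradiction (trans (sym t) e) λ ()
  N _ → refl
  W t → contradiction (trans (sym t) w) λ ()
  S t → contradiction (trans (sym t) s) λ ()
unique-long l () | false | false | true  | true
unique-long l _  | false | false | true  | false = W , w , λ where
  E t → contradiction (trans (sym t) e) λ ()
  N t → contradiction (trans (sym t) n) λ ()
  W _ → refl
  S t → contradiction (trans (sym t) s) λ ()
unique-long l _  | false | false | false | true  = S , s , λ where
  E t → contradiction (trans (sym t) e) λ ()
  N t → contradiction (trans (sym t) n) λ ()
  W t → contradiction (trans (sym t) w) λ ()
  S _ → refl
unique-long l () | false | false | false | false

-- Height functions and tilings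

module _ {black : Square → Bool} (checkerboard : IsCheckerboard black) where

  black-rightOf : ∀ d u → black (rightOf d u) ≡ not (black (leftOf d u))
  black-rightOf E u = checkerboard S (leftOf E u)
  black-rightOf N u = trans (sym (𝔹.not-involutive _))
    (cong not (sym (checkerboard W (rightOf N u))))
  black-rightOf W u = trans (sym (𝔹.not-involutive _))
    (cong not (sym (checkerboard S (rightOf W u))))
  black-rightOf S u = checkerboard W (leftOf S u)

module _ (R : Region) where

  edge-opposite : ∀ {d u} → IsEdge R d u → IsEdge R (opposite d) (step d u)
  edge-opposite {d} {u} (inj₁ l∈) = inj₂ (subst (_∈ squares R) (sym (rightOf-opposite d u)) l∈)
  edge-opposite {d} {u} (inj₂ r∈) = inj₁ (subst (_∈ squares R) (sym (leftOf-opposite d u)) r∈)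

  leftOf-vertex : ∀ d {u} → leftOf d u ∈ squares R → IsVertex R u
  leftOf-vertex E l∈ = here l∈
  leftOf-vertex N l∈ = there (here l∈)
  leftOf-vertex W l∈ = there (there (here l∈))
  leftOf-vertex S l∈ = there (there (there (here l∈)))

  edge-source : ∀ {d u} → IsEdge R d u → IsVertex R u
  edge-source {d} (inj₁ l∈) = leftOf-vertex d l∈
  edge-source {E} (inj₂ r∈) = leftOf-vertex S r∈
  edge-source {N} (inj₂ r∈) = leftOf-vertex E r∈
  edge-source {W} (inj₂ r∈) = leftOf-vertex N r∈
  edge-source {S} (inj₂ r∈) = leftOf-vertex W r∈

  edge-target : ∀ {d u} → IsEdge R d u → IsVertex R (step d u)
  edge-target {d} {u} e = edge-source {opposite d} {step d u} (edge-opposite {d} {u} e)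

  boundary⇒edge : ∀ {d u} → IsBoundaryEdge R d u → IsEdge R d u
  boundary⇒edge (inj₁ (l∈ , _)) = inj₁ l∈
  boundary⇒edge (inj₂ (_ , r∈)) = inj₂ r∈

  bisector-edge : ∀ {D} → D ∈ dominos (squares R) → let u , d = bisector D in IsEdge R d u
  bisector-edge {_ , horizontal} D∈ = inj₂ (All.head (All.tail (∈-dominos⁻ {squares R} D∈)))
  bisector-edge {_ , vertical}   D∈ = inj₁ (All.head (All.tail (∈-dominos⁻ {squares R} D∈)))

  edge-kind : ∀ d u → IsEdge R d u → IsBoundaryEdge R d u ⊎ (leftOf d u ∈ squares R
    × rightOf d u ∈ squares R)
  edge-kind d u e with leftOf d u ∈? squares R | rightOf d u ∈? squares R
  ... | yes l∈ | yes r∈ = inj₂ (l∈ , r∈)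
  ... | yes l∈ | no  r∉ = inj₁ (inj₁ (l∈ , r∉))
  ... | no  l∉ | yes r∈ = inj₁ (inj₂ (l∉ , r∈))
  ... | no  l∉ | no  r∉ = contradiction e λ { (inj₁ l∈) → l∉ l∈ ; (inj₂ r∈) → r∉ r∈ }

module Heights (black : Square → Bool) (checkerboard : IsCheckerboard black) (R : Region) where

  IsHeight : (Vertex → ℤ) → Set
  IsHeight = IsHeightFunction R black

  open IsHeightFunction

  -- `blackLeft` constrains an edge only when the square on its left is black; otherwise it is
  -- applied to the reversed edge.
  edge-rise : ∀ {h} → IsHeight h → ∀ d u → IsEdge R d u → ∃ λ l → h (step d u) ≡ h u ℤ.+ rise
    (black (leftOf d u)) l
  edge-rise {h} hh d u e with black (leftOf d u) in eq
  ... | true with blackLeft hh d u e eq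
  ...   | inj₁ short = false , short
  ...   | inj₂ long  = true , long
  edge-rise {h} hh d u e | false
    with blackLeft hh (opposite d) (step d u) (edge-opposite R {d} {u} e)
           (trans (cong black (leftOf-opposite d u)) (trans (black-rightOf checkerboard d u)
             (cong not eq)))
  ...   | inj₁ short = false , trans (solve 1 (λ i → i := (i :+ con (+ 1)) :+ con (ℤ.- + 1)) refl
    (h (step d u)))
            (cong (ℤ._+ (ℤ.- + 1)) (trans (sym short) (cong h (step-opposite d u))))
    where open ℤ-Solver
  ...   | inj₂ long  = true , trans (solve 1 (λ i → i := (i :- con (+ 3)) :+ con (+ 3)) refl
    (h (step d u)))
            (cong (ℤ._+ + 3) (trans (sym long) (cong h (step-opposite d u))))
    where open ℤ-Solver

  ∣drop∣ : ∀ (h : Vertex → ℤ) d u {b l} → h (step d u) ≡ h u ℤ.+ rise b l → ℤ.∣ h u ℤ.- h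
    (step d u) ∣ ≡ ℤ.∣ rise b l ∣
  ∣drop∣ h d u {b} {l} eq = trans (cong (λ i → ℤ.∣ h u ℤ.- i ∣) eq) (∣∣-rise (h u) b l)

  shift-height : ∀ {h} c → IsHeight h → IsHeight (λ u → h u ℤ.+ c)
  shift-height {h} c hh .boundary d u b = trans (cong ℤ.∣_∣ (solve 3 (λ i j c → (i :+ c) :- (j :+ c)
    := i :- j) refl (h u) (h (step d u)) c)) (boundary hh d u b)
    where open ℤ-Solver
  shift-height {h} c hh .blackLeft d u e bl with blackLeft hh d u e bl
  ... | inj₁ eq = inj₁ (trans (cong (ℤ._+ c) eq) (solve 2 (λ i c → (i :+ con (+ 1)) :+ c
    := (i :+ c) :+ con (+ 1)) refl (h u) c))
    where open ℤ-Solver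
  ... | inj₂ eq = inj₂ (trans (cong (ℤ._+ c) eq) (solve 2 (λ i c → (i :- con (+ 3)) :+ c
    := (i :+ c) :- con (+ 3)) refl (h u) c))
    where open ℤ-Solver

  -- Every condition on a height function involves a single edge, so it may be inherited from `f` on
  -- some edges and from `g` on others.
  select-height : ∀ {f g h} → IsHeight f → IsHeight g →
    (∀ d u → IsEdge R d u → (h u ≡ f u × h (step d u) ≡ f (step d u)) ⊎ (h u ≡ g u × h (step d u)
      ≡ g (step d u))) → IsHeight h
  select-height {f} {g} {h} hf hg select .boundary d u b with select d u (boundary⇒edge R {d} {u} b)
  ... | inj₁ (eq , eq′) = trans (cong₂ (λ i j → ℤ.∣ i ℤ.- j ∣) eq eq′) (boundary hf d u b)
  ... | inj₂ (eq , eq′) = trans (cong₂ (λ i j → ℤ.∣ i ℤ.- j ∣) eq eq′) (boundary hg d u b)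
  select-height {f} {g} {h} hf hg select .blackLeft d u e bl with select d u e
  ... | inj₁ (eq , eq′) = subst₂ (λ i j → j ≡ i ℤ.+ + 1 ⊎ j ≡ i ℤ.- + 3) (sym eq) (sym eq′)
    (blackLeft hf d u e bl)
  ... | inj₂ (eq , eq′) = subst₂ (λ i j → j ≡ i ℤ.+ + 1 ⊎ j ≡ i ℤ.- + 3) (sym eq) (sym eq′)
    (blackLeft hg d u e bl)

  lowRise : Bool → ℤ
  lowRise true  = ℤ.- + 3
  lowRise false = ℤ.- + 1

  rise-low-or-high : ∀ b l → rise b l ≡ lowRise b ⊎ rise b l ≡ lowRise b ℤ.+ + 4
  rise-low-or-high true  true  = inj₁ refl
  rise-low-or-high true  false = inj₂ refl
  rise-low-or-high false true  = inj₂ refl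
  rise-low-or-high false false = inj₁ refl

  lowRise≤rise : ∀ b l → lowRise b ℤ.≤ rise b l
  lowRise≤rise b l with rise-low-or-high b l
  ... | inj₁ eq = ℤ.≤-reflexive (sym eq)
  ... | inj₂ eq = ℤ.≤-trans (ℤ.i≤i+j (lowRise b) (+ 4)) (ℤ.≤-reflexive (sym eq))

  rise≤highRise : ∀ b l → rise b l ℤ.≤ lowRise b ℤ.+ + 4
  rise≤highRise b l with rise-low-or-high b l
  ... | inj₁ eq = ℤ.≤-trans (ℤ.≤-reflexive eq) (ℤ.i≤i+j (lowRise b) (+ 4))
  ... | inj₂ eq = ℤ.≤-reflexive eq

  rise-mod-4 : ∀ b l l′ → ∃ λ k → rise b l ≡ rise b l′ ℤ.+ + 4 ℤ.* k
  rise-mod-4 true  true  true  = + 0 , refl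
  rise-mod-4 true  true  false = ℤ.- + 1 , refl
  rise-mod-4 true  false true  = + 1 , refl
  rise-mod-4 true  false false = + 0 , refl
  rise-mod-4 false true  true  = + 0 , refl
  rise-mod-4 false true  false = + 1 , refl
  rise-mod-4 false false true  = ℤ.- + 1 , refl
  rise-mod-4 false false false = + 0 , refl

  Congruent : (f g : Vertex → ℤ) → Vertex → Set
  Congruent f g u = ∃ λ k → g u ≡ f u ℤ.+ + 4 ℤ.* k

  congruent-sym : ∀ f g {u} → Congruent f g u → Congruent g f u
  congruent-sym f g {u} (k , eq) = ℤ.- k , trans (solve 2 (λ i k → i := (i :+ con (+ 4) :* k) :+ con
    (+ 4) :* (:- k)) refl (f u) k)
    (cong (ℤ._+ + 4 ℤ.* (ℤ.- k)) (sym eq))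
    where open ℤ-Solver

  -- The two possible rises of an edge, 1 and -3 or -1 and 3, agree modulo 4, so the residues of any
  -- two height functions change in parallel.
  congruent-along : ∀ {f g u w} → IsHeight f → IsHeight g → Path R u w → Congruent f g u
    → Congruent f g w
  congruent-along hf hg (stop _) c = c
  congruent-along {f} {g} {u} hf hg (go d e p) (k , eq) = congruent-along hf hg p (k ℤ.+ k′ , (begin
    g (step d u)                                           ≡⟨ geq ⟩
    g u ℤ.+ rise b l′                                      ≡⟨ cong₂ ℤ._+_ eq req ⟩
    (f u ℤ.+ + 4 ℤ.* k) ℤ.+ (rise b l ℤ.+ + 4 ℤ.* k′)      ≡⟨ solve 4 (λ i k r k′ →
      (i :+ con (+ 4) :* k) :+ (r :+ con (+ 4) :* k′) := (i :+ r) :+ con (+ 4) :* (k :+ k′)) refl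
      (f u) k (rise b l) k′ ⟩
    (f u ℤ.+ rise b l) ℤ.+ + 4 ℤ.* (k ℤ.+ k′)              ≡⟨ cong (ℤ._+ + 4 ℤ.* (k ℤ.+ k′)) feq ⟨
    f (step d u) ℤ.+ + 4 ℤ.* (k ℤ.+ k′)                    ∎))
    where
    open ≡-Reasoning
    open ℤ-Solver using (solve; _:+_; _:-_; _:*_; :-_; con; _:=_)
    b = black (leftOf d u)
    l = proj₁ (edge-rise hf d u e)
    feq = proj₂ (edge-rise hf d u e)
    l′ = proj₁ (edge-rise hg d u e)
    geq = proj₂ (edge-rise hg d u e)
    k′ = proj₁ (rise-mod-4 b l′ l)
    req = proj₂ (rise-mod-4 b l′ l)

  gap-4 : ∀ {i j} k → j ≡ i ℤ.+ + 4 ℤ.* k → i ℤ.< j → i ℤ.+ + 4 ℤ.≤ j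
  gap-4 {i} {j} k eq i<j with k ℤ.≤? + 0
  ... | yes k≤0 = contradiction i<j (ℤ.≤⇒≯ (ℤ.≤-trans (ℤ.≤-reflexive eq)
    (ℤ.≤-trans (ℤ.+-monoʳ-≤ i (ℤ.*-monoˡ-≤-nonNeg (+ 4) k≤0)) (ℤ.≤-reflexive (ℤ.+-identityʳ i)))))
  ... | no  k≰0 = ℤ.≤-trans (ℤ.+-monoʳ-≤ i (ℤ.*-monoˡ-≤-nonNeg (+ 4) (ℤ.i<j⇒suc[i]≤j (ℤ.≰⇒> k≰0))))
    (ℤ.≤-reflexive (sym eq))

  -- Two heights that are congruent mod 4 differ by at least 4 or not at all, and along
  -- an edge their difference changes by at most 4, so it does not change sign.
  no-crossing : ∀ {f g} → IsHeight f → IsHeight g → ∀ d u → IsEdge R d u → Congruent f g u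
    → f u ℤ.< g u → f (step d u) ℤ.≤ g (step d u)
  no-crossing {f} {g} hf hg d u e (k , eq) f<g = begin
    f (step d u)                        ≡⟨ proj₂ (edge-rise hf d u e) ⟩
    f u ℤ.+ rise b (proj₁ (edge-rise hf d u e)) ≤⟨ ℤ.+-monoʳ-≤ (f u) (rise≤highRise b _) ⟩
    f u ℤ.+ (lowRise b ℤ.+ + 4)         ≡⟨ solve 2 (λ i r → i :+ (r :+ con (+ 4))
      := (i :+ con (+ 4)) :+ r) refl (f u) (lowRise b) ⟩
    (f u ℤ.+ + 4) ℤ.+ lowRise b         ≤⟨ ℤ.+-mono-≤ (gap-4 k eq f<g) (lowRise≤rise b _) ⟩
    g u ℤ.+ rise b (proj₁ (edge-rise hg d u e)) ≡⟨ proj₂ (edge-rise hg d u e) ⟨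
    g (step d u)                        ∎
    where
    open ℤ.≤-Reasoning
    open ℤ-Solver using (solve; _:+_; _:-_; _:*_; :-_; con; _:=_)
    b = black (leftOf d u)

  same-order : ∀ {f g} → IsHeight f → IsHeight g → (∀ {u} → IsVertex R u → Congruent f g u) → ∀ d u
    → IsEdge R d u →
    (f u ℤ.≤ g u × f (step d u) ℤ.≤ g (step d u)) ⊎ (g u ℤ.≤ f u × g (step d u) ℤ.≤ f (step d u))
  same-order {f} {g} hf hg cong-fg d u e with ℤ.<-cmp (f u) (g u)
  ... | tri< f<g _ _ = inj₁ (ℤ.<⇒≤ f<g , no-crossing hf hg d u e (cong-fg (edge-source R {d} e))
    f<g)
  ... | tri> _ _ g<f = inj₂ (ℤ.<⇒≤ g<f , no-crossing hg hf d u e (congruent-sym f g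
    (cong-fg (edge-source R {d} e))) g<f)
  ... | tri≈ _ f≡g _ with ℤ.≤-total (f (step d u)) (g (step d u))
  ...   | inj₁ f≤g = inj₁ (ℤ.≤-reflexive f≡g , f≤g)
  ...   | inj₂ g≤f = inj₂ (ℤ.≤-reflexive (sym f≡g) , g≤f)

  ⊓-height : ∀ {f g} → IsHeight f → IsHeight g → (∀ {u} → IsVertex R u → Congruent f g u)
    → IsHeight (λ u → f u ℤ.⊓ g u)
  ⊓-height hf hg c = select-height hf hg λ d u e → case-order (same-order hf hg c d u e)
    where
    case-order : ∀ {i j k l} → (i ℤ.≤ j × k ℤ.≤ l) ⊎ (j ℤ.≤ i × l ℤ.≤ k) → (i ℤ.⊓ j ≡ i × k ℤ.⊓ l
      ≡ k) ⊎ (i ℤ.⊓ j ≡ j × k ℤ.⊓ l ≡ l)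
    case-order (inj₁ (p , q)) = inj₁ (ℤ.i≤j⇒i⊓j≡i p , ℤ.i≤j⇒i⊓j≡i q)
    case-order (inj₂ (p , q)) = inj₂ (ℤ.i≥j⇒i⊓j≡j p , ℤ.i≥j⇒i⊓j≡j q)

  ⊔-height : ∀ {f g} → IsHeight f → IsHeight g → (∀ {u} → IsVertex R u → Congruent f g u)
    → IsHeight (λ u → f u ℤ.⊔ g u)
  ⊔-height hf hg c = select-height hf hg λ d u e → case-order (same-order hf hg c d u e)
    where
    case-order : ∀ {i j k l} → (i ℤ.≤ j × k ℤ.≤ l) ⊎ (j ℤ.≤ i × l ℤ.≤ k) → (i ℤ.⊔ j ≡ i × k ℤ.⊔ l
      ≡ k) ⊎ (i ℤ.⊔ j ≡ j × k ℤ.⊔ l ≡ l)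
    case-order (inj₁ (p , q)) = inj₂ (ℤ.i≤j⇒i⊔j≡j p , ℤ.i≤j⇒i⊔j≡j q)
    case-order (inj₂ (p , q)) = inj₁ (ℤ.i≥j⇒i⊔j≡i p , ℤ.i≥j⇒i⊔j≡i q)

  module _ (h : Vertex → ℤ) (hh : IsHeight h) where

    private
      long? : Decidable (λ D → drop-across h D ≡ 3)
      long? D = drop-across h D ℕ.≟ 3

    tilingOf : Tiling
    tilingOf = filter long? (dominos (squares R))

    side-edge : ∀ d {s} → s ∈ squares R → IsEdge R d (corner d s)
    side-edge d {s} s∈ = inj₁ (subst (_∈ squares R) (sym (leftOf-corner d s)) s∈)

    side-rise : ∀ {s} → s ∈ squares R → ∀ d → ∃ λ l → h (corner (turnLeft d) s)
      ≡ h (corner d s) ℤ.+ rise (black s) l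
    side-rise {s} s∈ d with edge-rise hh d (corner d s) (side-edge d s∈)
    ... | l , eq = l , trans (cong h (sym (step-corner d s)))
      (trans eq (cong (λ t → h (corner d s) ℤ.+ rise (black t) l) (leftOf-corner d s)))

    module _ {s} (s∈ : s ∈ squares R) (long : Dir → Bool)
             (rises : ∀ d → h (corner (turnLeft d) s) ≡ h (corner d s) ℤ.+ rise (black s) (long d))
             where

      rises-closed : rise (black s) (long E) ℤ.+ rise (black s) (long N) ℤ.+ rise (black s) (long W)
        ℤ.+ rise (black s) (long S) ≡ + 0
      rises-closed = closed (rises E) (rises N) (rises W) (rises S)
        where
        open ℤ-Solver
        closed : ∀ {i j k m e n w s} → j ≡ i ℤ.+ e → k ≡ j ℤ.+ n → m ≡ k ℤ.+ w → i ≡ m ℤ.+ s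
          → e ℤ.+ n ℤ.+ w ℤ.+ s ≡ + 0
        closed {i} {e = e} {n} {w} {s} refl refl refl eq = ∙-cancelˡ i _ _ (trans
          (solve 5 (λ i e n w s → i :+ (e :+ n :+ w :+ s) := (((i :+ e) :+ n) :+ w) :+ s) refl i e n
            w s)
          (trans (sym eq) (sym (ℤ.+-identityʳ i))))

      drop≡∣rise∣ : ∀ d → drop-across h (across d s) ≡ ℤ.∣ rise (black s) (long d) ∣
      drop≡∣rise∣ d = trans (drop-across-side h d s)
        (trans (cong (λ v → ℤ.∣ h (corner d s) ℤ.- h v ∣) (step-corner d s))
        (trans (cong (λ i → ℤ.∣ h (corner d s) ℤ.- i ∣) (rises d)) (∣∣-rise (h (corner d s))
          (black s) (long d))))

      -- The long side is not a boundary edge, where the drop would be 1, so the square beyond it is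
      -- in `R` and the domino across it exists. Conversely, a chosen domino covering `s` lies
      -- across a long side.
      covered-by : ∀ i → long i ≡ true → (∀ j → long j ≡ true → j ≡ i)
        → length (filter (λ D → s ∈? cells D) tilingOf) ≡ 1
      covered-by i long-i only-i = unique-length
        (Unique.filter⁺ (λ D → s ∈? cells D) (Unique.filter⁺ long? (dominos-unique (unique R))))
        (∈-filter⁺ (λ D → s ∈? cells D) (∈-filter⁺ long? across∈ drop≡3) (cells-across⁺ i s))
        only
        where
        drop≡3 : drop-across h (across i s) ≡ 3
        drop≡3 = trans (drop≡∣rise∣ i) (trans (cong (λ l → ℤ.∣ rise (black s) l ∣) long-i)
          (∣rise∣≡3 (black s)))
        across∈ : across i s ∈ dominos (squares R)
        across∈ with edge-kind R i (corner i s) (side-edge i s∈)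
        ... | inj₂ (_ , r∈) = ∈-dominos⁺ (across i s) (all-cells-across i s s∈ r∈)
        ... | inj₁ bd = contradiction (trans (sym drop≡3) (trans (drop-across-side h i s)
          (boundary hh i (corner i s) bd))) λ ()
        only : ∀ {D} → D ∈ filter (λ D → s ∈? cells D) tilingOf → D ≡ across i s
        only {D} D∈ with ∈-filter⁻ (λ D → s ∈? cells D) {xs = tilingOf} D∈
        ... | D∈T , s∈D with cells-across⁻ D s s∈D
        ...   | d , refl = cong (λ d → across d s) (only-i d
          (rise-long (black s) (trans (sym (drop≡∣rise∣ d))
            (proj₂ (∈-filter⁻ long? {xs = dominos (squares R)} D∈T)))))

    covered-once : ∀ {s} → s ∈ squares R → length (filter (λ D → s ∈? cells D) tilingOf) ≡ 1
    covered-once {s} s∈ = covered-by s∈ long rises i long-i only-i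
      where
      long : Dir → Bool
      long d = proj₁ (side-rise s∈ d)
      rises = λ d → proj₂ (side-rise s∈ d)
      one = unique-long long (one-long (black s) (long E) (long N) (long W) (long S)
        (rises-closed s∈ long rises))
      i = proj₁ one
      long-i = proj₁ (proj₂ one)
      only-i = proj₂ (proj₂ one)

    tilingOf-∈ : tilingOf ∈ tilings (squares R)
    tilingOf-∈ = ∈-filter⁺ (isTiling? (squares R)) (filter-∈-subsequences long?
      (dominos (squares R)))
      (All.tabulate covered-once)

    tilingOf-height : IsHeightOf R black tilingOf h
    tilingOf-height .IsHeightOf.isHeightFunction = hh
    tilingOf-height .IsHeightOf.bisected D D∈ = mk⇔ (λ D∈T
      → proj₂ (∈-filter⁻ long? {xs = dominos (squares R)} D∈T)) (∈-filter⁺ long? D∈)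

  module _ {T h h′} (H : IsHeightOf R black T h) (H′ : IsHeightOf R black T h′) where

    open IsHeightOf

    -- On a boundary edge both drops are 1. Any other edge bisects a domino of `R`, and whether that
    -- domino is in `T` decides both drops.
    long-iff : ∀ d u → IsEdge R d u → ℤ.∣ h u ℤ.- h (step d u) ∣ ≡ ℤ.∣ h′ u ℤ.- h′ (step d u) ∣ ⊎
      (ℤ.∣ h u ℤ.- h (step d u) ∣ ≡ 3 ⇔ ℤ.∣ h′ u ℤ.- h′ (step d u) ∣ ≡ 3)
    long-iff d u e with edge-kind R d u e
    ... | inj₁ bd = inj₁ (trans (boundary (isHeightFunction H) d u bd)
      (sym (boundary (isHeightFunction H′) d u bd)))
    ... | inj₂ (l∈ , r∈) = inj₂ (mk⇔
        (λ p → trans (sym (drop-u h′)) (to (bisected H′ D D∈) (from (bisected H D D∈)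
          (trans (drop-u h) p))))
        (λ p → trans (sym (drop-u h)) (to (bisected H D D∈) (from (bisected H′ D D∈)
          (trans (drop-u h′) p)))))
      where
      open Equivalence
      s = leftOf d u
      D = across d s
      D∈ = ∈-dominos⁺ D (all-cells-across d s l∈ (subst (λ v → rightOf d v ∈ squares R)
        (sym (corner-leftOf d u)) r∈))
      drop-u : ∀ h → drop-across h D ≡ ℤ.∣ h u ℤ.- h (step d u) ∣
      drop-u h = trans (drop-across-side h d s) (cong (λ v → ℤ.∣ h v ℤ.- h (step d v) ∣)
        (corner-leftOf d u))

    same-rise : ∀ d u → IsEdge R d u → ∃ λ i → h (step d u) ≡ h u ℤ.+ i × h′ (step d u) ≡ h′ u ℤ.+ i
    same-rise d u e with edge-rise (isHeightFunction H) d u e | edge-rise (isHeightFunction H′) d u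
      e
    ... | l , eq | l′ , eq′ = rise b l , eq , trans eq′ (cong (λ l → h′ u ℤ.+ rise b l) (sym l≡l′))
      where
      b = black (leftOf d u)
      m = ∣drop∣ h d u {b} {l} eq
      m′ = ∣drop∣ h′ d u {b} {l′} eq′
      booleans : ∀ {l l′} → (l ≡ true → l′ ≡ true) → (l′ ≡ true → l ≡ true) → l ≡ l′
      booleans {true}          f g = sym (f refl)
      booleans {false} {true}  f g = g refl
      booleans {false} {false} f g = refl
      long≡3 : ∀ {l} → l ≡ true → ℤ.∣ rise b l ∣ ≡ 3
      long≡3 refl = ∣rise∣≡3 b
      l≡l′ : l ≡ l′
      l≡l′ with long-iff d u e
      ... | inj₁ same = booleans (λ t → rise-long b (trans (sym m′) (trans (sym same)
        (trans m (long≡3 t)))))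
                                 (λ t → rise-long b (trans (sym m)
                                   (trans same (trans m′ (long≡3 t)))))
      ... | inj₂ iff  = booleans (λ t → rise-long b (trans (sym m′) (Equivalence.to iff
        (trans m (long≡3 t)))))
                                 (λ t → rise-long b (trans (sym m) (Equivalence.from iff
                                   (trans m′ (long≡3 t)))))

    same-difference : ∀ {u w} → Path R u w → h w ℤ.- h u ≡ h′ w ℤ.- h′ u
    same-difference {u} (stop _) = trans (ℤ.+-inverseʳ (h u)) (sym (ℤ.+-inverseʳ (h′ u)))
    same-difference {u} {w} (go d e p) with same-rise d u e
    ... | i , eq , eq′ = trans (lemma (h w) (h u) (h (step d u)) eq)
      (trans (cong (ℤ._+ i) (same-difference p)) (sym (lemma (h′ w) (h′ u) (h′ (step d u)) eq′)))
      where
      open ℤ-Solver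
      lemma : ∀ w u v → v ≡ u ℤ.+ i → w ℤ.- u ≡ (w ℤ.- v) ℤ.+ i
      lemma w u v refl = solve 3 (λ w u i → w :- u := (w :- (u :+ i)) :+ i) refl w u i

-- Conditioning on heights

sumOf-map : ∀ {A B : Set} (f : B → ℚ) (g : A → B) xs → sumOf f (map g xs) ≡ sumOf (f ∘ g) xs
sumOf-map f g []       = refl
sumOf-map f g (x ∷ xs) = cong (_+_ (f (g x))) (sumOf-map f g xs)

size-map : ∀ {A B : Set} (g : A → B) xs → size (map g xs) ≡ size xs
size-map g xs = cong fromℕ (length-map g xs)

fromℤ-neg : ∀ i → fromℤ (ℤ.- i) ≡ - fromℤ i
fromℤ-neg i = trans (solve 2 (λ m i → m := (m :+ i) :- i) refl (fromℤ (ℤ.- i)) (fromℤ i))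
  (trans (cong (_- fromℤ i) (trans (sym (fromℤ-+ (ℤ.- i) i)) (cong fromℤ (ℤ.+-inverseˡ i))))
    (+-identityˡ (- fromℤ i)))
  where open ℚ-Solver

sumOf-neg : ∀ {A : Set} (f : A → ℚ) xs → sumOf (λ x → - f x) xs ≡ - sumOf f xs
sumOf-neg f []       = refl
sumOf-neg f (x ∷ xs) = trans (cong (_+_ (- f x)) (sumOf-neg f xs))
  (sym (neg-distrib-+ (f x) (sumOf f xs)))

steps : ∀ {R u w} → Path R u w → ℕ
steps (stop _)   = 0
steps (go _ _ p) = suc (steps p)

length-vertices : ∀ {R u w} (p : Path R u w) → length (vertices p) ≡ suc (steps p)
length-vertices (stop _)   = refl
length-vertices (go _ _ p) = cong suc (length-vertices p)

four : ℚ
four = fromℤ (+ 4)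

module TilingHeights (black : Square → Bool) (checkerboard : IsCheckerboard black) (R : Region)
  (connected : ∀ u w → IsVertex R u → IsVertex R w → Path R u w)
  (v : Vertex) (v-vertex : IsVertex R v)
  (H : Tiling → Vertex → ℤ) (heightOf : ∀ T → T ∈ tilings (squares R) → IsHeightOf R black T (H T))
  where

  open Heights black checkerboard R
  open IsHeightOf

  Ts : List Tiling
  Ts = tilings (squares R)

  rel : Tiling → Vertex → ℤ
  rel T x = H T x ℤ.- H T v

  rel-v : ∀ T → rel T v ≡ + 0
  rel-v T = ℤ.+-inverseʳ (H T v)

  -- The height function of a tiling with the value `s` at `v`. Different values of `s` allow a
  -- family of tilings to be compared with a family raised by 4.
  lift : ℤ → Tiling → Vertex → ℤ
  lift s T x = rel T x ℤ.+ s

  lift-v : ∀ s T → lift s T v ≡ s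
  lift-v s T = trans (cong (ℤ._+ s) (rel-v T)) (ℤ.+-identityˡ s)

  lift-injective : ∀ s {T T′ x y} → lift s T x ≡ lift s T′ y → rel T x ≡ rel T′ y
  lift-injective s {T} {T′} {x} {y} = ∙-cancelʳ s (rel T x) (rel T′ y)

  lift-height : ∀ s {T} → T ∈ Ts → IsHeight (lift s T)
  lift-height s {T} T∈ = shift-height s (shift-height (ℤ.- H T v) (isHeightFunction
    (heightOf T T∈)))

  lift-congruent : ∀ {s t T T′} k → t ≡ s ℤ.+ + 4 ℤ.* k → T ∈ Ts → T′ ∈ Ts → ∀ {x} → IsVertex R x
    → Congruent (lift s T) (lift t T′) x
  lift-congruent {s} {t} {T} {T′} k eq T∈ T′∈ {x} x-vertex = congruent-along (lift-height s T∈)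
    (lift-height t T′∈) (connected v x v-vertex x-vertex)
    (k , trans (lift-v t T′) (trans eq (cong (ℤ._+ + 4 ℤ.* k) (sym (lift-v s T)))))

  -- This brings minima and maxima of heights back to tilings: `h` and `H T` are both heights of
  -- `T = tilingOf h hh`, hence differ by a constant, which the value at `v` determines.
  realized : ∀ {h} s → IsHeight h → h v ≡ s → ∃ λ T → T ∈ Ts × (∀ {x} → IsVertex R x → lift s T x
    ≡ h x)
  realized {h} s hh hv = T , T∈ , λ {x} x-vertex → trans
      (cong (ℤ._+ s) (same-difference (heightOf T T∈) (tilingOf-height h hh)
        (connected v x v-vertex x-vertex)))
      (trans (cong (λ i → h x ℤ.- i ℤ.+ s) hv) (solve 2 (λ h s → h :- s :+ s := h) refl (h x) s))
    where
    open ℤ-Solver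
    T = tilingOf h hh
    T∈ = tilingOf-∈ h hh

  endpoints : Domino → List Vertex
  endpoints D = let u , d = bisector D in u ∷ step d u ∷ []

  -- A finite list of vertices on which the heights determine the tiling; the code in the four
  -- functions theorem has to be finite and injective.
  bisectorEnds : List Vertex
  bisectorEnds = concatMap endpoints (dominos (squares R))

  ∈-bisectorEnds : ∀ {Ds D x} → D ∈ Ds → x ∈ endpoints D → x ∈ concatMap endpoints Ds
  ∈-bisectorEnds {_ ∷ _}  (here refl) x∈ = ∈-++⁺ˡ x∈
  ∈-bisectorEnds {D ∷ Ds} (there D∈)  x∈ = ∈-++⁺ʳ (endpoints D) (∈-bisectorEnds D∈ x∈)

  bisectorEnds-vertex : ∀ {Ds x} → (∀ {D} → D ∈ Ds → D ∈ dominos (squares R))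
    → x ∈ concatMap endpoints Ds → IsVertex R x
  bisectorEnds-vertex {D ∷ Ds} ⊆ x∈ with ∈-++⁻ (endpoints D) x∈
  ... | inj₁ (here refl)         = edge-source R {proj₂ (bisector D)} (bisector-edge R {D}
    (⊆ (here refl)))
  ... | inj₁ (there (here refl)) = edge-target R {proj₂ (bisector D)} (bisector-edge R {D}
    (⊆ (here refl)))
  ... | inj₂ x∈′ = bisectorEnds-vertex (⊆ ∘ there) x∈′

  rel-drop : ∀ T D → drop-across (rel T) D ≡ drop-across (H T) D
  rel-drop T D = let u , d = bisector D in
    cong ℤ.∣_∣ (solve 3 (λ i j c → (i :- c) :- (j :- c) := i :- j) refl (H T u) (H T (step d u))
      (H T v))
    where open ℤ-Solver

  rel-injective : ∀ {T T′} → T ∈ Ts → T′ ∈ Ts → (∀ {x} → x ∈ bisectorEnds → rel T x ≡ rel T′ x) → T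
    ≡ T′
  rel-injective {T} {T′} T∈ T′∈ agree = subsequences-ext (dominos-unique (unique R)) (tiling-⊆ T∈)
    (tiling-⊆ T′∈)
      (λ D∈ → transfer T∈ T′∈ D∈ (drops D∈)) (λ D∈ → transfer T′∈ T∈ D∈ (sym (drops D∈)))
    where
    tiling-⊆ : ∀ {T} → T ∈ Ts → T ∈ subsequences (dominos (squares R))
    tiling-⊆ T∈ = proj₁ (∈-filter⁻ (isTiling? (squares R)) {xs = subsequences (dominos (squares R))}
      T∈)
    drops : ∀ {D} → D ∈ dominos (squares R) → drop-across (H T) D ≡ drop-across (H T′) D
    drops {D} D∈ = trans (sym (rel-drop T D)) (trans
      (cong₂ (λ i j → ℤ.∣ i ℤ.- j ∣) (agree (∈-bisectorEnds D∈ (here refl)))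
        (agree (∈-bisectorEnds D∈ (there (here refl))))) (rel-drop T′ D))
    transfer : ∀ {T T′ D} → T ∈ Ts → T′ ∈ Ts → D ∈ dominos (squares R) → drop-across (H T) D
      ≡ drop-across (H T′) D → D ∈ T → D ∈ T′
    transfer {T} {T′} {D} T∈ T′∈ D∈ same D∈T = Equivalence.from (bisected (heightOf T′ T′∈) D D∈)
      (trans (sym same) (Equivalence.to (bisected (heightOf T T∈) D D∈) D∈T))

  -- The tilings whose relative heights take prescribed values on the list xs.
  record Cylinder (xs : List Vertex) (Us : List Tiling) : Set where
    field
      vertex    : ∀ {x} → x ∈ xs → IsVertex R x
      included  : ∀ {T} → T ∈ Us → T ∈ Ts
      distinct  : Unique Us
      constant  : ∀ {T T′} → T ∈ Us → T′ ∈ Us → ∀ {x} → x ∈ xs → rel T x ≡ rel T′ x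
      saturated : ∀ {T T′} → T ∈ Us → T′ ∈ Ts → (∀ {x} → x ∈ xs → rel T x ≡ rel T′ x) → T′ ∈ Us

  open Cylinder

  cylinder-start : Cylinder (v ∷ []) Ts
  cylinder-start .vertex (here refl) = v-vertex
  cylinder-start .included T∈ = T∈
  cylinder-start .distinct = tilings-unique (unique R)
  cylinder-start .constant {T} {T′} _ _ (here refl) = trans (rel-v T) (sym (rel-v T′))
  cylinder-start .saturated _ T′∈ _ = T′∈

  cylinder-filter : ∀ {xs Us y} {P : Pred Tiling 0ℓ} (P? : Decidable P) → Cylinder xs Us
    → IsVertex R y →
    (∀ {T T′} → T ∈ Us → T′ ∈ Us → P T → rel T y ≡ rel T′ y → P T′) →
    (∀ {T T′} → T ∈ Us → T′ ∈ Us → P T → P T′ → rel T y ≡ rel T′ y) → Cylinder (y ∷ xs)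
      (filter P? Us)
  cylinder-filter P? c y-vertex P-closed P-constant .vertex (here refl) = y-vertex
  cylinder-filter P? c y-vertex P-closed P-constant .vertex (there x∈)  = vertex c x∈
  cylinder-filter P? c y-vertex P-closed P-constant .included T∈ = included c
    (proj₁ (∈-filter⁻ P? T∈))
  cylinder-filter P? c y-vertex P-closed P-constant .distinct = Unique.filter⁺ P? (distinct c)
  cylinder-filter P? c y-vertex P-closed P-constant .constant T∈ T′∈ (here refl) =
    let T∈Us , PT = ∈-filter⁻ P? T∈ ; T′∈Us , PT′ = ∈-filter⁻ P? T′∈ in P-constant T∈Us T′∈Us PT PT′
  cylinder-filter P? c y-vertex P-closed P-constant .constant T∈ T′∈ (there x∈) =
    constant c (proj₁ (∈-filter⁻ P? T∈)) (proj₁ (∈-filter⁻ P? T′∈)) x∈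
  cylinder-filter P? c y-vertex P-closed P-constant .saturated T∈ T′∈ agree =
    let T∈Us , PT = ∈-filter⁻ P? T∈ ; T′∈Us = saturated c T∈Us T′∈ (agree ∘ there)
    in ∈-filter⁺ P? T′∈Us (P-closed T∈Us T′∈Us PT (agree (here refl)))

  -- On `xs` the minimum is the lower function and the maximum the upper one, so minima remain in
  -- `Us` and maxima in `Us′`. The shift by a multiple of 4 keeps the heights congruent, so both are
  -- height functions. Since `v` is in `xs`, they take the values `s` and `t` there.
  cylinder-monotone : ∀ {xs Us Us′ w s t} k → t ≡ s ℤ.+ + 4 ℤ.* k → Cylinder xs Us → Cylinder xs Us′
    → v ∈ xs → IsVertex R w →
    (∀ {T T′} → T ∈ Us → T′ ∈ Us′ → ∀ {x} → x ∈ xs → lift s T x ℤ.≤ lift t T′ x) →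
    sumOf (λ T → fromℤ (lift s T w)) Us * size Us′ ≤ size Us * sumOf (λ T → fromℤ (lift t T w)) Us′
  cylinder-monotone {xs} {Us} {Us′} {w} {s} {t} k t≡ c c′ v∈ w-vertex below = subst₂ _≤_
      (cong₂ _*_ (sumOf-map X (lift s) Us) (size-map (lift t) Us′))
        (cong₂ _*_ (size-map (lift s) Us) (sumOf-map X (lift t) Us′))
      (lattice-monotone vs (map (lift s) Us) (map (lift t) Us′) (here refl) (distinguished s c)
        (distinguished t c′) closed)
    where
    X : (Vertex → ℤ) → ℚ
    X f = fromℤ (f w)
    vs = w ∷ bisectorEnds
    vs-vertex : ∀ {x} → x ∈ vs → IsVertex R x
    vs-vertex (here refl) = w-vertex
    vs-vertex (there x∈)  = bisectorEnds-vertex (λ D∈ → D∈) x∈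
    distinguished : ∀ s {Us} → Cylinder xs Us → AllPairs (λ f g → ¬ (∀ {x} → x ∈ vs → f x ≡ g x))
      (map (lift s) Us)
    distinguished s c = AllPairs.map⁺ (allPairs-map-∈
      (λ {T} {T′} T∈ T′∈ T≢T′ agree → T≢T′ (rel-injective (included c T∈) (included c T′∈) (λ {x} x∈
        → lift-injective s {T} {T′} {x} {x} (agree (there x∈)))))
      (distinct c))
    closed : ∀ {f g} → f ∈ map (lift s) Us → g ∈ map (lift t) Us′ →
      (∃ λ h → h ∈ map (lift s) Us × ∀ {x} → x ∈ vs → h x ≡ f x ℤ.⊓ g x)
        × (∃ λ h → h ∈ map (lift t) Us′ × ∀ {x} → x ∈ vs → h x ≡ f x ℤ.⊔ g x)
    closed f∈ g∈ with ∈-map⁻ (lift s) f∈ | ∈-map⁻ (lift t) g∈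
    ... | T , T∈ , refl | T′ , T′∈ , refl =
      (lift s T₁ , ∈-map⁺ (lift s) (saturated c T∈ T₁∈ (λ {x} x∈ → lift-injective s {T} {T₁} {x} {x}
          (sym (trans (T₁≡ (vertex c x∈)) (ℤ.i≤j⇒i⊓j≡i (below T∈ T′∈ x∈)))))) , λ x∈
            → T₁≡ (vs-vertex x∈)) ,
      (lift t T₂ , ∈-map⁺ (lift t) (saturated c′ T′∈ T₂∈ (λ {x} x∈ → lift-injective t {T′} {T₂} {x}
        {x}
          (sym (trans (T₂≡ (vertex c x∈)) (ℤ.i≤j⇒i⊔j≡j (below T∈ T′∈ x∈)))))) , λ x∈
            → T₂≡ (vs-vertex x∈))
      where
      hT = lift-height s (included c T∈)
      hT′ = lift-height t (included c′ T′∈)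
      congruent : ∀ {x} → IsVertex R x → Congruent (lift s T) (lift t T′) x
      congruent = lift-congruent k t≡ (included c T∈) (included c′ T′∈)
      meet = realized s (⊓-height hT hT′ congruent) (trans (ℤ.i≤j⇒i⊓j≡i (below T∈ T′∈ v∈))
        (lift-v s T))
      join = realized t (⊔-height hT hT′ congruent) (trans (ℤ.i≤j⇒i⊔j≡j (below T∈ T′∈ v∈))
        (lift-v t T′))
      T₁ = proj₁ meet
      T₁∈ = proj₁ (proj₂ meet)
      T₁≡ : ∀ {x} → IsVertex R x → lift s T₁ x ≡ lift s T x ℤ.⊓ lift t T′ x
      T₁≡ = proj₂ (proj₂ meet)
      T₂ = proj₁ join
      T₂∈ = proj₁ (proj₂ join)
      T₂≡ : ∀ {x} → IsVertex R x → lift t T₂ x ≡ lift s T x ℤ.⊔ lift t T′ x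
      T₂≡ = proj₂ (proj₂ join)

  module _ (w : Vertex) (w-vertex : IsVertex R w) where

    X : Tiling → ℚ
    X T = fromℤ (H T v ℤ.- H T w)

    open Martingale X four (*<* (ℤ.+<+ (s≤s z≤n))) using (Revealed; done; reveal)

    Y : Tiling → ℚ
    Y T = fromℤ (rel T w)

    X≡-Y : ∀ T → X T ≡ - Y T
    X≡-Y T = trans (cong fromℤ (solve 2 (λ a b → a :- b := :- (b :- a)) refl (H T v) (H T w)))
      (fromℤ-neg (rel T w))
      where open ℤ-Solver

    sum-X : ∀ Us → sumOf X Us ≡ - sumOf Y Us
    sum-X Us = trans (sumOf-cong {f = X} Us (λ {T} _ → X≡-Y T)) (sumOf-neg Y Us)

    sum-lift : ∀ s Us → sumOf (λ T → fromℤ (lift s T w)) Us ≡ sumOf Y Us + size Us * fromℤ s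
    sum-lift s Us = trans (sumOf-cong {f = λ T → fromℤ (lift s T w)} Us (λ {T} _
      → fromℤ-+ (rel T w) s))
      (trans (sumOf-+ Y (λ _ → fromℤ s) Us) (cong (_+_ (sumOf Y Us)) (sumOf-const (fromℤ s) Us)))

    -- Raising the height at one more vertex by 4 raises the mean height at w by
    -- at least 0 and at most 4.
    cylinder-difference : ∀ {xs y} Us Us′ → Cylinder (y ∷ xs) Us → Cylinder (y ∷ xs) Us′ → v ∈ xs →
      (∀ {T T′} → T ∈ Us → T′ ∈ Us′ → ∀ {x} → x ∈ xs → rel T x ≡ rel T′ x) →
      (∀ {T T′} → T ∈ Us → T′ ∈ Us′ → rel T y ℤ.+ + 4 ≡ rel T′ y) →
      ∣ size Us′ * sumOf X Us - size Us * sumOf X Us′ ∣ ≤ four * (size Us * size Us′)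
    cylinder-difference {xs} {y} Us Us′ c c′ v∈ same raised = subst (λ D → ∣ D ∣ ≤ four * (n * m))
      (sym D≡)
        (∣∣-bound {n * b - m * a} {four * (n * m)}
          (≤-by {n * b - m * a} (m * (a + n * four) - (b + m * fromℤ (+ 0)) * n) (p≤q⇒0≤q-p upper′)
            (solve 5 (λ n m a b f → (n :* b :- m :* a) :+ (m :* (a :+ n :* f) :- (b :+ m :* con 0ℚ)
              :* n) := f :* (n :* m)) refl n m a b four))
          (≤-trans (≤-by { - (n * b - m * a)} {0ℚ} (n * (b + m * fromℤ (+ 0)) - (a + n * fromℤ
            (+ 0)) * m) (p≤q⇒0≤q-p lower′)
             (solve 4 (λ n m a b → (:- (n :* b :- m :* a)) :+ (n :* (b :+ m :* con 0ℚ)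
               :- (a :+ n :* con 0ℚ) :* m) := con 0ℚ) refl n m a b))
            (0≤* {four} {n * m} (fromℤ-mono {+ 0} {+ 4} (ℤ.+≤+ z≤n))
              (0≤* {n} {m} (0≤fromℕ (length Us)) (0≤fromℕ (length Us′))))))
      where
      open ℚ-Solver using (solve; _:+_; _:-_; _:*_; :-_; con; _:=_)
      n = size Us
      m = size Us′
      a = sumOf Y Us
      b = sumOf Y Us′
      D≡ : m * sumOf X Us - n * sumOf X Us′ ≡ n * b - m * a
      D≡ = trans (cong₂ (λ p q → m * p - n * q) (sum-X Us) (sum-X Us′))
        (solve 4 (λ n m a b → m :* (:- a) :- n :* (:- b) := n :* b :- m :* a) refl n m a b)
      lower′ : (a + n * fromℤ (+ 0)) * m ≤ n * (b + m * fromℤ (+ 0))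
      lower′ = subst₂ _≤_ (cong (_* m) (sum-lift (+ 0) Us)) (cong (n *_) (sum-lift (+ 0) Us′))
        (cylinder-monotone {s = + 0} {+ 0} (+ 0) refl c c′ (there v∈) w-vertex below)
        where
        below : ∀ {T T′} → T ∈ Us → T′ ∈ Us′ → ∀ {x} → x ∈ y ∷ xs → lift (+ 0) T x ℤ.≤ lift
          (+ 0) T′ x
        below {T} T∈ T′∈ (here refl) = ℤ.+-monoˡ-≤ (+ 0) (ℤ.≤-trans (ℤ.i≤i+j (rel T y) (+ 4))
          (ℤ.≤-reflexive (raised T∈ T′∈)))
        below T∈ T′∈ (there x∈)  = ℤ.≤-reflexive (cong (ℤ._+ + 0) (same T∈ T′∈ x∈))
      -- The roles are exchanged: raised by 4, the heights of `Us` equal those of `Us′` at `y` and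
      -- exceed them by 4 on `xs`.
      upper′ : (b + m * fromℤ (+ 0)) * n ≤ m * (a + n * four)
      upper′ = subst₂ _≤_ (cong (_* n) (sum-lift (+ 0) Us′)) (cong (m *_) (sum-lift (+ 4) Us))
        (cylinder-monotone {s = + 0} {+ 4} (+ 1) refl c′ c (there v∈) w-vertex below)
        where
        below : ∀ {T T′} → T ∈ Us′ → T′ ∈ Us → ∀ {x} → x ∈ y ∷ xs → lift (+ 0) T x ℤ.≤ lift
          (+ 4) T′ x
        below {T} T∈ T′∈ (here refl) = ℤ.≤-reflexive (trans (ℤ.+-identityʳ (rel T y))
          (sym (raised T′∈ T∈)))
        below {T} {T′} T∈ T′∈ {x} (there x∈) = ℤ.≤-trans
          (ℤ.≤-reflexive (trans (ℤ.+-identityʳ (rel T x)) (sym (same T′∈ T∈ x∈))))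
          (ℤ.i≤i+j (rel T′ x) (+ 4))

    -- The question at each edge is whether the next height takes the lower of its two possible
    -- values. If the path returns to a vertex in `xs`, the answer is already known and one part is
    -- empty. At the end of the path the height at `w` is fixed.
    revealed : ∀ {u xs Us} (p : Path R u w) → u ∈ xs → v ∈ xs → Cylinder xs Us
      → Revealed (steps p) Us
    revealed (stop _) u∈ v∈ c = done λ {T} {T′} T∈ T′∈ →
      trans (X≡-Y T) (trans (cong (λ i → - fromℤ i) (constant c T∈ T′∈ u∈)) (sym (X≡-Y T′)))
    revealed {u} {xs} {Us} (go d e p) u∈ v∈ c = reveal low? (cylinder-difference (filter low? Us)
      (filter (∁? low?) Us) cˡ cʰ v∈ same raised)
      (revealed p (here refl) (there v∈) cˡ) (revealed p (here refl) (there v∈) cʰ)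
      where
      open ℤ-Solver using (solve; _:+_; _:-_; _:*_; :-_; con; _:=_)
      y = step d u
      b = black (leftOf d u)
      y-vertex = edge-target R {d} {u} e
      low? : Decidable (λ T → rel T y ≡ rel T u ℤ.+ lowRise b)
      low? T = rel T y ℤ.≟ rel T u ℤ.+ lowRise b
      high : ∀ {T} → T ∈ Us → ¬ (rel T y ≡ rel T u ℤ.+ lowRise b) → rel T y ≡ rel T u ℤ.+ lowRise b
        ℤ.+ + 4
      high {T} T∈ not-low with edge-rise (shift-height (ℤ.- H T v) (isHeightFunction
        (heightOf T (included c T∈)))) d u e
      ... | l , eq with rise-low-or-high b l
      ...   | inj₁ low = contradiction (trans eq (cong (ℤ._+_ (rel T u)) low)) not-low
      ...   | inj₂ hi  = trans eq (trans (cong (ℤ._+_ (rel T u)) hi)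
        (sym (ℤ.+-assoc (rel T u) (lowRise b) (+ 4))))
      cˡ : Cylinder (y ∷ xs) (filter low? Us)
      cˡ = cylinder-filter low? c y-vertex
        (λ T∈ T′∈ low eq → trans (sym eq) (trans low (cong (ℤ._+ lowRise b)
          (constant c T∈ T′∈ u∈))))
        (λ T∈ T′∈ low low′ → trans low (trans (cong (ℤ._+ lowRise b) (constant c T∈ T′∈ u∈))
          (sym low′)))
      cʰ : Cylinder (y ∷ xs) (filter (∁? low?) Us)
      cʰ = cylinder-filter (∁? low?) c y-vertex
        (λ T∈ T′∈ not-low eq low′ → not-low (trans eq (trans low′ (cong (ℤ._+ lowRise b)
          (sym (constant c T∈ T′∈ u∈))))))
        (λ T∈ T′∈ n n′ → trans (high T∈ n) (trans (cong (λ i → i ℤ.+ lowRise b ℤ.+ + 4)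
          (constant c T∈ T′∈ u∈)) (sym (high T′∈ n′))))
      same : ∀ {T T′} → T ∈ filter low? Us → T′ ∈ filter (∁? low?) Us → ∀ {x} → x ∈ xs → rel T x
        ≡ rel T′ x
      same T∈ T′∈ = constant c (proj₁ (∈-filter⁻ low? {xs = Us} T∈))
        (proj₁ (∈-filter⁻ (∁? low?) {xs = Us} T′∈))
      raised : ∀ {T T′} → T ∈ filter low? Us → T′ ∈ filter (∁? low?) Us → rel T y ℤ.+ + 4 ≡ rel T′ y
      raised T∈ T′∈ =
        let T∈Us , low = ∈-filter⁻ low? {xs = Us} T∈ ; T′∈Us , n = ∈-filter⁻ (∁? low?) {xs = Us} T′∈
        in trans (cong (ℤ._+ + 4) (trans low (cong (ℤ._+ lowRise b) (constant c T∈Us T′∈Us u∈))))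
           (sym (high T′∈Us n))

-- The concentration inequality

module _ {A : Set} where

  markov : ∀ {P : Pred A 0ℓ} (P? : Decidable P) {f c} xs → (∀ {x} → x ∈ xs → 0ℚ ≤ f x) →
    (∀ {x} → x ∈ xs → P x → c ≤ f x) →
    size (filter P? xs) * c ≤ sumOf f xs
  markov P? {c = c} [] _ _ = ≤-reflexive (*-zeroˡ c)
  markov P? {f} {c} (x ∷ xs) 0≤f c≤f with P? x
  ... | yes px = ≤-trans (≤-reflexive (trans (cong (_* c) (fromℕ-suc (length (filter P? xs))))
      (solve 2 (λ n c → (n :+ con 1ℚ) :* c := c :+ n :* c) refl (size (filter P? xs)) c)))
    (+-mono-≤ (c≤f (here refl) px) (markov P? {f} xs (0≤f ∘ there) (c≤f ∘ there)))
    where open ℚ-Solver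
  ... | no  _  = ≤-trans (markov P? {f} xs (0≤f ∘ there) (c≤f ∘ there))
    (≤-trans (≤-grow {sumOf f xs} {f x} (0≤f (here refl))) (≤-reflexive (+-comm (sumOf f xs)
      (f x))))

  sumOf-fromℤ : ∀ (X : A → ℤ) xs → fromℤ (foldr ℤ._+_ (+ 0) (map X xs)) ≡ sumOf (fromℤ ∘ X) xs
  sumOf-fromℤ X []       = refl
  sumOf-fromℤ X (x ∷ xs) = trans (fromℤ-+ (X x) (foldr ℤ._+_ (+ 0) (map X xs)))
    (cong (_+_ (fromℤ (X x))) (sumOf-fromℤ X xs))

fromℤ-+≡fromℕ : ∀ n → fromℤ (+ n) ≡ fromℕ n
fromℤ-+≡fromℕ n = ↥p/↧p≡p (fromℕ n)

size-*-𝔼 : ∀ R X → size (tilings (squares R)) * 𝔼 R X ≡ sumOf (fromℤ ∘ X) (tilings (squares R))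
size-*-𝔼 R X = trans (fromℕ-*-/ (foldr ℤ._+_ (+ 0) (map X (tilings (squares R)))) (#tilings R)
  {{#tilings-nonZero R}}) (sumOf-fromℤ X (tilings (squares R)))

size-*-ℙ : ∀ R {A : Pred Tiling 0ℓ} (A? : Decidable A) → size (tilings (squares R)) * ℙ R A?
  ≡ size (filter A? (tilings (squares R)))
size-*-ℙ R A? = trans (fromℕ-*-/ (+ length (filter A? (tilings (squares R)))) (#tilings R)
  {{#tilings-nonZero R}}) (fromℤ-+≡fromℕ _)

0<size : ∀ R → 0ℚ < size (tilings (squares R))
0<size R = positive-fromℕ (#tilings R) {{#tilings-nonZero R}}
  where
  positive-fromℕ : ∀ n .{{_ : ℕ.NonZero n}} → 0ℚ < fromℕ n
  positive-fromℕ (suc n) = 0<fromℕ-suc n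

averages-translate : ∀ a n g y x → Average.averages a n (λ x → g (x - y)) x ≡ Average.averages a n g
  (x - y)
averages-translate a zero    g y x = refl
averages-translate a (suc n) g y x = cong (½ *_) (cong₂ _+_
  (trans (averages-translate a n g y (x - a)) (cong (Average.averages a n g) (shift x y (- a))))
  (trans (averages-translate a n g y (x + a)) (cong (Average.averages a n g) (shift x y a))))
  where
  open ℚ-Solver
  shift : ∀ x y z → x + z - y ≡ x - y + z
  shift = solve 3 (λ x y z → x :+ z :- y := x :- y :+ z) refl

-- Azuma's inequality, with the truncated series of cosh in place of the exponential.
azuma : ∀ {A : Set} (X : A → ℚ) a (0<a : 0ℚ < a) {n xs μ} → Martingale.Revealed X a 0<a n xs
  → size xs * μ ≡ sumOf X xs →
  ∀ {P : Pred A 0ℓ} (P? : Decidable P) τ q → 0ℚ ≤ τ → 0ℚ ≤ q → (∀ {x} → x ∈ xs → P x → q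
    ≤ τ * ((X x - μ) * (X x - μ))) →
  ∀ k → size (filter P? xs) * evenSum q k ≤ size xs * expSum (τ * (fromℕ n * (½ * (a * a)))) k
azuma X a 0<a {n} {xs} {μ} r mean P? τ q 0≤τ 0≤q large k = begin
  size (filter P? xs) * evenSum q k
    ≤⟨ markov P? {f ∘ X} xs (λ {x} _ → evenSum-nonNeg (τ * ((X x - μ) * (X x - μ)))
      (0≤* {τ} {(X x - μ) * (X x - μ)} 0≤τ (0≤x² (X x - μ))) k)
         (λ {x} x∈ px → evenSum-mono q (τ * ((X x - μ) * (X x - μ))) 0≤q (large x∈ px) k) ⟩
  sumOf (f ∘ X) xs
    ≤⟨ Martingale.revealed-bound X a 0<a {g = f} r (chord-translate {g} μ
      (chord-evenSum 0<a τ 0≤τ k)) μ mean ⟩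
  size xs * averages n f μ
    ≡⟨ cong (size xs *_) (trans (averages-translate a n g μ μ) (cong (averages n g)
      (+-inverseʳ μ))) ⟩
  size xs * averages n g 0ℚ
    ≤⟨ *-monoˡ {size xs} {averages n g 0ℚ} {expSum (τ * (fromℕ n * (½ * (a * a)))) k}
      (0≤fromℕ (length xs)) (averages-evenSum τ 0≤τ n k) ⟩
  size xs * expSum (τ * (fromℕ n * (½ * (a * a)))) k ∎
  where
  open ≤-Reasoning
  open Average a
  g f : ℚ → ℚ
  g x = evenSum (τ * (x * x)) k
  f x = g (x - μ)

-- The approximation is a rounded-down multiple of `inv n`, so one more unit passes the root.
√-above : ∀ m n → fromℕ m ≤ (seq (√ m) n + inv n) * (seq (√ m) n + inv n)
√-above m n = *-cancelʳ-≤-pos (M * M) {{ℚ.positive (0<* {M} {M} (0<fromℕ-suc n) (0<fromℕ-suc n))}}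
  (begin
  fromℕ m * (M * M)                       ≡⟨ trans (cong (fromℕ m *_)
    (sym (fromℕ-* (suc n) (suc n)))) (sym (fromℕ-* m (suc n ℕ.* suc n))) ⟩
  fromℕ (m ℕ.* (suc n ℕ.* suc n))         ≤⟨ fromℕ-mono
    (ℕ.<⇒≤ (isqrt-upper (m ℕ.* (suc n ℕ.* suc n)))) ⟩
  fromℕ (suc r ℕ.* suc r)                 ≡⟨ trans (fromℕ-* (suc r) (suc r)) (cong (λ s → s * s)
    (fromℕ-suc r)) ⟩
  (fromℕ r + 1ℚ) * (fromℕ r + 1ℚ)         ≡⟨ cong (λ s → s * s) (*-inv (fromℕ r + 1ℚ) n) ⟨
  M * (fromℕ r + 1ℚ) * i * (M * (fromℕ r + 1ℚ) * i)
    ≡⟨ solve 3 (λ M r i → M :* (r :+ con 1ℚ) :* i :* (M :* (r :+ con 1ℚ) :* i)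
      := (r :* i :+ i) :* (r :* i :+ i) :* (M :* M)) refl M (fromℕ r) i ⟩
  (fromℕ r * i + i) * (fromℕ r * i + i) * (M * M) ∎)
  where
  open ≤-Reasoning
  open ℚ-Solver using (solve; _:+_; _:-_; _:*_; :-_; con; _:=_)
  M = fromℕ (suc n)
  i = inv n
  r = isqrt (m ℕ.* (suc n ℕ.* suc n))

√-nonNeg : ∀ m n → 0ℚ ≤ seq (√ m) n
√-nonNeg m n = 0≤* {fromℕ r} {inv n} (0≤fromℕ r) (0≤inv n)
  where r = isqrt (m ℕ.* (suc n ℕ.* suc n))

-- At a late index the rounding error `c₀ * inv n` of the root is absorbed by the gap `ε` of the
-- strict inequality; squaring then removes the root.
square-above : ∀ (c : ℝ) m c₀ x → 0ℚ ≤ c₀ → (∃ λ N₀ → ∀ n → N₀ ℕ.≤ n → c₀ ≤ seq c n) →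
  c *ℝ √ m <ℝ fromℚ ∣ x ∣ → c₀ * c₀ * fromℕ m ≤ x * x
square-above c m c₀ x 0≤c₀ (N₁ , c₀≤c) (ε , 0<ε , N₂ , above) = begin
  c₀ * c₀ * fromℕ m                ≤⟨ *-monoˡ {c₀ * c₀} {fromℕ m} {(s + inv n) * (s + inv n)}
    (0≤x² c₀) (√-above m n) ⟩
  c₀ * c₀ * ((s + inv n) * (s + inv n)) ≡⟨ solve 2 (λ c t → c :* c :* (t :* t)
    := (c :* t) :* (c :* t)) refl c₀ (s + inv n) ⟩
  y * y                            ≤⟨ *-mono {y} {∣ x ∣} {y} {∣ x ∣} 0≤y (0≤∣p∣ x) y≤∣x∣ y≤∣x∣ ⟩
  ∣ x ∣ * ∣ x ∣                    ≡⟨ ∣p*q∣≡∣p∣*∣q∣ x x ⟨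
  ∣ x * x ∣                        ≡⟨ 0≤p⇒∣p∣≡p (0≤x² x) ⟩
  x * x                            ∎
  where
  open ≤-Reasoning
  open ℚ-Solver using (solve; _:+_; _:-_; _:*_; :-_; con; _:=_)
  v = vanish c₀ ε 0≤c₀ 0<ε
  n = N₁ ℕ.+ (N₂ ℕ.+ proj₁ v)
  s = seq (√ m) n
  y = c₀ * (s + inv n)
  0≤y : 0ℚ ≤ y
  0≤y = 0≤* {c₀} {s + inv n} 0≤c₀ (0≤+ {s} {inv n} (√-nonNeg m n) (0≤inv n))
  y≤∣x∣ : y ≤ ∣ x ∣
  y≤∣x∣ = ≤-trans (≤-reflexive (*-distribˡ-+ c₀ s (inv n))) (≤-trans
    (+-mono-≤ (*-monoʳ {s} {c₀} {seq c n} (√-nonNeg m n) (c₀≤c n (ℕ.m≤m+n N₁ _)))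
              (proj₂ v n (ℕ.≤-trans (ℕ.m≤n+m (proj₁ v) N₂) (ℕ.m≤n+m _ N₁))))
    (above n (ℕ.≤-trans (ℕ.m≤m+n N₂ (proj₁ v)) (ℕ.m≤n+m _ N₁))))

1/32 1/16 : ℚ
1/32 = + 1 / 32
1/16 = + 1 / 16

-- c₀ is so close to c that replacing c by c₀ loses less than is gained from the
-- path having one edge less than vertices.
below-limit : ∀ (c : ℝ) → fromℚ 0ℚ <ℝ c → ∀ m → ∃ λ c₀ → 0ℚ < c₀ × ∃ λ N₀ → ∀ n → N₀ ℕ.≤ n →
  c₀ ≤ seq c n × fromℕ (suc m) * (seq c n * seq c n) ≤ fromℕ (suc (suc m)) * (c₀ * c₀)
below-limit c (ε , 0<ε , N₁ , positive) m = c₀ , 0<c₀ , k , λ n k≤n →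
    let d = seq c n - c₀
        bounds = ∣p∣≤q⇒0≤q±p (seq c n - seq c k) δ (proj₂ (cauchy c δ 0<δ) n k
          (ℕ.≤-trans (ℕ.m≤n+m N₂ N₁) k≤n) (ℕ.m≤n+m N₂ N₁))
        0≤d : 0ℚ ≤ d
        0≤d = ≤-trans (proj₂ bounds) (≤-reflexive (solve 3 (λ x y δ → δ :+ (x :- y)
          := x :- (y :- δ)) refl (seq c n) (seq c k) δ))
        d≤2δ : d ≤ δ + δ
        d≤2δ = ≤-by {d} {δ + δ} (δ - (seq c n - seq c k)) (proj₁ bounds)
          (solve 3 (λ x y δ → (x :- (y :- δ)) :+ (δ :- (x :- y)) := δ :+ δ) refl (seq c n)
            (seq c k) δ)
    in ≤-by {c₀} {seq c n} d 0≤d (solve 2 (λ x y → y :+ (x :- y) := x) refl (seq c n) c₀) ,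
       close n d 0≤d d≤2δ (solve 2 (λ x y → x := y :+ (x :- y)) refl (seq c n) c₀)
  where
  open ℚ-Solver using (solve; _:+_; _:-_; _:*_; :-_; con; _:=_)
  M = fromℕ (suc m)
  0≤M : 0ℚ ≤ M
  0≤M = 0≤fromℕ (suc m)
  1≤M : 1ℚ ≤ M
  1≤M = fromℕ-mono {1} {suc m} (s≤s z≤n)
  -- As `seq c n` exceeds `c₀` by at most `2 δ` and `2 δ ≤ 2 c₀`, the squares differ by at most
  -- `2 δ * 4 c₀`, and `8 M δ ≤ c₀` makes `M` times this at most `c₀ * c₀`. The summand 1 makes up
  -- for the `δ` subtracted in `c₀`.
  K = fromℕ 8 * M + 1ℚ
  0≤8M : 0ℚ ≤ fromℕ 8 * M
  0≤8M = 0≤* {fromℕ 8} {M} (0≤fromℕ 8) 0≤M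
  small = shrink K ε (0≤+ {fromℕ 8 * M} {1ℚ} 0≤8M 0≤1) 0<ε
  δ = proj₁ small
  0<δ = proj₁ (proj₂ small)
  0≤δ = <⇒≤ 0<δ
  N₂ = proj₁ (cauchy c δ 0<δ)
  k = N₁ ℕ.+ N₂
  c₀ = seq c k - δ
  8Mδ≤c₀ : fromℕ 8 * M * δ ≤ c₀
  8Mδ≤c₀ = ≤-by {fromℕ 8 * M * δ} {c₀} ((seq c k - ε) + (ε - δ * K))
    (0≤+ {seq c k - ε} {ε - δ * K} (p≤q⇒0≤q-p (≤-trans (≤-reflexive (sym (+-identityˡ ε)))
      (positive k (ℕ.m≤m+n N₁ N₂)))) (p≤q⇒0≤q-p (proj₂ (proj₂ small))))
    (solve 4 (λ a δ x ε → a :* δ :+ ((x :- ε) :+ (ε :- δ :* (a :+ con 1ℚ))) := x :- δ) refl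
      (fromℕ 8 * M) δ (seq c k) ε)
  8δ≤c₀ : fromℕ 8 * δ ≤ c₀
  8δ≤c₀ = ≤-trans (*-monoʳ {δ} {fromℕ 8} {fromℕ 8 * M} 0≤δ
    (≤-trans (≤-reflexive (sym (*-identityʳ (fromℕ 8)))) (*-monoˡ {fromℕ 8} {1ℚ} {M}
    (0≤fromℕ 8) 1≤M))) 8Mδ≤c₀
  0<c₀ : 0ℚ < c₀
  0<c₀ = <-≤-trans (0<* {fromℕ 8} {δ} (0<fromℕ-suc 7) 0<δ) 8δ≤c₀
  close : ∀ n d → 0ℚ ≤ d → d ≤ δ + δ → seq c n ≡ c₀ + d → M * (seq c n * seq c n)
    ≤ fromℕ (suc (suc m)) * (c₀ * c₀)
  close n d 0≤d d≤2δ eq = begin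
    M * (seq c n * seq c n)             ≡⟨ cong (λ x → M * (x * x)) eq ⟩
    M * ((c₀ + d) * (c₀ + d))           ≡⟨ solve 3 (λ M c d → M :* ((c :+ d) :* (c :+ d))
      := M :* (c :* c) :+ M :* (d :* (c :+ c :+ d))) refl M c₀ d ⟩
    M * (c₀ * c₀) + M * (d * (c₀ + c₀ + d))
      ≤⟨ +-monoʳ-≤ (M * (c₀ * c₀)) (*-monoˡ {M} {d * (c₀ + c₀ + d)}
        {(δ + δ) * (c₀ + c₀ + (c₀ + c₀))} 0≤M
           (*-mono {d} {δ + δ} {c₀ + c₀ + d} {c₀ + c₀ + (c₀ + c₀)} (0≤+ {c₀ + c₀} {d} 0≤2c₀ 0≤d)
             (0≤+ {δ} {δ} 0≤δ 0≤δ) d≤2δ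
             (+-monoʳ-≤ (c₀ + c₀) (≤-trans d≤2δ
               (≤-trans 2δ≤8δ (≤-trans 8δ≤c₀ (≤-grow {c₀} {c₀} 0≤c₀))))))) ⟩
    M * (c₀ * c₀) + M * ((δ + δ) * (c₀ + c₀ + (c₀ + c₀)))
      ≡⟨ solve 3 (λ M c δ → M :* (c :* c) :+ M :* ((δ :+ δ) :* (c :+ c :+ (c :+ c)))
        := M :* (c :* c) :+ (con (fromℕ 8) :* M :* δ) :* c) refl M c₀ δ ⟩
    M * (c₀ * c₀) + (fromℕ 8 * M * δ) * c₀
      ≤⟨ +-monoʳ-≤ (M * (c₀ * c₀)) (*-monoʳ {c₀} {fromℕ 8 * M * δ} {c₀} 0≤c₀ 8Mδ≤c₀) ⟩
    M * (c₀ * c₀) + c₀ * c₀             ≡⟨ solve 2 (λ M c → M :* (c :* c) :+ c :* c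
      := (M :+ con 1ℚ) :* (c :* c)) refl M c₀ ⟩
    (M + 1ℚ) * (c₀ * c₀)                ≡⟨ cong (_* (c₀ * c₀)) (fromℕ-suc (suc m)) ⟨
    fromℕ (suc (suc m)) * (c₀ * c₀)     ∎
    where
    open ≤-Reasoning
    0≤c₀ = <⇒≤ 0<c₀
    0≤2c₀ : 0ℚ ≤ c₀ + c₀
    0≤2c₀ = 0≤+ {c₀} {c₀} 0≤c₀ 0≤c₀
    2δ≤8δ : δ + δ ≤ fromℕ 8 * δ
    2δ≤8δ = ≤-by {δ + δ} {fromℕ 8 * δ} (fromℕ 6 * δ) (0≤* {fromℕ 6} {δ} (0≤fromℕ 6) 0≤δ)
      (solve 1 (λ δ → (δ :+ δ) :+ con (fromℕ 6) :* δ := con (fromℕ 8) :* δ) refl δ)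

proposition22 : (black : Square → Bool) → IsCheckerboard black →
    (R : Region) → SimplyConnected R →
    (v w : Vertex) → Interior R v → Interior R w →
    (m : ℕ) (p : Path R v w) → length (vertices p) ≡ m →
    (H : Tiling → Vertex → ℤ) → (∀ T → T ∈ tilings (squares R) → IsHeightOf R black T (H T)) →
    (c : ℝ) → fromℚ 0ℚ <ℝ c →
    ProbabilityLessThan R
    (DiffersFromMeanByMoreThan R (λ T → H T v ℤ.- H T w) (c *ℝ (√ m)))
    (fromℚ (+ 2 / 1) *ℝ exp (-ℝ ((c *ℝ c) *ℝ fromℚ (+ 1 / 32))))
proposition22 black checkerboard R sc v w (v∈ ∷ _) (w∈ ∷ _) m p refl H heightOf c 0<c {A} A? A⊆ =
  subst (λ k → (∀ T → T ∈ Ts → A T → c *ℝ √ k <ℝ fromℚ ∣ X T - 𝔼 R Xℤ ∣) → fromℚ P <ℝ bound)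
    (sym (length-vertices p)) main A⊆
  where
  open ℚ-Solver using (solve; _:+_; _:-_; _:*_; :-_; con; _:=_)
  open TilingHeights black checkerboard R (SimplyConnected.connected sc) v
    (here v∈) H heightOf using (cylinder-start; revealed)
  Ts = tilings (squares R)
  Xℤ : Tiling → ℤ
  Xℤ T = H T v ℤ.- H T w
  X : Tiling → ℚ
  X T = fromℤ (Xℤ T)
  P = ℙ R A?
  bound = fromℚ (+ 2 / 1) *ℝ exp (-ℝ ((c *ℝ c) *ℝ fromℚ 1/32))
  n = steps p
  limit = below-limit c 0<c n
  c₀ = proj₁ limit
  0≤c₀ = <⇒≤ (proj₁ (proj₂ limit))
  N₀ = proj₁ (proj₂ (proj₂ limit))
  near = proj₂ (proj₂ (proj₂ limit))
  M = fromℕ (suc n)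
  i = inv n
  Mi≡1 : M * i ≡ 1ℚ
  Mi≡1 = *-inverseʳ M
  -- With λ = c₀ / (16 √M), the three quantities are `z` = λ c₀ √M, the threshold on the scale of λ;
  -- `τ` = λ²; and `q` = n λ² 4² / 2. The martingale has `n` steps, whereas λ is chosen for the
  -- `M = n + 1` vertices.
  z = c₀ * c₀ * 1/16
  0≤z : 0ℚ ≤ z
  0≤z = 0≤* {c₀ * c₀} {1/16} (0≤x² c₀) (<⇒≤ (positive⁻¹ 1/16))
  τ = z * 1/16 * i
  0≤τ : 0ℚ ≤ τ
  0≤τ = 0≤* {z * 1/16} {i} (0≤* {z} {1/16} 0≤z (<⇒≤ (positive⁻¹ 1/16))) (0≤inv n)
  q = τ * (fromℕ n * (½ * (four * four)))
  0≤q : 0ℚ ≤ q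
  0≤q = 0≤* {τ} {fromℕ n * (½ * (four * four))} 0≤τ (0≤* {fromℕ n} {½ * (four * four)} (0≤fromℕ n)
    (0≤* {½} {four * four} (<⇒≤ (positive⁻¹ ½)) (0≤x² four)))
  y : ℕ → ℚ
  y k = seq c k * seq c k * 1/32
  0≤P : 0ℚ ≤ P
  0≤P = 0≤-cancelˡ {size Ts} {P} (0<size R) (≤-trans (0≤fromℕ (length (filter A? Ts)))
    (≤-reflexive (sym (size-*-ℙ R A?))))
  main : (∀ T → T ∈ Ts → A T → c *ℝ √ (suc n) <ℝ fromℚ ∣ X T - 𝔼 R Xℤ ∣) → fromℚ P <ℝ bound
  main A⊆ = exp-bound P z q y N₀ 0≤P 0≤z 0≤q (λ k N₀≤k → 0≤* {seq c k * seq c k} {1/32}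
    (0≤x² (seq c k)) (<⇒≤ (positive⁻¹ 1/32)) , q+y≤z k (proj₂ (near k N₀≤k)))
      (λ k → *-cancelˡ-≤-pos (size Ts) {{ℚ.positive (0<size R)}} (begin
        size Ts * (P * evenSum (z * z) k)          ≡⟨ *-assoc (size Ts) P (evenSum (z * z) k) ⟨
        size Ts * P * evenSum (z * z) k            ≡⟨ cong (_* evenSum (z * z) k) (size-*-ℙ R A?) ⟩
        size (filter A? Ts) * evenSum (z * z) k    ≤⟨ azuma X four _ (revealed w (here w∈) p
          (here refl) (here refl) cylinder-start) (size-*-𝔼 R Xℤ) A? τ (z * z) 0≤τ
          (0≤x² z) large k ⟩
        size Ts * expSum q k                       ∎))
    where
    open ≤-Reasoning
    large : ∀ {T} → T ∈ Ts → A T → z * z ≤ τ * ((X T - 𝔼 R Xℤ) * (X T - 𝔼 R Xℤ))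
    large {T} T∈ a = begin
      z * z                                ≡⟨ *-identityʳ (z * z) ⟨
      z * z * 1ℚ                           ≡⟨ cong (z * z *_) Mi≡1 ⟨
      z * z * (M * i)                      ≡⟨ solve 4 (λ z c M i → z :* (c :* con 1/16) :* (M :* i)
        := z :* con 1/16 :* i :* (c :* M)) refl z (c₀ * c₀) M i ⟩
      τ * (c₀ * c₀ * M)                    ≤⟨ *-monoˡ {τ} {c₀ * c₀ * M} {(X T - 𝔼 R Xℤ)
        * (X T - 𝔼 R Xℤ)} 0≤τ
                                                (square-above c (suc n) c₀ (X T - 𝔼 R Xℤ) 0≤c₀
                                                  (N₀ , λ k N₀≤k → proj₁ (near k N₀≤k))
                                                  (A⊆ T T∈ a)) ⟩
      τ * ((X T - 𝔼 R Xℤ) * (X T - 𝔼 R Xℤ)) ∎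
    -- Multiplied by `32 M`, the claim reads `n c₀² + M c² ≤ 2 M c₀²`, and `2 M - n = n + 2` is the
    -- factor of `c₀²` in the hypothesis.
    q+y≤z : ∀ k → M * (seq c k * seq c k) ≤ fromℕ (suc (suc n)) * (c₀ * c₀) → q + y k ≤ z
    q+y≤z k close = *-cancelˡ-≤-pos M {{ℚ.positive (0<fromℕ-suc n)}} (begin
      M * (q + y k)
        ≡⟨ solve 5 (λ M c i n s → M :* (c :* con 1/16 :* con 1/16 :* i :* (n :* con
          (½ * (four * four))) :+ s :* con 1/32)
             := con 1/32 :* (M :* i :* (n :* c) :+ M :* s)) refl M (c₀ * c₀) i (fromℕ n)
               (seq c k * seq c k) ⟩
      1/32 * (M * i * (fromℕ n * (c₀ * c₀)) + M * (seq c k * seq c k))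
        ≡⟨ cong (λ t → 1/32 * (t * (fromℕ n * (c₀ * c₀)) + M * (seq c k * seq c k))) Mi≡1 ⟩
      1/32 * (1ℚ * (fromℕ n * (c₀ * c₀)) + M * (seq c k * seq c k))
        ≤⟨ *-monoˡ {1/32} {1ℚ * (fromℕ n * (c₀ * c₀)) + M * (seq c k * seq c k)}
          {1ℚ * (fromℕ n * (c₀ * c₀)) + fromℕ (suc (suc n)) * (c₀ * c₀)}
             (<⇒≤ (positive⁻¹ 1/32)) (+-monoʳ-≤ (1ℚ * (fromℕ n * (c₀ * c₀))) close) ⟩
      1/32 * (1ℚ * (fromℕ n * (c₀ * c₀)) + fromℕ (suc (suc n)) * (c₀ * c₀))
        ≡⟨ cong (λ t → 1/32 * (1ℚ * (fromℕ n * (c₀ * c₀)) + t * (c₀ * c₀)))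
          (trans (fromℕ-suc (suc n)) (cong (_+ 1ℚ) (fromℕ-suc n))) ⟩
      1/32 * (1ℚ * (fromℕ n * (c₀ * c₀)) + (fromℕ n + 1ℚ + 1ℚ) * (c₀ * c₀))
        ≡⟨ solve 2 (λ n c → con 1/32 :* (con 1ℚ :* (n :* c) :+ (n :+ con 1ℚ :+ con 1ℚ) :* c)
          := (n :+ con 1ℚ) :* (c :* con 1/16)) refl (fromℕ n) (c₀ * c₀) ⟩
      (fromℕ n + 1ℚ) * z
        ≡⟨ cong (_* z) (fromℕ-suc n) ⟨
      M * z ∎)
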